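{- For any integer $\ell\ge2$ and any constant $0<c<\frac{1}{3\ell-2}$, we have, as $n\to\infty$, \[g(n;2\ell,cn)\ge\frac12\left(\frac{3\ell-5}{3\ell-2}+c-c^2-o(1)\right)n^2.\]
   Context: A red/blue/purple colouring of $K_n$ is a partition $R\cup B\cup P$ of its edge set. For integers $s,t\ge2$ and $n<R(s,t)$, $g(n;s,t)$ is the largest integer $g$ such that some red/blue/purple colouring of $K_n$ has $|P|=g$, $R\cup P$ is $K_s$-free and $B\cup P$ is $K_t$-free; for non-integer arguments $g(n;s,t):=g(n;\lceil s\rceil,\lceil t\rceil)$.
   Formalization: The constant c is taken to be rational rather than real; the real case follows by taking a rational c' slightly below c, since g(n;s,t) is nondecreasing in t and c−c² is continuous. -}

module Defs where

open import Data.Nat as ℕ using (ℕ; zero; suc; _<ᵇ_)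
open import Data.Bool using (Bool; true; false; _∧_; if_then_else_)
open import Data.Fin using (Fin; toℕ)
open import Data.List using (List; map; allFin)
open import Data.Nat.ListAction using (sum)
open import Data.Product using (Σ; _×_; _,_)
open import Data.Sum using (_⊎_)
open import Data.Integer as ℤ using (ℤ; +_)
open import Data.Rational as ℚ using (ℚ; _/_; ceiling)
open import Function.Definitions using (Injective)
open import Relation.Binary.PropositionalEquality using (_≡_; _≢_)
open import Relation.Nullary using (¬_)

data Colour : Set where
  red blue purple : Colour

-- A red/blue/purple colouring of the edges of K_n on vertex set Fin n:
-- a symmetric colour assignment to pairs of vertices (diagonal values
-- are never used).
record Colouring (n : ℕ) : Set where
  field
    colour : Fin n → Fin n → Colour
    symm   : ∀ x y → colour x y ≡ colour y x
open Colouring public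

InRP : Colour → Set
InRP c = (c ≡ red) ⊎ (c ≡ purple)

InBP : Colour → Set
InBP c = (c ≡ blue) ⊎ (c ≡ purple)

HasClique : ∀ {n} → (Colour → Set) → ℕ → Colouring n → Set
HasClique {n} Allowed s χ =
  Σ (Fin s → Fin n) λ f →
    Injective _≡_ _≡_ f × (∀ a b → a ≢ b → Allowed (colour χ (f a) (f b)))

RPCliqueFree : ∀ {n} → ℕ → Colouring n → Set
RPCliqueFree s χ = ¬ HasClique InRP s χ

BPCliqueFree : ∀ {n} → ℕ → Colouring n → Set
BPCliqueFree t χ = ¬ HasClique InBP t χ

isPurple : Colour → Bool
isPurple purple = true
isPurple _      = false

purpleCount : ∀ {n} → Colouring n → ℕ
purpleCount {n} χ =
  sum (map (λ i → sum (map (λ j →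
         if (toℕ i <ᵇ toℕ j) ∧ isPurple (colour χ i j) then 1 else 0)
       (allFin n))) (allFin n))

Admissible : ∀ {n} → ℕ → ℕ → Colouring n → Set
Admissible s t χ = RPCliqueFree s χ × BPCliqueFree t χ

-- ⌈ x ⌉ as a natural number (used for x ≥ 0, where it is exact).
ceilℕ : ℚ → ℕ
ceilℕ x = ℤ.∣ ceiling x ∣

ℕtoℚ : ℕ → ℚ
ℕtoℚ n = + n / 1

-- a / b as a rational for naturals (b = 0 mapped to 0; only used with b > 0).
ratℕ : ℕ → ℕ → ℚ
ratℕ a zero    = ℚ.0ℚ
ratℕ a (suc b) = + a / suc b

{-# OPTIONS --safe #-}
module Submission where

-- Write A = 3ℓ − 2, and give all sizes as fractions of n. The vertex set is X ∪ Y ∪ Z₁ ∪ Z₂ ∪ V₃ ∪ … ∪ V_ℓ with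
-- |Z₁| = |Z₂| = c, |X| = |Y| = 2/A − c and |Vᵢ| = 3/A (all up to o(1)). Red is sparse, but it meets every large
-- set that has to be met.
--
-- X–Y is a Bollobás–Erdős graph: x, x′ ∈ X are red when nearly antipodal, likewise in Y, and x ∈ X, y ∈ Y are
-- purple when ⟨x , y⟩ exceeds a threshold μ. A K₄ on x, x′, y, y′ would give 4μ < ⟨x + x′ , y + y′⟩, which
-- Cauchy–Schwarz forbids. Instead of a sphere, X is a power of the boundary of the square [-M , M]² and Y a power
-- of {±1}². Both are products of paths, so a Poincaré inequality applied to the truncated squared distance to a
-- set shows that two sets of positive density contain nearly antipodal points. Each point of the square boundary
-- has a coordinate ±M, so ⟨x , y⟩ contains a simple random walk with steps ±M, and the central binomial
-- coefficient bounds the number of pairs with |⟨x , y⟩| ≤ μ; purple X–Y pairs therefore have density 1/2 − o(1).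
--
-- The pairs X–Z₁, Y–Z₂ and Z₁–Z₂ are purple, and so are all pairs between Vᵢ and the rest; pairs at nearly
-- antipodal points of the last two types are red instead. Inside Vᵢ, a circle times Y, purple joins nearly
-- opposite positions (an arc of length c) unless the points of Y are close, and red joins nearly antipodal
-- points whose positions do not have a common purple neighbour; this is triangle-free because c is less than
-- 1/A, a third of the circle. A clique has at most 3 vertices in X ∪ Y ∪ Z₁ ∪ Z₂ and 2 in each Vᵢ. A set without red pairs is, up
-- to o(n), contained in Z₁, in Z₂, or in an arc of length c of one circle.
--
-- All this is a colouring of a fixed finite set, which is blown up to n vertices.

open import Defs
open import Data.Bool using (Bool; true; false; not; if_then_else_; _∧_)
open import Data.Bool.Properties using (not-involutive) renaming (_≟_ to _≟ᵇ_)
open import Data.Empty using (⊥; ⊥-elim)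
open import Data.Fin using (Fin; zero; suc; toℕ)
import Data.Fin as Fin
import Data.Fin.Properties as Finₚ
open import Data.Integer using (ℤ)
import Data.Integer as ℤ
import Data.Integer.DivMod as ℤ-DivMod
import Data.Integer.Properties as ℤₚ
import Data.Integer.Tactic.RingSolver as ℤ-Ring
open import Data.List using (List; []; _∷_; map; _++_; length; foldr; replicate; upTo; applyUpTo; cartesianProductWith; allFin; filter; tabulate; lookup)
open import Data.List.Membership.Propositional using (_∈_)
open import Data.List.Membership.Propositional.Properties using (∈-map⁺; ∈-map⁻; ∈-allFin; ∈-filter⁺; ∈-filter⁻; ∈-upTo⁻; ∈-tabulate⁺; ∈-tabulate⁻)
open import Data.List.Properties using (map-++; map-∘; map-tabulate; length-++; length-applyUpTo; length-tabulate; tabulate-lookup)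
open import Data.List.Relation.Unary.All as All using (All; []; _∷_)
open import Data.List.Relation.Unary.All.Properties using (all-filter)
open import Data.List.Relation.Unary.AllPairs using (AllPairs; []; _∷_)
import Data.List.Relation.Unary.AllPairs.Properties as AllPairsₚ
open import Data.List.Relation.Unary.Any using (here; there; any?)
open import Data.List.Relation.Unary.Linked as Linked using (Linked; []; [-]; _∷_)
open import Data.List.Relation.Unary.Unique.Propositional using (Unique)
open import Data.List.Relation.Unary.Unique.Propositional.Properties using (allFin⁺)
open import Data.Nat
open import Data.Nat.Combinatorics using (_C_; nCk≡nC[n∸k]; nCk+nC[k+1]≡[n+1]C[k+1]; nC1≡n; k>n⇒nCk≡0)
open import Data.Nat.Coprimality using (Coprime)
open import Data.Nat.DivMod using (_mod_; _%_; _/_; m%n<n; m≡m%n+[m/n]*n; m<n⇒m%n≡m; [m+n]%n≡m%n; m*n/n≡m; /-mono-≤)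
open import Data.Nat.ListAction using (sum)
open import Data.Nat.ListAction.Properties using (sum-++)
open import Data.Nat.Properties
open import Data.Nat.Tactic.RingSolver using (solve-∀)
open import Data.Product using (Σ; ∃; _×_; _,_; proj₁; proj₂)
open import Data.Product.Properties using () renaming (≡-dec to ×-≡-dec)
open import Data.Rational as ℚ using (ℚ; mkℚ; ½; 0ℚ; 1ℚ)
import Data.Rational.Properties as ℚₚ
open import Data.Rational.Unnormalised as ℚᵘ using (ℚᵘ; mkℚᵘ)
import Data.Rational.Unnormalised.Properties as ℚᵘₚ
open import Data.Sum using (_⊎_; inj₁; inj₂)
open import Data.Sum.Properties using () renaming (≡-dec to ⊎-≡-dec)
open import Data.Vec as Vec using (Vec; []; _∷_)
open import Data.Vec.Properties using (≡-dec)
open import Function using (_∘_; id)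
open import Function.Definitions using (Injective)
open import Relation.Binary.Definitions using (DecidableEquality; tri<; tri≈; tri>)
open import Relation.Binary.PropositionalEquality
open import Relation.Nullary using (Dec; yes; no; does; ¬_)
open import Relation.Nullary.Decidable using (_⊎-dec_; _×-dec_; ¬?)

-- Two demands on the threshold μ pull against each other. Excluding K₄ needs 4μ to exceed every
-- possible ⟨x + x′ , y + y′⟩, which may be as large as |x + x′| |y + y′|, while purple density 1/2
-- needs μ to be small against the typical |⟨x , y⟩|. Scale coordinates to size 1 in dimension h, so
-- that this typical size is of order √h. Concentration in the sign cube concerns Hamming distance
-- and yields |y + y′| only of order h^(1/4); with two sign cubes the product would again be of
-- order √h, with a constant that is too large. The boundary of a finely subdivided square gives
-- concentration in Euclidean distance instead: once M is of order √h, |x + x′| is bounded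
-- independently of h, and the product drops to order h^(1/4).
--
-- The number L of labels and the error 1/E have to be fixed before the dimension, because a set
-- counts as large from density 1/(2L) on. This is possible since the Poincaré constant of a power
-- of a path is that of the path itself.

private variable
  A B A′ : Set

-- Finite sums

∑ : List A → (A → ℕ) → ℕ
∑ xs f = sum (map f xs)

∑-mono-∈ : (xs : List A) {f g : A → ℕ} → (∀ x → x ∈ xs → f x ≤ g x) → ∑ xs f ≤ ∑ xs g
∑-mono-∈ []       f≤g = z≤n
∑-mono-∈ (x ∷ xs) f≤g = +-mono-≤ (f≤g x (here refl)) (∑-mono-∈ xs (λ y y∈ → f≤g y (there y∈)))

∑-mono : (xs : List A) {f g : A → ℕ} → (∀ x → f x ≤ g x) → ∑ xs f ≤ ∑ xs g
∑-mono xs f≤g = ∑-mono-∈ xs (λ x _ → f≤g x)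

∑-cong : (xs : List A) {f g : A → ℕ} → (∀ x → f x ≡ g x) → ∑ xs f ≡ ∑ xs g
∑-cong []       f≡g = refl
∑-cong (x ∷ xs) f≡g = cong₂ _+_ (f≡g x) (∑-cong xs f≡g)

∑-+ : (xs : List A) (f g : A → ℕ) → ∑ xs (λ x → f x + g x) ≡ ∑ xs f + ∑ xs g
∑-+ []       f g = refl
∑-+ (x ∷ xs) f g rewrite ∑-+ xs f g = lemma (f x) (g x) (∑ xs f) (∑ xs g)
  where
  lemma : ∀ a b c d → (a + b) + (c + d) ≡ (a + c) + (b + d)
  lemma = solve-∀

∑-*ˡ : (xs : List A) (c : ℕ) (f : A → ℕ) → ∑ xs (λ x → c * f x) ≡ c * ∑ xs f
∑-*ˡ []       c f = sym (*-zeroʳ c)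
∑-*ˡ (x ∷ xs) c f rewrite ∑-*ˡ xs c f = sym (*-distribˡ-+ c (f x) (∑ xs f))

∑-*ʳ : (xs : List A) (c : ℕ) (f : A → ℕ) → ∑ xs (λ x → f x * c) ≡ ∑ xs f * c
∑-*ʳ xs c f = begin
  ∑ xs (λ x → f x * c)  ≡⟨ ∑-cong xs (λ x → *-comm (f x) c) ⟩
  ∑ xs (λ x → c * f x)  ≡⟨ ∑-*ˡ xs c f ⟩
  c * ∑ xs f            ≡⟨ *-comm c _ ⟩
  ∑ xs f * c            ∎
  where open ≡-Reasoning

∑-const : (xs : List A) (c : ℕ) → ∑ xs (λ _ → c) ≡ length xs * c
∑-const []       c = refl
∑-const (x ∷ xs) c = cong (c +_) (∑-const xs c)

∑-swap : (xs : List A) (ys : List B) (f : A → B → ℕ) →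
         ∑ xs (λ x → ∑ ys (f x)) ≡ ∑ ys (λ y → ∑ xs (λ x → f x y))
∑-swap []       ys f = sym (trans (∑-const ys 0) (*-zeroʳ (length ys)))
∑-swap (x ∷ xs) ys f rewrite ∑-swap xs ys f = sym (∑-+ ys (f x) _)

∑-++ : (xs ys : List A) (f : A → ℕ) → ∑ (xs ++ ys) f ≡ ∑ xs f + ∑ ys f
∑-++ xs ys f rewrite map-++ f xs ys = sum-++ (map f xs) (map f ys)

∑-map : (g : A → B) (xs : List A) (f : B → ℕ) → ∑ (map g xs) f ≡ ∑ xs (f ∘ g)
∑-map g xs f = cong sum (sym (map-∘ xs))

∑-cartesian : (_∙_ : A → B → A′) (xs : List A) (ys : List B) (f : A′ → ℕ) →
              ∑ (cartesianProductWith _∙_ xs ys) f ≡ ∑ xs (λ x → ∑ ys (λ y → f (x ∙ y)))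
∑-cartesian _∙_ []       ys f = refl
∑-cartesian _∙_ (x ∷ xs) ys f
  rewrite ∑-++ (map (x ∙_) ys) (cartesianProductWith _∙_ xs ys) f
        | ∑-map (x ∙_) ys f
        | ∑-cartesian _∙_ xs ys f = refl

∑∑-* : (xs : List A) (ys : List B) (f : A → ℕ) (g : B → ℕ) →
       ∑ xs (λ x → ∑ ys (λ y → f x * g y)) ≡ ∑ xs f * ∑ ys g
∑∑-* xs ys f g = trans (∑-cong xs (λ x → ∑-*ˡ ys (f x) g)) (∑-*ʳ xs (∑ ys g) f)

ind : {P : Set} → Dec P → ℕ
ind p = if does p then 1 else 0

ind-yes : {P : Set} (p : Dec P) → P → ind p ≡ 1
ind-yes (yes _) _ = refl
ind-yes (no ¬p) p = ⊥-elim (¬p p)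

ind-no : {P : Set} (p : Dec P) → ¬ P → ind p ≡ 0
ind-no (yes p) ¬p = ⊥-elim (¬p p)
ind-no (no _)  _  = refl

ind⇒ : {P : Set} (p : Dec P) → 1 ≤ ind p → P
ind⇒ (yes p) _ = p

ind≤1 : {P : Set} (p : Dec P) → ind p ≤ 1
ind≤1 (yes _) = ≤-refl
ind≤1 (no _)  = z≤n

ind-mono : {P Q : Set} (p : Dec P) (q : Dec Q) → (P → Q) → ind p ≤ ind q
ind-mono (yes p) q f = ≤-reflexive (sym (ind-yes q (f p)))
ind-mono (no _)  q f = z≤n

δ : ℕ → ℕ → ℕ
δ a b = ∣ a - b ∣ * ∣ a - b ∣

δ-refl : ∀ a → δ a a ≡ 0
δ-refl a rewrite ∣n-n∣≡0 a = refl

δ-sym : ∀ a b → δ a b ≡ δ b a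
δ-sym a b rewrite ∣-∣-comm a b = refl

∣i∣² : ∀ i → ℤ.+ (ℤ.∣ i ∣ * ℤ.∣ i ∣) ≡ i ℤ.* i
∣i∣² (ℤ.+ n)      = ℤₚ.pos-* n n
∣i∣² (ℤ.-[1+ n ]) = refl

δ-ℤ : ∀ a b → ℤ.+ δ a b ≡ (ℤ.+ a ℤ.- ℤ.+ b) ℤ.* (ℤ.+ a ℤ.- ℤ.+ b)
δ-ℤ a b = begin
  ℤ.+ δ a b                                          ≡⟨ cong (λ z → ℤ.+ (z * z)) (lemma a b) ⟩
  ℤ.+ (ℤ.∣ a ℤ.⊖ b ∣ * ℤ.∣ a ℤ.⊖ b ∣)                ≡⟨ ∣i∣² (a ℤ.⊖ b) ⟩
  (a ℤ.⊖ b) ℤ.* (a ℤ.⊖ b)                            ≡⟨ cong (λ z → z ℤ.* z) (sym (ℤₚ.[+m]-[+n]≡m⊖n a b)) ⟩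
  (ℤ.+ a ℤ.- ℤ.+ b) ℤ.* (ℤ.+ a ℤ.- ℤ.+ b)            ∎
  where
  open ≡-Reasoning
  lemma : ∀ a b → ∣ a - b ∣ ≡ ℤ.∣ a ℤ.⊖ b ∣
  lemma a b with ≤-total a b
  ... | inj₁ a≤b = trans (m≤n⇒∣m-n∣≡n∸m a≤b) (sym (ℤₚ.∣⊖∣-≤ a≤b))
  ... | inj₂ b≤a = trans (m≤n⇒∣n-m∣≡n∸m b≤a) (sym (cong ℤ.∣_∣ (ℤₚ.⊖-≥ b≤a)))

≤-from-gap : ∀ {i j : ℤ.ℤ} (k : ℕ) → j ≡ i ℤ.+ ℤ.+ k → i ℤ.≤ j
≤-from-gap {i} k refl = ℤₚ.i≤i+j i (ℤ.+ k)

-- The gap is the square of (a − b) − (c − d).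
δ-exchange : ∀ a b c d → δ a d + δ b c ≤ δ a c + δ b d + (δ a b + δ c d)
δ-exchange a b c d = ℤₚ.drop‿+≤+ (≤-from-gap gap eq)
  where
  w = (ℤ.+ a ℤ.- ℤ.+ b) ℤ.- (ℤ.+ c ℤ.- ℤ.+ d)
  gap = ℤ.∣ w ∣ * ℤ.∣ w ∣
  S : ℤ.ℤ → ℤ.ℤ → ℤ.ℤ
  S x y = (x ℤ.- y) ℤ.* (x ℤ.- y)
  identity : ∀ a b c d →
    ((a ℤ.- c) ℤ.* (a ℤ.- c) ℤ.+ (b ℤ.- d) ℤ.* (b ℤ.- d)) ℤ.+ ((a ℤ.- b) ℤ.* (a ℤ.- b) ℤ.+ (c ℤ.- d) ℤ.* (c ℤ.- d))
    ≡ ((a ℤ.- d) ℤ.* (a ℤ.- d) ℤ.+ (b ℤ.- c) ℤ.* (b ℤ.- c)) ℤ.+ ((a ℤ.- b) ℤ.- (c ℤ.- d)) ℤ.* ((a ℤ.- b) ℤ.- (c ℤ.- d))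
  identity = ℤ-Ring.solve-∀
  eq : ℤ.+ (δ a c + δ b d + (δ a b + δ c d)) ≡ ℤ.+ (δ a d + δ b c) ℤ.+ ℤ.+ gap
  eq = begin
    (ℤ.+ δ a c ℤ.+ ℤ.+ δ b d) ℤ.+ (ℤ.+ δ a b ℤ.+ ℤ.+ δ c d)
      ≡⟨ cong₂ ℤ._+_ (cong₂ ℤ._+_ (δ-ℤ a c) (δ-ℤ b d)) (cong₂ ℤ._+_ (δ-ℤ a b) (δ-ℤ c d)) ⟩
    (S (ℤ.+ a) (ℤ.+ c) ℤ.+ S (ℤ.+ b) (ℤ.+ d)) ℤ.+ (S (ℤ.+ a) (ℤ.+ b) ℤ.+ S (ℤ.+ c) (ℤ.+ d))
      ≡⟨ identity (ℤ.+ a) (ℤ.+ b) (ℤ.+ c) (ℤ.+ d) ⟩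
    (S (ℤ.+ a) (ℤ.+ d) ℤ.+ S (ℤ.+ b) (ℤ.+ c)) ℤ.+ w ℤ.* w
      ≡⟨ cong₂ ℤ._+_ (cong₂ ℤ._+_ (sym (δ-ℤ a d)) (sym (δ-ℤ b c))) (sym (∣i∣² w)) ⟩
    (ℤ.+ δ a d ℤ.+ ℤ.+ δ b c) ℤ.+ ℤ.+ gap ∎
    where open ≡-Reasoning

δ-split : ∀ a b → δ a b ≤ (b ∸ a) * (b ∸ a) + (a ∸ b) * (a ∸ b)
δ-split a b with ≤-total a b
... | inj₁ a≤b rewrite m≤n⇒∣m-n∣≡n∸m a≤b = m≤m+n _ _
... | inj₂ b≤a rewrite m≤n⇒∣n-m∣≡n∸m b≤a = m≤n+m _ _

2ab≤a²+b² : ∀ a b → 2 * (a * b) ≤ a * a + b * b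
2ab≤a²+b² a b with ≤-total a b
... | inj₁ a≤b = subst (λ b → 2 * (a * b) ≤ a * a + b * b) (m+[n∸m]≡n a≤b) (lemma a (b ∸ a))
  where
  eq : ∀ a c → a * a + (a + c) * (a + c) ≡ 2 * (a * (a + c)) + c * c
  eq = solve-∀
  lemma : ∀ a c → 2 * (a * (a + c)) ≤ a * a + (a + c) * (a + c)
  lemma a c rewrite eq a c = m≤m+n _ _
... | inj₂ b≤a = subst (λ a → 2 * (a * b) ≤ a * a + b * b) (m+[n∸m]≡n b≤a) (lemma b (a ∸ b))
  where
  eq : ∀ b c → (b + c) * (b + c) + b * b ≡ 2 * ((b + c) * b) + c * c
  eq = solve-∀
  lemma : ∀ b c → 2 * ((b + c) * b) ≤ (b + c) * (b + c) + b * b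
  lemma b c rewrite eq b c = m≤m+n _ _

-- The inductive step of Cauchy-Schwarz along a path: `b` is the change over `k` edges of energy
-- `e`, and one more edge changes by `a`. After scaling by k + 1 the cross term splits by 2xy ≤ x² +
-- y² with x = (k + 1)a and y = b.
square-sum-≤ : ∀ k a b e → b * b ≤ k * e → (a + b) * (a + b) ≤ suc k * (a * a + e)
square-sum-≤ zero a zero e _ = ≤-trans (≤-reflexive (eq a)) (+-monoˡ-≤ 0 (m≤m+n (a * a) e))
  where
  eq : ∀ a → (a + 0) * (a + 0) ≡ a * a + 0
  eq = solve-∀
square-sum-≤ (suc k) a b e b²≤ = *-cancelˡ-≤ (suc k) (begin
  suc k * ((a + b) * (a + b))
    ≡⟨ eq₁ k a b ⟩
  suc k * (a * a) + 2 * (suc k * a * b) + suc k * (b * b)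
    ≤⟨ +-mono-≤ (+-monoʳ-≤ (suc k * (a * a)) (≤-trans (2ab≤a²+b² (suc k * a) b) (+-monoʳ-≤ _ b²≤)))
                (*-monoʳ-≤ (suc k) b²≤) ⟩
  suc k * (a * a) + (suc k * a * (suc k * a) + suc k * e) + suc k * (suc k * e)
    ≡⟨ eq₂ k a e ⟩
  suc k * (suc (suc k) * (a * a + e)) ∎)
  where
  open ≤-Reasoning
  eq₁ : ∀ k a b → suc k * ((a + b) * (a + b)) ≡ suc k * (a * a) + 2 * (suc k * a * b) + suc k * (b * b)
  eq₁ = solve-∀
  eq₂ : ∀ k a e → suc k * (a * a) + (suc k * a * (suc k * a) + suc k * e) + suc k * (suc k * e)
                ≡ suc k * (suc (suc k) * (a * a + e))
  eq₂ = solve-∀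

-- Poincaré inequality on a product of paths

-- The Dirichlet energy of `F` on the path that visits the list in order.
pathEnergy : List A → (A → ℕ) → ℕ
pathEnergy []           F = 0
pathEnergy (x ∷ [])     F = 0
pathEnergy (x ∷ y ∷ zs) F = δ (F x) (F y) + pathEnergy (y ∷ zs) F

δ-head≤pathEnergy : (x : A) (zs : List A) (F : A → ℕ) {y : A} → y ∈ x ∷ zs →
                    δ (F x) (F y) ≤ length zs * pathEnergy (x ∷ zs) F
δ-head≤pathEnergy x zs       F (here refl) rewrite δ-refl (F x) = z≤n
δ-head≤pathEnergy x (z ∷ zs) F {y} (there y∈) = begin
  δ (F x) (F y)
    ≤⟨ *-mono-≤ (∣-∣-triangle (F x) (F z) (F y)) (∣-∣-triangle (F x) (F z) (F y)) ⟩
  (∣ F x - F z ∣ + ∣ F z - F y ∣) * (∣ F x - F z ∣ + ∣ F z - F y ∣)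
    ≤⟨ square-sum-≤ (length zs) ∣ F x - F z ∣ ∣ F z - F y ∣ _ (δ-head≤pathEnergy z zs F y∈) ⟩
  suc (length zs) * (δ (F x) (F z) + pathEnergy (z ∷ zs) F) ∎
  where open ≤-Reasoning

δ≤pathEnergy : (zs : List A) (F : A → ℕ) {x y : A} → x ∈ zs → y ∈ zs →
               δ (F x) (F y) ≤ length zs * pathEnergy zs F
δ≤pathEnergy (z ∷ zs) F (here refl) y∈ =
  ≤-trans (δ-head≤pathEnergy z zs F y∈) (*-monoˡ-≤ (pathEnergy (z ∷ zs) F) (n≤1+n (length zs)))
δ≤pathEnergy (z ∷ zs) F {x} (there x∈) (here refl) rewrite δ-sym (F x) (F z) =
  ≤-trans (δ-head≤pathEnergy z zs F (there x∈)) (*-monoˡ-≤ (pathEnergy (z ∷ zs) F) (n≤1+n (length zs)))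
δ≤pathEnergy (z ∷ z′ ∷ zs) F (there x∈) (there y∈) =
  ≤-trans (δ≤pathEnergy (z′ ∷ zs) F x∈ y∈)
    (*-mono-≤ (n≤1+n (length (z′ ∷ zs))) (m≤n+m (pathEnergy (z′ ∷ zs) F) (δ (F z) (F z′))))

-- Adding the terms (i , j) and (j , i) makes `δ-exchange` applicable: it trades the two crossed
-- terms for two diagonal ones, at the cost of the variation of `F` alone and of `G` alone, which
-- the path energies bound.
path-poincaré : (ks : List A) (F G : A → ℕ) →
  2 * ∑ ks (λ i → ∑ ks (λ j → δ (F i) (G j)))
  ≤ 2 * (length ks * ∑ ks (λ i → δ (F i) (G i)))
    + length ks * length ks * (length ks * (pathEnergy ks F + pathEnergy ks G))
path-poincaré ks F G = begin
  2 * S                              ≡⟨ cong (S +_) (+-identityʳ S) ⟩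
  S + S                              ≡⟨ cong (S +_) (∑-swap ks ks (λ i j → δ (F i) (G j))) ⟩
  S + ∑ ks (λ i → ∑ ks (λ j → δ (F j) (G i)))
    ≡⟨ ∑-+ ks _ _ ⟨
  ∑ ks (λ i → ∑ ks (λ j → δ (F i) (G j)) + ∑ ks (λ j → δ (F j) (G i)))
    ≡⟨ ∑-cong ks (λ i → sym (∑-+ ks _ _)) ⟩
  ∑ ks (λ i → ∑ ks (λ j → δ (F i) (G j) + δ (F j) (G i)))
    ≤⟨ ∑-mono-∈ ks (λ i i∈ → ∑-mono-∈ ks (λ j j∈ → pointwise i j i∈ j∈)) ⟩
  ∑ ks (λ i → ∑ ks (λ j → (d i + d j) + e))
    ≡⟨ ∑-cong ks (λ i → trans (∑-+ ks (λ j → d i + d j) (λ _ → e))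
                      (cong₂ _+_ (trans (∑-+ ks (λ _ → d i) d) (cong (_+ ∑ ks d) (∑-const ks (d i))))
                                 (∑-const ks e))) ⟩
  ∑ ks (λ i → (m * d i + ∑ ks d) + m * e)
    ≡⟨ trans (∑-+ ks (λ i → m * d i + ∑ ks d) (λ _ → m * e))
         (cong₂ _+_ (trans (∑-+ ks (λ i → m * d i) (λ _ → ∑ ks d)) (cong₂ _+_ (∑-*ˡ ks m d) (∑-const ks (∑ ks d))))
                    (∑-const ks (m * e))) ⟩
  (m * ∑ ks d + m * ∑ ks d) + m * (m * e)
    ≡⟨ eq m (∑ ks d) (pathEnergy ks F) (pathEnergy ks G) ⟩
  2 * (m * ∑ ks d) + m * m * (m * (pathEnergy ks F + pathEnergy ks G)) ∎
  where
  open ≤-Reasoning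
  m = length ks
  S = ∑ ks (λ i → ∑ ks (λ j → δ (F i) (G j)))
  d : _ → ℕ
  d i = δ (F i) (G i)
  e = m * pathEnergy ks F + m * pathEnergy ks G
  pointwise : ∀ i j → i ∈ ks → j ∈ ks → δ (F i) (G j) + δ (F j) (G i) ≤ (d i + d j) + e
  pointwise i j i∈ j∈ = ≤-trans (δ-exchange (F i) (F j) (G i) (G j))
    (+-monoʳ-≤ (d i + d j) (+-mono-≤ (δ≤pathEnergy ks F i∈ j∈) (δ≤pathEnergy ks G i∈ j∈)))
  eq : ∀ m s a b → (m * s + m * s) + m * (m * (m * a + m * b)) ≡ 2 * (m * s) + m * m * (m * (a + b))
  eq = solve-∀

-- Each edge is charged one-sidedly: an increase of `F` along it is paid by the end where `F` is
-- smaller. A vertex has at most two neighbours on the path, hence the factor 2. One-sided bounds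
-- suffice this way, and for a distance to a set only increases have a convenient local bound.
pathEnergy-≤ : (ks : List A) (F w : A → ℕ) →
  Linked (λ k k′ → (F k′ ∸ F k) * (F k′ ∸ F k) ≤ w k × (F k ∸ F k′) * (F k ∸ F k′) ≤ w k′) ks →
  pathEnergy ks F ≤ 2 * ∑ ks w
pathEnergy-≤ []       F w _ = z≤n
pathEnergy-≤ (k ∷ ks) F w linked = ≤-trans (go k ks linked)
    (≤-trans (+-monoˡ-≤ (2 * ∑ ks w) (m≤m+n (w k) (w k + 0))) (≤-reflexive (sym (*-distribˡ-+ 2 (w k) (∑ ks w)))))
  where
  open ≤-Reasoning
  eq : ∀ a b s → (a + b) + (b + 2 * s) ≡ a + 2 * (b + s)
  eq = solve-∀
  go : ∀ x zs → Linked _ (x ∷ zs) → pathEnergy (x ∷ zs) F ≤ w x + 2 * ∑ zs w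
  go x []       _ = z≤n
  go x (y ∷ zs) ((up , down) ∷ rest) = begin
    δ (F x) (F y) + pathEnergy (y ∷ zs) F
      ≤⟨ +-mono-≤ (≤-trans (δ-split (F x) (F y)) (+-mono-≤ up down)) (go y zs rest) ⟩
    (w x + w y) + (w y + 2 * ∑ zs w)      ≡⟨ eq (w x) (w y) (∑ zs w) ⟩
    w x + 2 * (w y + ∑ zs w)              ∎

allVec : List A → (h : ℕ) → List (Vec A h)
allVec ks zero    = [] ∷ []
allVec ks (suc h) = cartesianProductWith _∷_ ks (allVec ks h)

∑-allVec : (ks : List A) (h : ℕ) (f : Vec A (suc h) → ℕ) →
           ∑ (allVec ks (suc h)) f ≡ ∑ ks (λ k → ∑ (allVec ks h) (λ v → f (k ∷ v)))
∑-allVec ks h f = ∑-cartesian _∷_ ks (allVec ks h) f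

length-∑ : (xs : List A) → length xs ≡ ∑ xs (λ _ → 1)
length-∑ xs = sym (trans (∑-const xs 1) (*-identityʳ (length xs)))

length-allVec : (ks : List A) (h : ℕ) → length (allVec ks (suc h)) ≡ length ks * length (allVec ks h)
length-allVec ks h = begin
  length (allVec ks (suc h))              ≡⟨ length-∑ (allVec ks (suc h)) ⟩
  ∑ (allVec ks (suc h)) (λ _ → 1)         ≡⟨ ∑-allVec ks h (λ _ → 1) ⟩
  ∑ ks (λ _ → ∑ (allVec ks h) (λ _ → 1))  ≡⟨ ∑-const ks _ ⟩
  length ks * ∑ (allVec ks h) (λ _ → 1)   ≡⟨ cong (length ks *_) (sym (length-∑ (allVec ks h))) ⟩
  length ks * length (allVec ks h)        ∎
  where open ≡-Reasoning

-- The Dirichlet form of the product graph: path energies in each coordinate direction, summed over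
-- the other coordinates without normalisation.
energy : (ks : List A) (h : ℕ) → (Vec A h → ℕ) → ℕ
energy ks zero    f = 0
energy ks (suc h) f = ∑ ks (λ k → energy ks h (λ v → f (k ∷ v)))
                    + ∑ (allVec ks h) (λ v → pathEnergy ks (λ k → f (k ∷ v)))

-- Allowing two functions is what makes the inequality tensorise.
poincaré : (ks : List A) (h : ℕ) (f g : Vec A h → ℕ) →
  2 * ∑ (allVec ks h) (λ x → ∑ (allVec ks h) (λ y → δ (f x) (g y)))
  ≤ 2 * (length (allVec ks h) * ∑ (allVec ks h) (λ x → δ (f x) (g x)))
    + length ks * length ks * (length (allVec ks h) * (energy ks h f + energy ks h g))
poincaré ks zero f g rewrite *-zeroʳ (length ks * length ks) = ≤-reflexive (eq (δ (f []) (g [])))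
  where
  eq : ∀ a → 2 * (a + 0 + 0) ≡ 2 * (1 * (a + 0)) + 0
  eq = solve-∀
poincaré {A = A} ks (suc h) f g = begin
  2 * ∑ (allVec ks (suc h)) (λ x → ∑ (allVec ks (suc h)) (λ y → δ (f x) (g y)))
    ≡⟨ cong (2 *_) expand ⟩
  2 * ∑ ks (λ i → ∑ ks (λ j → ∑ Ω (λ v → ∑ Ω (λ w → δ (f (i ∷ v)) (g (j ∷ w))))))
    ≡⟨ trans (sym (∑-*ˡ ks 2 _)) (∑-cong ks (λ i → sym (∑-*ˡ ks 2 _))) ⟩
  ∑ ks (λ i → ∑ ks (λ j → 2 * ∑ Ω (λ v → ∑ Ω (λ w → δ (f (i ∷ v)) (g (j ∷ w))))))
    ≤⟨ ∑-mono ks (λ i → ∑-mono ks (λ j → poincaré ks h (λ v → f (i ∷ v)) (λ v → g (j ∷ v)))) ⟩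
  ∑ ks (λ i → ∑ ks (λ j → 2 * (n * ∑ Ω (λ v → δ (f (i ∷ v)) (g (j ∷ v)))) + m * m * (n * (Ef i + Eg j))))
    ≡⟨ trans (∑-cong ks (λ i → ∑-+ ks _ _)) (∑-+ ks _ _) ⟩
  ∑ ks (λ i → ∑ ks (λ j → 2 * (n * ∑ Ω (λ v → δ (f (i ∷ v)) (g (j ∷ v))))))
    + ∑ ks (λ i → ∑ ks (λ j → m * m * (n * (Ef i + Eg j))))
    ≡⟨ cong₂ _+_ diagonal energies ⟩
  n * ∑ Ω (λ v → 2 * ∑ ks (λ i → ∑ ks (λ j → δ (f (i ∷ v)) (g (j ∷ v)))))
    + m * m * (n * (m * (∑ ks Ef + ∑ ks Eg)))
    -- The diagonal term left by the induction hypothesis still compares different heads `i` and `j`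
    -- over one common tail `v`; this is the one-dimensional situation.
    ≤⟨ +-monoˡ-≤ _ (*-monoʳ-≤ n (∑-mono Ω (λ v → path-poincaré ks (λ k → f (k ∷ v)) (λ k → g (k ∷ v))))) ⟩
  n * ∑ Ω (λ v → 2 * (m * ∑ ks (λ i → δ (f (i ∷ v)) (g (i ∷ v)))) + m * m * (m * (Pf v + Pg v)))
    + m * m * (n * (m * (∑ ks Ef + ∑ ks Eg)))
    ≡⟨ cong (λ z → n * z + m * m * (n * (m * (∑ ks Ef + ∑ ks Eg)))) fibres ⟩
  n * (2 * (m * s) + m * m * (m * (∑ Ω Pf + ∑ Ω Pg)))
    + m * m * (n * (m * (∑ ks Ef + ∑ ks Eg)))
    ≡⟨ eq n m s (∑ Ω Pf) (∑ Ω Pg) (∑ ks Ef) (∑ ks Eg) ⟩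
  2 * (m * n * s) + m * m * (m * n * ((∑ ks Ef + ∑ Ω Pf) + (∑ ks Eg + ∑ Ω Pg)))
    ≡⟨ cong₂ (λ k t → 2 * (k * t) + m * m * (k * ((∑ ks Ef + ∑ Ω Pf) + (∑ ks Eg + ∑ Ω Pg))))
         (sym (length-allVec ks h)) (sym s-expand) ⟩
  2 * (length (allVec ks (suc h)) * ∑ (allVec ks (suc h)) (λ x → δ (f x) (g x)))
    + m * m * (length (allVec ks (suc h)) * (energy ks (suc h) f + energy ks (suc h) g)) ∎
  where
  open ≤-Reasoning
  m = length ks
  Ω = allVec ks h
  n = length Ω
  Ef Eg : A → ℕ
  Ef i = energy ks h (λ v → f (i ∷ v))
  Eg j = energy ks h (λ v → g (j ∷ v))
  Pf Pg : Vec A h → ℕ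
  Pf v = pathEnergy ks (λ k → f (k ∷ v))
  Pg v = pathEnergy ks (λ k → g (k ∷ v))
  s = ∑ Ω (λ v → ∑ ks (λ i → δ (f (i ∷ v)) (g (i ∷ v))))
  s-expand : ∑ (allVec ks (suc h)) (λ x → δ (f x) (g x)) ≡ s
  s-expand = trans (∑-allVec ks h _) (∑-swap ks Ω _)
  expand : ∑ (allVec ks (suc h)) (λ x → ∑ (allVec ks (suc h)) (λ y → δ (f x) (g y)))
         ≡ ∑ ks (λ i → ∑ ks (λ j → ∑ Ω (λ v → ∑ Ω (λ w → δ (f (i ∷ v)) (g (j ∷ w))))))
  expand = trans (∑-allVec ks h _) (∑-cong ks (λ i →
           trans (∑-cong Ω (λ v → ∑-allVec ks h _)) (∑-swap Ω ks _)))
  diagonal : ∑ ks (λ i → ∑ ks (λ j → 2 * (n * ∑ Ω (λ v → δ (f (i ∷ v)) (g (j ∷ v))))))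
           ≡ n * ∑ Ω (λ v → 2 * ∑ ks (λ i → ∑ ks (λ j → δ (f (i ∷ v)) (g (j ∷ v)))))
  diagonal = ≡R.begin
    ∑ ks (λ i → ∑ ks (λ j → 2 * (n * ∑ Ω (λ v → δ (f (i ∷ v)) (g (j ∷ v))))))
      ≡R.≡⟨ ∑-cong ks (λ i → trans (∑-cong ks (λ j → sym (*-assoc 2 n _))) (∑-*ˡ ks (2 * n) _)) ⟩
    ∑ ks (λ i → 2 * n * ∑ ks (λ j → ∑ Ω (λ v → δ (f (i ∷ v)) (g (j ∷ v)))))
      ≡R.≡⟨ ∑-*ˡ ks (2 * n) _ ⟩
    2 * n * ∑ ks (λ i → ∑ ks (λ j → ∑ Ω (λ v → δ (f (i ∷ v)) (g (j ∷ v)))))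
      ≡R.≡⟨ cong (2 * n *_) (trans (∑-cong ks (λ i → ∑-swap ks Ω _)) (∑-swap ks Ω _)) ⟩
    2 * n * ∑ Ω (λ v → ∑ ks (λ i → ∑ ks (λ j → δ (f (i ∷ v)) (g (j ∷ v)))))
      ≡R.≡⟨ 2-inside n _ ⟩
    n * (2 * ∑ Ω (λ v → ∑ ks (λ i → ∑ ks (λ j → δ (f (i ∷ v)) (g (j ∷ v))))))
      ≡R.≡⟨ cong (n *_) (sym (∑-*ˡ Ω 2 _)) ⟩
    n * ∑ Ω (λ v → 2 * ∑ ks (λ i → ∑ ks (λ j → δ (f (i ∷ v)) (g (j ∷ v))))) ≡R.∎
    where
    module ≡R = ≡-Reasoning
    2-inside : ∀ n s → 2 * n * s ≡ n * (2 * s)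
    2-inside = solve-∀
  energies : ∑ ks (λ i → ∑ ks (λ j → m * m * (n * (Ef i + Eg j))))
           ≡ m * m * (n * (m * (∑ ks Ef + ∑ ks Eg)))
  energies = ≡R.begin
    ∑ ks (λ i → ∑ ks (λ j → m * m * (n * (Ef i + Eg j))))
      ≡R.≡⟨ trans (∑-cong ks (λ i → ∑-*ˡ ks (m * m) _)) (∑-*ˡ ks (m * m) _) ⟩
    m * m * ∑ ks (λ i → ∑ ks (λ j → n * (Ef i + Eg j)))
      ≡R.≡⟨ cong (m * m *_) (trans (∑-cong ks (λ i → ∑-*ˡ ks n _)) (∑-*ˡ ks n _)) ⟩
    m * m * (n * ∑ ks (λ i → ∑ ks (λ j → Ef i + Eg j)))
      ≡R.≡⟨ cong (λ z → m * m * (n * z)) (trans (∑-cong ks (λ i → trans (∑-+ ks _ _) (cong (_+ ∑ ks Eg) (∑-const ks (Ef i)))))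
               (trans (∑-+ ks _ _) (trans (cong₂ _+_ (∑-*ˡ ks m Ef) (∑-const ks (∑ ks Eg))) (sym (*-distribˡ-+ m _ _))))) ⟩
    m * m * (n * (m * (∑ ks Ef + ∑ ks Eg))) ≡R.∎
    where module ≡R = ≡-Reasoning
  fibres : ∑ Ω (λ v → 2 * (m * ∑ ks (λ i → δ (f (i ∷ v)) (g (i ∷ v)))) + m * m * (m * (Pf v + Pg v)))
         ≡ 2 * (m * s) + m * m * (m * (∑ Ω Pf + ∑ Ω Pg))
  fibres = trans (∑-+ Ω _ _) (cong₂ _+_
    (trans (∑-*ˡ Ω 2 _) (cong (2 *_) (∑-*ˡ Ω m _)))
    (trans (∑-*ˡ Ω (m * m) _) (cong (m * m *_) (trans (∑-*ˡ Ω m _) (cong (m *_) (∑-+ Ω Pf Pg))))))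
  eq : ∀ n m s a b c d → n * (2 * (m * s) + m * m * (m * (a + b))) + m * m * (n * (m * (c + d)))
                       ≡ 2 * (m * n * s) + m * m * (m * n * ((c + a) + (d + b)))
  eq = solve-∀

-- For equal functions the diagonal term vanishes. Up to the normalisation by the number of points,
-- the constant depends on `ks` only and not on `h`.
variance≤energy : (ks : List A) (h : ℕ) (f : Vec A h → ℕ) →
  ∑ (allVec ks h) (λ x → ∑ (allVec ks h) (λ y → δ (f x) (f y)))
  ≤ length ks * length ks * (length (allVec ks h) * energy ks h f)
variance≤energy ks h f = *-cancelˡ-≤ 2 (begin
  2 * ∑ Ω (λ x → ∑ Ω (λ y → δ (f x) (f y)))
    ≤⟨ poincaré ks h f f ⟩
  2 * (n * ∑ Ω (λ x → δ (f x) (f x))) + m * m * (n * (energy ks h f + energy ks h f))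
    ≡⟨ cong (λ z → 2 * (n * z) + m * m * (n * (energy ks h f + energy ks h f))) (trans (∑-cong Ω (λ x → δ-refl (f x))) (trans (∑-const Ω 0) (*-zeroʳ n))) ⟩
  2 * (n * 0) + m * m * (n * (energy ks h f + energy ks h f))
    ≡⟨ eq n m (energy ks h f) ⟩
  2 * (m * m * (n * energy ks h f)) ∎)
  where
  open ≤-Reasoning
  m = length ks
  Ω = allVec ks h
  n = length Ω
  eq : ∀ n m e → 2 * (n * 0) + m * m * (n * (e + e)) ≡ 2 * (m * m * (n * e))
  eq = solve-∀

-- Concentration of measure

-- The vector `u x` lists, coordinate by coordinate, bounds for the squared increase when one step
-- is made from `x`. Only its total enters, so the bounds may depend on `x` in any way.
energy-≤ : (ks : List A) (_~_ : A → A → Set) → Linked (λ k k′ → k ~ k′ × k′ ~ k) ks →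
  (h : ℕ) (f : Vec A h → ℕ) (u : Vec A h → Vec ℕ h) →
  (∀ x i k → Vec.lookup x i ~ k → (f (x Vec.[ i ]≔ k) ∸ f x) * (f (x Vec.[ i ]≔ k) ∸ f x) ≤ Vec.lookup (u x) i) →
  energy ks h f ≤ ∑ (allVec ks h) (λ x → 2 * Vec.sum (u x))
energy-≤ ks _~_ linked zero    f u step = z≤n
energy-≤ ks _~_ linked (suc h) f u step = begin
  ∑ ks (λ k → energy ks h (λ v → f (k ∷ v))) + ∑ Ω (λ v → pathEnergy ks (λ k → f (k ∷ v)))
    ≤⟨ +-mono-≤
         (∑-mono ks (λ k → energy-≤ ks _~_ linked h (λ v → f (k ∷ v)) (λ v → Vec.tail (u (k ∷ v)))
           (λ x i k′ r → subst (_ ≤_) (lookup-tail (u (k ∷ x)) i) (step (k ∷ x) (suc i) k′ r))))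
         (∑-mono Ω (λ v → pathEnergy-≤ ks (λ k → f (k ∷ v)) (λ k → Vec.head (u (k ∷ v)))
           (Linked.map (λ {k} {k′} (r , r′) → subst (_ ≤_) (lookup-head (u (k ∷ v))) (step (k ∷ v) zero k′ r)
                                            , subst (_ ≤_) (lookup-head (u (k′ ∷ v))) (step (k′ ∷ v) zero k r′)) linked))) ⟩
  ∑ ks (λ k → ∑ Ω (λ v → 2 * Vec.sum (Vec.tail (u (k ∷ v))))) + ∑ Ω (λ v → 2 * ∑ ks (λ k → Vec.head (u (k ∷ v))))
    ≡⟨ cong (∑ ks (λ k → ∑ Ω (λ v → 2 * Vec.sum (Vec.tail (u (k ∷ v))))) +_)
         (trans (∑-cong Ω (λ v → sym (∑-*ˡ ks 2 _))) (∑-swap Ω ks _)) ⟩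
  ∑ ks (λ k → ∑ Ω (λ v → 2 * Vec.sum (Vec.tail (u (k ∷ v))))) + ∑ ks (λ k → ∑ Ω (λ v → 2 * Vec.head (u (k ∷ v))))
    ≡⟨ trans (sym (∑-+ ks _ _)) (∑-cong ks (λ k → trans (sym (∑-+ Ω _ _)) (∑-cong Ω (λ v → sum-uncons (u (k ∷ v)))))) ⟩
  ∑ ks (λ k → ∑ Ω (λ v → 2 * Vec.sum (u (k ∷ v))))
    ≡⟨ ∑-allVec ks h _ ⟨
  ∑ (allVec ks (suc h)) (λ x → 2 * Vec.sum (u x)) ∎
  where
  open ≤-Reasoning
  Ω = allVec ks h
  lookup-tail : ∀ {n} (w : Vec ℕ (suc n)) i → Vec.lookup w (suc i) ≡ Vec.lookup (Vec.tail w) i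
  lookup-tail (_ ∷ _) i = refl
  lookup-head : ∀ {n} (w : Vec ℕ (suc n)) → Vec.lookup w zero ≡ Vec.head w
  lookup-head (_ ∷ _) = refl
  sum-uncons : ∀ {n} (w : Vec ℕ (suc n)) → 2 * Vec.sum (Vec.tail w) + 2 * Vec.head w ≡ 2 * Vec.sum w
  sum-uncons (a ∷ w) = eq a (Vec.sum w)
    where
    eq : ∀ a b → 2 * b + 2 * a ≡ 2 * (a + b)
    eq = solve-∀

module Concentration {K : Set} (_≟_ : DecidableEquality K) (ks : List K)
  (q : K → K → ℕ) (q-refl : ∀ k → q k k ≡ 0)
  where

  -- The discrete form of the fact that a squared distance has a squared gradient of the order of
  -- itself. The additive 2 pays for coordinates at distance 0 and becomes the term linear in `h`.
  Step : K → K → Set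
  Step k k′ = ∀ a → (q k′ a ∸ q k a) * (q k′ a ∸ q k a) ≤ 8 * q k a + 2

  dist : ∀ {h} → Vec K h → Vec K h → ℕ
  dist []      []      = 0
  dist (k ∷ x) (a ∷ y) = q k a + dist x y

  dist-refl : ∀ {h} (x : Vec K h) → dist x x ≡ 0
  dist-refl []      = refl
  dist-refl (k ∷ x) rewrite q-refl k = dist-refl x

  dist-update : ∀ {h} (x a : Vec K h) i k →
    dist (x Vec.[ i ]≔ k) a ∸ dist x a ≡ q k (Vec.lookup a i) ∸ q (Vec.lookup x i) (Vec.lookup a i)
  dist-update (k₀ ∷ x) (a₀ ∷ a) zero    k = [m+n]∸[o+n]≡m∸o (q k a₀) (dist x a) (q k₀ a₀)
    where
    [m+n]∸[o+n]≡m∸o : ∀ m n o → (m + n) ∸ (o + n) ≡ m ∸ o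
    [m+n]∸[o+n]≡m∸o m n o rewrite +-comm m n | +-comm o n = [m+n]∸[m+o]≡n∸o n m o
  dist-update (k₀ ∷ x) (a₀ ∷ a) (suc i) k =
    trans ([m+n]∸[m+o]≡n∸o (q k₀ a₀) _ _) (dist-update x a i k)

  -- Cutting the distance off at `D` keeps the gradient bound of order D + h at every point, however
  -- far from `As` it lies.
  near : ∀ {h} → ℕ → List (Vec K h) → Vec K h → ℕ
  near D As x = foldr (λ a r → dist x a ⊓ r) D As

  near≤dist : ∀ {h} D (As : List (Vec K h)) x {a} → a ∈ As → near D As x ≤ dist x a
  near≤dist D (a ∷ As) x (here refl) = m⊓n≤m (dist x a) _
  near≤dist D (a ∷ As) x (there a∈)  = ≤-trans (m⊓n≤n (dist x a) _) (near≤dist D As x a∈)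

  near≤D : ∀ {h} D (As : List (Vec K h)) x → near D As x ≤ D
  near≤D D []       x = ≤-refl
  near≤D D (a ∷ As) x = ≤-trans (m⊓n≤n (dist x a) _) (near≤D D As x)

  near-attained : ∀ {h} D (As : List (Vec K h)) x →
    near D As x ≡ D ⊎ ∃ λ a → a ∈ As × near D As x ≡ dist x a
  near-attained D []       x = inj₁ refl
  near-attained D (a ∷ As) x with ⊓-sel (dist x a) (near D As x)
  ... | inj₁ eq = inj₂ (a , here refl , eq)
  ... | inj₂ eq with near-attained D As x
  ...   | inj₁ eq′             = inj₁ (trans eq eq′)
  ...   | inj₂ (b , b∈ , eq′)  = inj₂ (b , there b∈ , trans eq eq′)

  D≤near : ∀ {h} D (As : List (Vec K h)) x → (∀ {a} → a ∈ As → D ≤ dist x a) → D ≤ near D As x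
  D≤near D []       x far = ≤-refl
  D≤near D (a ∷ As) x far = ⊓-glb (far (here refl)) (D≤near D As x (far ∘ there))

  weights : ∀ {h} → Vec K h → Vec K h → Vec ℕ h
  weights = Vec.zipWith (λ k a → 8 * q k a + 2)

  sum-weights : ∀ {h} (x a : Vec K h) → Vec.sum (weights x a) ≡ 8 * dist x a + 2 * h
  sum-weights []      []      = refl
  sum-weights {suc h} (k ∷ x) (a ∷ y) rewrite sum-weights x y = eq (q k a) (dist x y) h
    where
    eq : ∀ a b h → (8 * a + 2) + (8 * b + 2 * h) ≡ 8 * (a + b) + 2 * suc h
    eq = solve-∀

  lookup-weights : ∀ {h} (x a : Vec K h) i →
    Vec.lookup (weights x a) i ≡ 8 * q (Vec.lookup x i) (Vec.lookup a i) + 2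
  lookup-weights (k ∷ x) (a ∷ y) zero    = refl
  lookup-weights (k ∷ x) (a ∷ y) (suc i) = lookup-weights x y i

  -- Where the cut-off is attained, no step can increase `near`. Elsewhere let `a` be a closest
  -- point of `As`: after the step the distance to this same `a` still bounds `near` from above, so
  -- `near` grows at most as much as that distance does.
  slope : ∀ {h} D (As : List (Vec K h)) x → ∃ λ (u : Vec ℕ h) → Vec.sum u ≤ 8 * D + 2 * h ×
    (∀ i k → Step (Vec.lookup x i) k →
      (near D As (x Vec.[ i ]≔ k) ∸ near D As x) * (near D As (x Vec.[ i ]≔ k) ∸ near D As x) ≤ Vec.lookup u i)
  slope {h} D As x with near-attained D As x
  ... | inj₁ eq = Vec.replicate h 0
                , ≤-trans (≤-reflexive (sum-replicate h)) z≤n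
                , λ i k _ → ≤-trans (≤-reflexive (cong (λ z → z * z)
                    (m≤n⇒m∸n≡0 (≤-trans (near≤D D As (x Vec.[ i ]≔ k)) (≤-reflexive (sym eq)))))) z≤n
    where
    sum-replicate : ∀ h → Vec.sum (Vec.replicate h 0) ≡ 0
    sum-replicate zero    = refl
    sum-replicate (suc h) = sum-replicate h
  ... | inj₂ (a , a∈ , eq) = weights x a
    , ≤-trans (≤-reflexive (sum-weights x a))
        (+-monoˡ-≤ (2 * h) (*-monoʳ-≤ 8 (≤-trans (≤-reflexive (sym eq)) (near≤D D As x))))
    , λ i k st → subst (_ ≤_) (sym (lookup-weights x a i)) (≤-trans
        (let le = ≤-trans (∸-mono (near≤dist D As (x Vec.[ i ]≔ k) a∈) (≤-reflexive (sym eq)))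
                    (≤-reflexive (dist-update x a i k)) in *-mono-≤ le le)
        (st (Vec.lookup a i)))

  _∈?_ : ∀ {h} (x : Vec K h) (As : List (Vec K h)) → Dec (x ∈ As)
  x ∈? As = any? (≡-dec _≟_ x) As

  size : ∀ {h} → List (Vec K h) → ℕ
  size {h} As = ∑ (allVec ks h) (λ x → ind (x ∈? As))

  -- The truncated distance to As is 0 on As and D on Bs, yet has small energy.
  concentration : Linked (λ k k′ → Step k k′ × Step k′ k) ks →
    ∀ {h} D (As Bs : List (Vec K h)) → (∀ {a b} → a ∈ As → b ∈ Bs → D ≤ dist b a) →
    size As * size Bs * (D * D)
    ≤ length ks * length ks * (length (allVec ks h) * (length (allVec ks h) * (16 * D + 4 * h)))
  concentration linked {h} D As Bs far = begin
    size As * size Bs * (D * D)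
      ≡⟨ cong (_* (D * D)) (∑∑-* Ω Ω _ _) ⟨
    ∑ Ω (λ x → ∑ Ω (λ y → ind (x ∈? As) * ind (y ∈? Bs))) * (D * D)
      ≡⟨ trans (sym (∑-*ʳ Ω (D * D) _)) (∑-cong Ω (λ x → sym (∑-*ʳ Ω (D * D) _))) ⟩
    ∑ Ω (λ x → ∑ Ω (λ y → ind (x ∈? As) * ind (y ∈? Bs) * (D * D)))
      ≤⟨ ∑-mono Ω (λ x → ∑-mono Ω (λ y → pointwise x y)) ⟩
    ∑ Ω (λ x → ∑ Ω (λ y → δ (f x) (f y)))
      ≤⟨ variance≤energy ks h f ⟩
    m * m * (n * energy ks h f)
      ≤⟨ *-monoʳ-≤ (m * m) (*-monoʳ-≤ n (≤-trans
           (energy-≤ ks Step linked h f (λ x → proj₁ (slope D As x)) (λ x → proj₂ (proj₂ (slope D As x))))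
           (≤-trans (∑-mono Ω (λ x → ≤-trans (*-monoʳ-≤ 2 (proj₁ (proj₂ (slope D As x)))) (≤-reflexive (eq D h))))
                    (≤-reflexive (∑-const Ω _))))) ⟩
    m * m * (n * (n * (16 * D + 4 * h))) ∎
    where
    open ≤-Reasoning
    m = length ks
    Ω = allVec ks h
    n = length Ω
    f : Vec K h → ℕ
    f = near D As
    eq : ∀ D h → 2 * (8 * D + 2 * h) ≡ 16 * D + 4 * h
    eq = solve-∀
    pointwise : ∀ x y → ind (x ∈? As) * ind (y ∈? Bs) * (D * D) ≤ δ (f x) (f y)
    pointwise x y with x ∈? As | y ∈? Bs
    ... | no _   | _      = z≤n
    ... | yes _  | no _   = z≤n
    ... | yes x∈ | yes y∈ = ≤-reflexive (trans (+-identityʳ (D * D)) (sym (cong₂ δ fx≡0 fy≡D)))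
      where
      fx≡0 : f x ≡ 0
      fx≡0 = n≤0⇒n≡0 (≤-trans (near≤dist D As x x∈) (≤-reflexive (dist-refl x)))
      fy≡D : f y ≡ D
      fy≡D = ≤-antisym (near≤D D As y) (D≤near D As y (λ a∈ → far a∈ y∈))

-- The power of a square boundary and the sign cube

sqd : ℤ → ℤ → ℕ
sqd i j = ℤ.∣ i ℤ.- j ∣ * ℤ.∣ i ℤ.- j ∣

sqd-refl : ∀ i → sqd i i ≡ 0
sqd-refl i rewrite ℤₚ.+-inverseʳ i = refl

-- A unit step raises t² by at most 2t + 1, and (2t + 1)² ≤ 8t² + 2.
sqd-step : ∀ {i j} → ℤ.∣ j ℤ.- i ∣ ≤ 1 → ∀ a → (sqd j a ∸ sqd i a) * (sqd j a ∸ sqd i a) ≤ 8 * sqd i a + 2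
sqd-step {i} {j} ∣j-i∣≤1 a = begin
  (sqd j a ∸ sqd i a) * (sqd j a ∸ sqd i a)  ≤⟨ *-mono-≤ diff diff ⟩
  (2 * t + 1) * (2 * t + 1)                  ≤⟨ bound t ⟩
  8 * (t * t) + 2                            ∎
  where
  open ≤-Reasoning
  t = ℤ.∣ i ℤ.- a ∣
  telescope : ∀ i j a → j ℤ.- a ≡ (j ℤ.- i) ℤ.+ (i ℤ.- a)
  telescope = ℤ-Ring.solve-∀
  ∣j-a∣≤ : ℤ.∣ j ℤ.- a ∣ ≤ 1 + t
  ∣j-a∣≤ = ≤-trans (≤-reflexive (cong ℤ.∣_∣ (telescope i j a)))
             (≤-trans (ℤₚ.∣i+j∣≤∣i∣+∣j∣ (j ℤ.- i) (i ℤ.- a)) (+-monoˡ-≤ t ∣j-i∣≤1))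
  eq : ∀ t → (1 + t) * (1 + t) ≡ (2 * t + 1) + t * t
  eq = solve-∀
  diff : sqd j a ∸ sqd i a ≤ 2 * t + 1
  diff = ≤-trans (∸-monoˡ-≤ (t * t) (*-mono-≤ ∣j-a∣≤ ∣j-a∣≤))
           (≤-reflexive (trans (cong (_∸ t * t) (eq t)) (m+n∸n≡m (2 * t + 1) (t * t))))
  eq₁ : ∀ t → (2 * t + 1) * (2 * t + 1) ≡ 2 * (2 * t * 1) + (4 * (t * t) + 1)
  eq₁ = solve-∀
  eq₂ : ∀ t → (2 * t) * (2 * t) + 1 * 1 + (4 * (t * t) + 1) ≡ 8 * (t * t) + 2
  eq₂ = solve-∀
  bound : ∀ t → (2 * t + 1) * (2 * t + 1) ≤ 8 * (t * t) + 2
  bound t rewrite eq₁ t = ≤-trans (+-monoˡ-≤ (4 * (t * t) + 1) (2ab≤a²+b² (2 * t) 1)) (≤-reflexive (eq₂ t))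

-- The block ends one short of `g n`, and `z` takes the place of `g n`. At a corner of the square
-- these are two names of one point, which is what `glue` expresses.
linked-applyUpTo-++ : {R : A → A → Set} (g : ℕ → A) (n : ℕ) {z : A} {zs : List A} →
  (∀ i → R (g i) (g (suc i))) → (∀ x → R x (g n) → R x z) → Linked R (z ∷ zs) →
  Linked R (applyUpTo g n ++ z ∷ zs)
linked-applyUpTo-++ g zero          step glue l = l
linked-applyUpTo-++ g (suc zero)    step glue l = glue (g 0) (step 0) ∷ l
linked-applyUpTo-++ g (suc (suc n)) step glue l =
  step 0 ∷ linked-applyUpTo-++ (g ∘ suc) (suc n) (step ∘ suc) glue l

linked-applyUpTo : {R : A → A → Set} (g : ℕ → A) (n : ℕ) → (∀ i → R (g i) (g (suc i))) → Linked R (applyUpTo g n)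
linked-applyUpTo g zero          step = []
linked-applyUpTo g (suc zero)    step = [-]
linked-applyUpTo g (suc (suc n)) step = step 0 ∷ linked-applyUpTo (g ∘ suc) (suc n) (step ∘ suc)

∑-applyUpTo-∘ : (g : ℕ → A) (k : A → B) (n : ℕ) (f : B → ℕ) → ∑ (applyUpTo g n) (f ∘ k) ≡ ∑ (applyUpTo (k ∘ g) n) f
∑-applyUpTo-∘ g k zero    f = refl
∑-applyUpTo-∘ g k (suc n) f = cong (f (k (g 0)) +_) (∑-applyUpTo-∘ (g ∘ suc) k n f)

∑-allVec-map : (ks : List A) (τ : A → A) → (∀ f → ∑ ks (f ∘ τ) ≡ ∑ ks f) →
               ∀ h (f : Vec A h → ℕ) → ∑ (allVec ks h) (f ∘ Vec.map τ) ≡ ∑ (allVec ks h) f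
∑-allVec-map ks τ inv zero    f = refl
∑-allVec-map ks τ inv (suc h) f = begin
  ∑ (allVec ks (suc h)) (f ∘ Vec.map τ)                          ≡⟨ ∑-allVec ks h _ ⟩
  ∑ ks (λ k → ∑ (allVec ks h) (λ v → f (τ k ∷ Vec.map τ v)))    ≡⟨ ∑-cong ks (λ k → ∑-allVec-map ks τ inv h (λ v → f (τ k ∷ v))) ⟩
  ∑ ks (λ k → ∑ (allVec ks h) (λ v → f (τ k ∷ v)))              ≡⟨ inv (λ k → ∑ (allVec ks h) (λ v → f (k ∷ v))) ⟩
  ∑ ks (λ k → ∑ (allVec ks h) (λ v → f (k ∷ v)))                ≡⟨ ∑-allVec ks h f ⟨
  ∑ (allVec ks (suc h)) f                                        ∎
  where open ≡-Reasoning

sgn : Bool → ℤ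
sgn true  = ℤ.1ℤ
sgn false = ℤ.-1ℤ

sgn-not : ∀ b → sgn (not b) ≡ ℤ.- sgn b
sgn-not true  = refl
sgn-not false = refl

ham : Bool → Bool → ℕ
ham true  true  = 0
ham true  false = 1
ham false true  = 1
ham false false = 0

Sign² : Set
Sign² = Bool × Bool

-- Ordered so that consecutive points differ in one sign.
signs : List Sign²
signs = (true , false) ∷ (true , true) ∷ (false , true) ∷ (false , false) ∷ []

qY : Sign² → Sign² → ℕ
qY (a , b) (c , d) = ham a c + ham b d

negY : Sign² → Sign²
negY (a , b) = not a , not b

ham-refl : ∀ a → ham a a ≡ 0
ham-refl true  = refl
ham-refl false = refl

qY-refl : ∀ k → qY k k ≡ 0
qY-refl (a , b) = cong₂ _+_ (ham-refl a) (ham-refl b)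

module CY = Concentration (×-≡-dec _≟ᵇ_ _≟ᵇ_) signs qY qY-refl

∑-negY : ∀ f → ∑ signs (f ∘ negY) ≡ ∑ signs f
∑-negY f = eq (f (false , true)) (f (false , false)) (f (true , false)) (f (true , true))
  where
  eq : ∀ a b c d → a + (b + (c + (d + 0))) ≡ c + (d + (a + (b + 0)))
  eq = solve-∀

signs-linked : Linked (λ k k′ → CY.Step k k′ × CY.Step k′ k) signs
signs-linked =
    ((λ (a , b) → fromSucc (second a true false b)) , (λ (a , b) → fromSucc (second a true true b)))
  ∷ ((λ (a , b) → fromSucc (first b true true a)) , (λ (a , b) → fromSucc (first b true false a)))
  ∷ ((λ (a , b) → fromSucc (second a false true b)) , (λ (a , b) → fromSucc (second a false false b)))
  ∷ [-]
  where
  fromSucc : ∀ {m n} → m ≤ suc n → (m ∸ n) * (m ∸ n) ≤ 8 * n + 2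
  fromSucc {m} {n} m≤ = ≤-trans (*-mono-≤ le le) (≤-trans (s≤s z≤n) (m≤n+m 2 (8 * n)))
    where
    le : m ∸ n ≤ 1
    le = m≤n+o⇒m∸n≤o m n (≤-trans m≤ (≤-reflexive (+-comm 1 n)))
  ham≤1 : ∀ a b → ham a b ≤ 1
  ham≤1 true  true  = z≤n
  ham≤1 true  false = ≤-refl
  ham≤1 false true  = ≤-refl
  ham≤1 false false = z≤n
  second : ∀ a σ τ b → ham σ a + ham (not τ) b ≤ suc (ham σ a + ham τ b)
  second a σ τ b = ≤-trans (+-monoʳ-≤ (ham σ a) (≤-trans (ham≤1 (not τ) b) (s≤s z≤n)))
                     (≤-reflexive (+-suc (ham σ a) (ham τ b)))
  first : ∀ b σ τ a → ham (not τ) a + ham σ b ≤ suc (ham τ a + ham σ b)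
  first b σ τ a = +-monoˡ-≤ (ham σ b) (≤-trans (ham≤1 (not τ) a) (s≤s z≤n))

module Ring (M : ℕ) where

  -- The boundary of the square [-M , M]²: the side x = M for s = false, the side y = M for s = true,
  -- and their antipodes.
  Point : Set
  Point = Bool × Bool × ℕ

  side₁ side₂ : Bool → ℕ → ℤ
  side₁ false k = ℤ.+ M
  side₁ true  k = ℤ.+ M ℤ.- ℤ.+ k
  side₂ false k = ℤ.+ k ℤ.- ℤ.+ M
  side₂ true  k = ℤ.+ M

  px py : Point → ℤ
  px (σ , s , k) = sgn σ ℤ.* side₁ s k
  py (σ , s , k) = sgn σ ℤ.* side₂ s k

  negX : Point → Point
  negX (σ , s , k) = not σ , s , k

  px-neg : ∀ k → px (negX k) ≡ ℤ.- px k
  px-neg (σ , s , k) rewrite sgn-not σ = sym (ℤₚ.neg-distribˡ-* (sgn σ) (side₁ s k))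

  py-neg : ∀ k → py (negX k) ≡ ℤ.- py k
  py-neg (σ , s , k) rewrite sgn-not σ = sym (ℤₚ.neg-distribˡ-* (sgn σ) (side₂ s k))

  qX : Point → Point → ℕ
  qX k a = sqd (px k) (px a) + sqd (py k) (py a)

  -- A half-open side: the point with index `2 * M` is left out because it has the coordinates of
  -- the first point of the next side.
  edge : Bool → Bool → List Point
  edge σ s = applyUpTo (λ k → σ , s , k) (2 * M)

  ring : List Point
  ring = edge true false ++ edge true true ++ edge false false ++ edge false true

  length-ring : length ring ≡ 8 * M
  length-ring = begin
    length ring
      ≡⟨ length-++ (edge true false) ⟩
    length (edge true false) + length (edge true true ++ edge false false ++ edge false true)
      ≡⟨ cong₂ _+_ (length-edge true false) (length-++ (edge true true)) ⟩
    2 * M + (length (edge true true) + length (edge false false ++ edge false true))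
      ≡⟨ cong (2 * M +_) (cong₂ _+_ (length-edge true true)
           (trans (length-++ (edge false false)) (cong₂ _+_ (length-edge false false) (length-edge false true)))) ⟩
    2 * M + (2 * M + (2 * M + 2 * M))
      ≡⟨ eq M ⟩
    8 * M ∎
    where
    open ≡-Reasoning
    length-edge : ∀ σ s → length (edge σ s) ≡ 2 * M
    length-edge σ s = length-applyUpTo (λ k → σ , s , k) (2 * M)
    eq : ∀ M → 2 * M + (2 * M + (2 * M + 2 * M)) ≡ 8 * M
    eq = solve-∀

  ∑-negX : ∀ f → ∑ ring (f ∘ negX) ≡ ∑ ring f
  ∑-negX f = begin
    ∑ ring (f ∘ negX)
      ≡⟨ expand (f ∘ negX) ⟩
    ∑ (edge true false) (f ∘ negX) + (∑ (edge true true) (f ∘ negX)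
      + (∑ (edge false false) (f ∘ negX) + ∑ (edge false true) (f ∘ negX)))
      ≡⟨ cong₂ _+_ (∑-edge true false) (cong₂ _+_ (∑-edge true true) (cong₂ _+_ (∑-edge false false) (∑-edge false true))) ⟩
    ∑ (edge false false) f + (∑ (edge false true) f + (∑ (edge true false) f + ∑ (edge true true) f))
      ≡⟨ eq (∑ (edge false false) f) (∑ (edge false true) f) (∑ (edge true false) f) (∑ (edge true true) f) ⟩
    ∑ (edge true false) f + (∑ (edge true true) f + (∑ (edge false false) f + ∑ (edge false true) f))
      ≡⟨ expand f ⟨
    ∑ ring f ∎
    where
    open ≡-Reasoning
    ∑-edge : ∀ σ s → ∑ (edge σ s) (f ∘ negX) ≡ ∑ (edge (not σ) s) f
    ∑-edge σ s = ∑-applyUpTo-∘ (λ k → σ , s , k) negX (2 * M) f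
    expand : ∀ g → ∑ ring g ≡ ∑ (edge true false) g + (∑ (edge true true) g
                               + (∑ (edge false false) g + ∑ (edge false true) g))
    expand g = trans (∑-++ (edge true false) _ g) (cong (∑ (edge true false) g +_)
               (trans (∑-++ (edge true true) _ g) (cong (∑ (edge true true) g +_) (∑-++ (edge false false) _ g))))
    eq : ∀ a b c d → a + (b + (c + d)) ≡ c + (d + (a + b))
    eq = solve-∀

  _≟ᵖ_ : DecidableEquality Point
  _≟ᵖ_ = ×-≡-dec _≟ᵇ_ (×-≡-dec _≟ᵇ_ _≟_)

  module CX = Concentration _≟ᵖ_ ring qX
    (λ k → cong₂ _+_ (sqd-refl (px k)) (sqd-refl (py k)))

  private
    -- Stated through coordinates rather than names, so that it does not distinguish the two names
    -- of a corner. Only one coordinate moves, hence the increase of `qX` is that of a single `sqd`.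
    Next : Point → Point → Set
    Next k k′ = (px k′ ≡ px k × ℤ.∣ py k′ ℤ.- py k ∣ ≤ 1) ⊎ (ℤ.∣ px k′ ℤ.- px k ∣ ≤ 1 × py k′ ≡ py k)

    next⇒step : ∀ {k k′} → Next k k′ → CX.Step k k′
    next⇒step {k} {k′} (inj₁ (eq , le)) a rewrite eq
      | [m+n]∸[m+o]≡n∸o (sqd (px k) (px a)) (sqd (py k′) (py a)) (sqd (py k) (py a)) =
      ≤-trans (sqd-step {py k} {py k′} le (py a))
        (+-monoˡ-≤ 2 (*-monoʳ-≤ 8 (m≤n+m (sqd (py k) (py a)) (sqd (px k) (px a)))))
    next⇒step {k} {k′} (inj₂ (le , eq)) a rewrite eq
      | +-comm (sqd (px k′) (px a)) (sqd (py k) (py a)) | +-comm (sqd (px k) (px a)) (sqd (py k) (py a))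
      | [m+n]∸[m+o]≡n∸o (sqd (py k) (py a)) (sqd (px k′) (px a)) (sqd (px k) (px a)) =
      ≤-trans (sqd-step {px k} {px k′} le (px a))
        (+-monoˡ-≤ 2 (*-monoʳ-≤ 8 (m≤n+m (sqd (px k) (px a)) (sqd (py k) (py a)))))

    next-sym : ∀ {k k′} → Next k k′ → Next k′ k
    next-sym {k} {k′} (inj₁ (eq , le)) = inj₁ (sym eq , subst (_≤ 1) (ℤₚ.∣i-j∣≡∣j-i∣ (py k′) (py k)) le)
    next-sym {k} {k′} (inj₂ (le , eq)) = inj₂ (subst (_≤ 1) (ℤₚ.∣i-j∣≡∣j-i∣ (px k′) (px k)) le , sym eq)

    ∣sgn∣ : ∀ σ z → ℤ.∣ z ∣ ≡ 1 → ℤ.∣ sgn σ ℤ.* z ∣ ≤ 1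
    ∣sgn∣ true  z eq rewrite ℤₚ.*-identityˡ z = ≤-reflexive eq
    ∣sgn∣ false z eq rewrite ℤₚ.-1*i≡-i z | ℤₚ.∣-i∣≡∣i∣ z = ≤-reflexive eq

    along : ∀ σ s k → Next (σ , s , k) (σ , s , suc k)
    along σ false k = inj₁ (refl , subst (λ z → ℤ.∣ z ∣ ≤ 1) (sym (eq (sgn σ) (ℤ.+ k) (ℤ.+ M))) (∣sgn∣ σ ℤ.1ℤ refl))
      where
      eq : ∀ s k M → s ℤ.* ((ℤ.1ℤ ℤ.+ k) ℤ.- M) ℤ.- s ℤ.* (k ℤ.- M) ≡ s ℤ.* ℤ.1ℤ
      eq = ℤ-Ring.solve-∀
    along σ true k = inj₂ (subst (λ z → ℤ.∣ z ∣ ≤ 1) (sym (eq (sgn σ) (ℤ.+ k) (ℤ.+ M))) (∣sgn∣ σ ℤ.-1ℤ refl) , refl)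
      where
      eq : ∀ s k M → s ℤ.* (M ℤ.- (ℤ.1ℤ ℤ.+ k)) ℤ.- s ℤ.* (M ℤ.- k) ≡ s ℤ.* ℤ.-1ℤ
      eq = ℤ-Ring.solve-∀

    transport : ∀ k k′ → px k ≡ px k′ → py k ≡ py k′ → ∀ x → Next x k → Next x k′
    transport k k′ eqx eqy x n rewrite eqx | eqy = n

    +2M : ℤ.+ (2 * M) ≡ ℤ.+ M ℤ.+ ℤ.+ M
    +2M = cong (λ z → ℤ.+ (M + z)) (+-identityʳ M)

    corner₁ : ∀ σ x → Next x (σ , false , 2 * M) → Next x (σ , true , 0)
    corner₁ σ = transport (σ , false , 2 * M) (σ , true , 0) (cong (sgn σ ℤ.*_) (sym (ℤₚ.+-identityʳ (ℤ.+ M))))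
      (cong (sgn σ ℤ.*_) (trans (cong (ℤ._- ℤ.+ M) +2M) (eq (ℤ.+ M))))
      where
      eq : ∀ M → (M ℤ.+ M) ℤ.- M ≡ M
      eq = ℤ-Ring.solve-∀

    corner₂ : ∀ x → Next x (true , true , 2 * M) → Next x (false , false , 0)
    corner₂ = transport (true , true , 2 * M) (false , false , 0) (trans (cong (λ z → ℤ.1ℤ ℤ.* (ℤ.+ M ℤ.- z)) +2M) (eq₁ (ℤ.+ M))) (eq₂ (ℤ.+ M))
      where
      eq₁ : ∀ M → ℤ.1ℤ ℤ.* (M ℤ.- (M ℤ.+ M)) ≡ ℤ.-1ℤ ℤ.* M
      eq₁ = ℤ-Ring.solve-∀
      eq₂ : ∀ M → ℤ.1ℤ ℤ.* M ≡ ℤ.-1ℤ ℤ.* (ℤ.0ℤ ℤ.- M)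
      eq₂ = ℤ-Ring.solve-∀

  ring-linked : Linked (λ k k′ → CX.Step k k′ × CX.Step k′ k) ring
  ring-linked = Linked.map (λ {k} {k′} r → next⇒step {k} {k′} r , next⇒step {k′} {k} (next-sym {k} {k′} r)) (closed (2 * M) refl)
    where
    -- The side length becomes a variable so that the degenerate empty ring can be split off by
    -- cases.
    closed : ∀ n → n ≡ 2 * M → Linked Next
      (applyUpTo (λ k → true , false , k) n ++ applyUpTo (λ k → true , true , k) n
        ++ applyUpTo (λ k → false , false , k) n ++ applyUpTo (λ k → false , true , k) n)
    closed zero    _  = []
    closed (suc n) eq =
      linked-applyUpTo-++ (λ k → true , false , k) (suc n) (along true false)
        (λ x → corner₁ true x ∘ subst (λ k → Next x (true , false , k)) eq)
      (linked-applyUpTo-++ (λ k → true , true , k) (suc n) (along true true)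
        (λ x → corner₂ x ∘ subst (λ k → Next x (true , true , k)) eq)
      (linked-applyUpTo-++ (λ k → false , false , k) (suc n) (along false false)
        (λ x → corner₁ false x ∘ subst (λ k → Next x (false , false , k)) eq)
      (linked-applyUpTo (λ k → false , true , k) (suc n) (along false true))))

-- Near-antipodal pairs and second moments in the sign cube

nsq : ℤ → ℕ
nsq i = ℤ.∣ i ∣ * ℤ.∣ i ∣

drop-≤ : ∀ {m n i} → ℤ.+ n ≡ ℤ.+ m ℤ.+ i → ℤ.0ℤ ℤ.≤ i → m ≤ n
drop-≤ {m} {n} {i} eq 0≤i = ℤₚ.drop‿+≤+ (subst (ℤ.+ m ℤ.≤_) (sym eq)
  (subst (ℤ._≤ ℤ.+ m ℤ.+ i) (ℤₚ.+-identityʳ (ℤ.+ m)) (ℤₚ.+-monoʳ-≤ (ℤ.+ m) 0≤i)))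

0≤nsq : ∀ i → ℤ.0ℤ ℤ.≤ i ℤ.* i
0≤nsq i = subst (ℤ.0ℤ ℤ.≤_) (∣i∣² i) (ℤ.+≤+ z≤n)

antiY : ∀ {h} → Vec Sign² h → Vec Sign² h → ℕ
antiY y y′ = CY.dist y (Vec.map negY y′)

antiY-sym : ∀ {h} (y y′ : Vec Sign² h) → antiY y y′ ≡ antiY y′ y
antiY-sym []            []            = refl
antiY-sym ((a , b) ∷ y) ((c , d) ∷ z) = cong₂ _+_ (cong₂ _+_ (bit a c) (bit b d)) (antiY-sym y z)
  where
  bit : ∀ a b → ham a (not b) ≡ ham b (not a)
  bit true  true  = refl
  bit true  false = refl
  bit false true  = refl
  bit false false = refl

distY-sym : ∀ {h} (y y′ : Vec Sign² h) → CY.dist y y′ ≡ CY.dist y′ y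
distY-sym []            []            = refl
distY-sym ((a , b) ∷ y) ((c , d) ∷ z) = cong₂ _+_ (cong₂ _+_ (bit a c) (bit b d)) (distY-sym y z)
  where
  bit : ∀ a b → ham a b ≡ ham b a
  bit true  true  = refl
  bit true  false = refl
  bit false true  = refl
  bit false false = refl

-- Among three signs two agree, so every coordinate costs at least 1 in one of the three pairs.
antiY-triangle : ∀ {h} (x y z : Vec Sign² h) → 2 * h ≤ antiY x y + antiY x z + antiY y z
antiY-triangle [] [] [] = z≤n
antiY-triangle {suc h} ((a , a′) ∷ x) ((b , b′) ∷ y) ((c , c′) ∷ z) = begin
  2 * suc h                                    ≡⟨ eq₁ h ⟩
  1 + 1 + 2 * h                                ≤⟨ +-mono-≤ (+-mono-≤ (bit a b c) (bit a′ b′ c′)) (antiY-triangle x y z) ⟩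
  (ham a (not b) + ham a (not c) + ham b (not c)) + (ham a′ (not b′) + ham a′ (not c′) + ham b′ (not c′))
    + (antiY x y + antiY x z + antiY y z)
    ≡⟨ eq₂ (ham a (not b)) (ham a (not c)) (ham b (not c)) (ham a′ (not b′)) (ham a′ (not c′)) (ham b′ (not c′))
           (antiY x y) (antiY x z) (antiY y z) ⟩
  _ ∎
  where
  open ≤-Reasoning
  bit : ∀ a b c → 1 ≤ ham a (not b) + ham a (not c) + ham b (not c)
  bit true  true  _     = s≤s z≤n
  bit true  false true  = s≤s z≤n
  bit true  false false = s≤s z≤n
  bit false true  true  = s≤s z≤n
  bit false true  false = s≤s z≤n
  bit false false _     = s≤s z≤n
  eq₁ : ∀ h → 2 * suc h ≡ 1 + 1 + 2 * h
  eq₁ = solve-∀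
  eq₂ : ∀ a b c a′ b′ c′ x y z → (a + b + c) + (a′ + b′ + c′) + (x + y + z)
      ≡ ((a + a′) + x) + ((b + b′) + y) + ((c + c′) + z)
  eq₂ = solve-∀

-- The triangle inequality through the antipode of `z`. It makes any two points near-antipodal to a
-- third one close, which the colouring of the circles relies on.
distY≤antiY+antiY : ∀ {h} (z x y : Vec Sign² h) → CY.dist x y ≤ antiY z x + antiY z y
distY≤antiY+antiY [] [] [] = z≤n
distY≤antiY+antiY ((c , c′) ∷ z) ((a , a′) ∷ x) ((b , b′) ∷ y) =
  ≤-trans (+-mono-≤ (+-mono-≤ (bit a b c) (bit a′ b′ c′)) (distY≤antiY+antiY z x y))
    (≤-reflexive (eq (ham c (not a)) (ham c (not b)) (ham c′ (not a′)) (ham c′ (not b′)) (antiY z x) (antiY z y)))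
  where
  bit : ∀ a b c → ham a b ≤ ham c (not a) + ham c (not b)
  bit true  true  _     = z≤n
  bit true  false true  = s≤s z≤n
  bit true  false false = s≤s z≤n
  bit false true  true  = s≤s z≤n
  bit false true  false = s≤s z≤n
  bit false false _     = z≤n
  eq : ∀ a b a′ b′ x y → (a + b) + (a′ + b′) + (x + y) ≡ ((a + a′) + x) + ((b + b′) + y)
  eq = solve-∀

dotY : ∀ {h} → Vec Sign² h → Vec Sign² h → ℤ
dotY []            []            = ℤ.0ℤ
dotY ((a , b) ∷ y) ((c , d) ∷ z) = sgn a ℤ.* sgn c ℤ.+ sgn b ℤ.* sgn d ℤ.+ dotY y z

dotY-dist : ∀ {h} (y z : Vec Sign² h) → ℤ.+ (2 * h) ≡ ℤ.+ (2 * CY.dist y z) ℤ.+ dotY y z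
dotY-dist [] [] = refl
dotY-dist {suc h} ((a , b) ∷ y) ((c , d) ∷ z) = begin
  ℤ.+ (2 * suc h)                 ≡⟨ cong ℤ.+_ (eq₁ h) ⟩
  ℤ.+ 2 ℤ.+ ℤ.+ (2 * h)           ≡⟨ cong (λ i → ℤ.+ 2 ℤ.+ i) (dotY-dist y z) ⟩
  ℤ.+ 2 ℤ.+ (ℤ.+ (2 * CY.dist y z) ℤ.+ dotY y z)
    ≡⟨ cong (ℤ._+ (ℤ.+ (2 * CY.dist y z) ℤ.+ dotY y z)) (cong₂ ℤ._+_ (bit a c) (bit b d)) ⟩
  ((ℤ.+ (2 * ham a c) ℤ.+ sgn a ℤ.* sgn c) ℤ.+ (ℤ.+ (2 * ham b d) ℤ.+ sgn b ℤ.* sgn d)) ℤ.+ (ℤ.+ (2 * CY.dist y z) ℤ.+ dotY y z)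
    ≡⟨ eq₂ (ℤ.+ (2 * ham a c)) (sgn a ℤ.* sgn c) (ℤ.+ (2 * ham b d)) (sgn b ℤ.* sgn d) (ℤ.+ (2 * CY.dist y z)) (dotY y z) ⟩
  ((ℤ.+ (2 * ham a c) ℤ.+ ℤ.+ (2 * ham b d)) ℤ.+ ℤ.+ (2 * CY.dist y z)) ℤ.+ (sgn a ℤ.* sgn c ℤ.+ sgn b ℤ.* sgn d ℤ.+ dotY y z)
    ≡⟨ cong (λ n → ℤ.+ n ℤ.+ (sgn a ℤ.* sgn c ℤ.+ sgn b ℤ.* sgn d ℤ.+ dotY y z)) (eq₃ (ham a c) (ham b d) (CY.dist y z)) ⟩
  ℤ.+ (2 * (ham a c + ham b d + CY.dist y z)) ℤ.+ (sgn a ℤ.* sgn c ℤ.+ sgn b ℤ.* sgn d ℤ.+ dotY y z) ∎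
  where
  open ≡-Reasoning
  bit : ∀ a c → ℤ.+ 1 ≡ ℤ.+ (2 * ham a c) ℤ.+ sgn a ℤ.* sgn c
  bit true  true  = refl
  bit true  false = refl
  bit false true  = refl
  bit false false = refl
  eq₁ : ∀ h → 2 * suc h ≡ 2 + 2 * h
  eq₁ = solve-∀
  eq₂ : ∀ a b c d e f → ((a ℤ.+ b) ℤ.+ (c ℤ.+ d)) ℤ.+ (e ℤ.+ f) ≡ ((a ℤ.+ c) ℤ.+ e) ℤ.+ (b ℤ.+ d ℤ.+ f)
  eq₂ = ℤ-Ring.solve-∀
  eq₃ : ∀ a b c → 2 * a + 2 * b + 2 * c ≡ 2 * (a + b + c)
  eq₃ = solve-∀

dotY-neg : ∀ {h} (y z : Vec Sign² h) → dotY y (Vec.map negY z) ≡ ℤ.- dotY y z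
dotY-neg [] [] = refl
dotY-neg ((a , b) ∷ y) ((c , d) ∷ z) rewrite dotY-neg y z | sgn-not c | sgn-not d = eq (sgn a) (sgn b) (sgn c) (sgn d) (dotY y z)
  where
  eq : ∀ a b c d e → a ℤ.* ℤ.- c ℤ.+ b ℤ.* ℤ.- d ℤ.+ ℤ.- e ≡ ℤ.- (a ℤ.* c ℤ.+ b ℤ.* d ℤ.+ e)
  eq = ℤ-Ring.solve-∀

length-signs^ : ∀ h → length (allVec signs h) ≡ 4 ^ h
length-signs^ zero    = refl
length-signs^ (suc h) = trans (length-allVec signs h) (cong (4 *_) (length-signs^ h))

-- The inner product is a sum of 2h independent signs, so the variances add up to 2h. The offset `t`
-- carries the coordinates already fixed through the induction.
∑-nsq-dotY : ∀ {h} (y : Vec Sign² h) t →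
  ∑ (allVec signs h) (λ z → nsq (t ℤ.+ dotY y z)) ≡ 4 ^ h * (nsq t + 2 * h)
∑-nsq-dotY [] t rewrite ℤₚ.+-identityʳ t = eq (nsq t)
  where
  eq : ∀ n → n + 0 ≡ 1 * (n + 0)
  eq = solve-∀
∑-nsq-dotY {suc h} ((a , b) ∷ y) t = begin
  ∑ (allVec signs (suc h)) (λ z → nsq (t ℤ.+ dotY ((a , b) ∷ y) z))
    ≡⟨ ∑-allVec signs h _ ⟩
  ∑ signs (λ (c , d) → ∑ (allVec signs h) (λ z → nsq (t ℤ.+ (sgn a ℤ.* sgn c ℤ.+ sgn b ℤ.* sgn d ℤ.+ dotY y z))))
    ≡⟨ ∑-cong signs (λ (c , d) → trans
         (∑-cong (allVec signs h) (λ z → cong nsq (sym (ℤₚ.+-assoc t (sgn a ℤ.* sgn c ℤ.+ sgn b ℤ.* sgn d) (dotY y z)))))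
         (∑-nsq-dotY y (t ℤ.+ (sgn a ℤ.* sgn c ℤ.+ sgn b ℤ.* sgn d)))) ⟩
  ∑ signs (λ (c , d) → 4 ^ h * (nsq (t ℤ.+ (sgn a ℤ.* sgn c ℤ.+ sgn b ℤ.* sgn d)) + 2 * h))
    ≡⟨ ∑-*ˡ signs (4 ^ h) (λ (c , d) → nsq (t ℤ.+ (sgn a ℤ.* sgn c ℤ.+ sgn b ℤ.* sgn d)) + 2 * h) ⟩
  4 ^ h * ∑ signs (λ (c , d) → nsq (t ℤ.+ (sgn a ℤ.* sgn c ℤ.+ sgn b ℤ.* sgn d)) + 2 * h)
    ≡⟨ cong (4 ^ h *_) (trans (∑-+ signs (λ (c , d) → nsq (t ℤ.+ (sgn a ℤ.* sgn c ℤ.+ sgn b ℤ.* sgn d))) (λ _ → 2 * h))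
         (cong₂ _+_ (four a b) (∑-const signs (2 * h)))) ⟩
  4 ^ h * ((4 * nsq t + 8) + 4 * (2 * h))
    ≡⟨ eq (4 ^ h) (nsq t) h ⟩
  4 * 4 ^ h * (nsq t + 2 * suc h) ∎
  where
  open ≡-Reasoning
  eq : ∀ p n h → p * ((4 * n + 8) + 4 * (2 * h)) ≡ 4 * p * (n + 2 * suc h)
  eq = solve-∀
  identity : ∀ t u v w x → (u ≡ ℤ.+ 2 × v ≡ ℤ.0ℤ × w ≡ ℤ.0ℤ × x ≡ ℤ.- ℤ.+ 2) →
    nsq (t ℤ.+ u) + (nsq (t ℤ.+ v) + (nsq (t ℤ.+ w) + (nsq (t ℤ.+ x) + 0))) ≡ 4 * nsq t + 8
  identity t u v w x (refl , refl , refl , refl) = ℤₚ.+-injective (begin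
    ℤ.+ nsq (t ℤ.+ ℤ.+ 2) ℤ.+ (ℤ.+ nsq (t ℤ.+ ℤ.0ℤ) ℤ.+ (ℤ.+ nsq (t ℤ.+ ℤ.0ℤ) ℤ.+ (ℤ.+ nsq (t ℤ.+ ℤ.- ℤ.+ 2) ℤ.+ ℤ.0ℤ)))
      ≡⟨ cong₂ ℤ._+_ (∣i∣² (t ℤ.+ ℤ.+ 2)) (cong₂ ℤ._+_ (∣i∣² (t ℤ.+ ℤ.0ℤ)) (cong₂ ℤ._+_ (∣i∣² (t ℤ.+ ℤ.0ℤ)) (cong (ℤ._+ ℤ.0ℤ) (∣i∣² (t ℤ.+ ℤ.- ℤ.+ 2))))) ⟩
    _ ≡⟨ poly t ⟩
    ℤ.+ 4 ℤ.* (t ℤ.* t) ℤ.+ ℤ.+ 8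
      ≡⟨ cong (ℤ._+ ℤ.+ 8) (trans (cong ((ℤ.+ 4) ℤ.*_) (sym (∣i∣² t))) (sym (ℤₚ.pos-* 4 (nsq t)))) ⟩
    ℤ.+ (4 * nsq t) ℤ.+ ℤ.+ 8 ∎)
    where
    poly : ∀ t → (t ℤ.+ ℤ.+ 2) ℤ.* (t ℤ.+ ℤ.+ 2) ℤ.+ ((t ℤ.+ ℤ.0ℤ) ℤ.* (t ℤ.+ ℤ.0ℤ) ℤ.+ ((t ℤ.+ ℤ.0ℤ) ℤ.* (t ℤ.+ ℤ.0ℤ)
             ℤ.+ ((t ℤ.+ ℤ.- ℤ.+ 2) ℤ.* (t ℤ.+ ℤ.- ℤ.+ 2) ℤ.+ ℤ.0ℤ))) ≡ ℤ.+ 4 ℤ.* (t ℤ.* t) ℤ.+ ℤ.+ 8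
    poly = ℤ-Ring.solve-∀
  rotate₁ : ∀ a b c d → a + (b + (c + (d + 0))) ≡ b + (a + (c + (d + 0)))
  rotate₁ = solve-∀
  rotate₂ : ∀ a b c d → a + (b + (c + (d + 0))) ≡ d + (a + (c + (b + 0)))
  rotate₂ = solve-∀
  rotate₃ : ∀ a b c d → a + (b + (c + (d + 0))) ≡ c + (b + (d + (a + 0)))
  rotate₃ = solve-∀
  rotate₄ : ∀ a b c d → a + (b + (c + (d + 0))) ≡ a + (b + (d + (c + 0)))
  rotate₄ = solve-∀
  at : ℤ → ℕ
  at u = nsq (t ℤ.+ u)
  -- The two sign products add up to 2, 0, 0 and -2, in an order that depends on `a` and `b`; the
  -- rotations sort them for `identity`.
  four : ∀ a b → ∑ signs (λ (c , d) → nsq (t ℤ.+ (sgn a ℤ.* sgn c ℤ.+ sgn b ℤ.* sgn d))) ≡ 4 * nsq t + 8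
  four true  true  = trans (rotate₁ (at ℤ.0ℤ) (at (ℤ.+ 2)) (at ℤ.0ℤ) (at (ℤ.- ℤ.+ 2))) (identity t _ _ _ _ (refl , refl , refl , refl))
  four true  false = trans (rotate₄ (at (ℤ.+ 2)) (at ℤ.0ℤ) (at (ℤ.- ℤ.+ 2)) (at ℤ.0ℤ)) (identity t _ _ _ _ (refl , refl , refl , refl))
  four false true  = trans (rotate₃ (at (ℤ.- ℤ.+ 2)) (at ℤ.0ℤ) (at (ℤ.+ 2)) (at ℤ.0ℤ)) (identity t _ _ _ _ (refl , refl , refl , refl))
  four false false = trans (rotate₂ (at ℤ.0ℤ) (at (ℤ.- ℤ.+ 2)) (at ℤ.0ℤ) (at (ℤ.+ 2))) (identity t _ _ _ _ (refl , refl , refl , refl))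

-- Chebyshev: ⟨y , z⟩ has second moment 2h, while both events force |⟨y , z⟩| ≥ h.
aligned-rare : ∀ {h} D → 4 * D ≤ h → (y : Vec Sign² h) (f : Vec Sign² h → ℕ) →
  (∀ z → f z ≤ 1) → (∀ z → 1 ≤ f z → antiY y z < D ⊎ CY.dist y z < 2 * D) →
  h * h * ∑ (allVec signs h) f ≤ 2 * h * 4 ^ h
aligned-rare {h} D 4D≤h y f f≤1 f⇒ = begin
  h * h * ∑ Ω f                             ≡⟨ ∑-*ˡ Ω (h * h) f ⟨
  ∑ Ω (λ z → h * h * f z)                   ≤⟨ ∑-mono Ω pointwise ⟩
  ∑ Ω (λ z → nsq (ℤ.0ℤ ℤ.+ dotY y z))       ≡⟨ ∑-nsq-dotY y ℤ.0ℤ ⟩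
  4 ^ h * (2 * h)                           ≡⟨ *-comm (4 ^ h) (2 * h) ⟩
  2 * h * 4 ^ h                             ∎
  where
  open ≤-Reasoning
  Ω = allVec signs h
  large : ∀ d i → ℤ.+ (2 * h) ≡ ℤ.+ (2 * d) ℤ.+ i → d < 2 * D → h ≤ ℤ.∣ i ∣
  large d i eq d<2D = +-cancelˡ-≤ (2 * d) h ℤ.∣ i ∣ (begin
    2 * d + h                 ≤⟨ +-monoˡ-≤ h (≤-trans (*-monoʳ-≤ 2 (<⇒≤ d<2D)) (≤-trans (≤-reflexive (4D D)) 4D≤h)) ⟩
    h + h                     ≡⟨ cong (h +_) (+-identityʳ h) ⟨
    ℤ.∣ ℤ.+ (2 * h) ∣         ≡⟨ cong ℤ.∣_∣ eq ⟩
    ℤ.∣ ℤ.+ (2 * d) ℤ.+ i ∣   ≤⟨ ℤₚ.∣i+j∣≤∣i∣+∣j∣ (ℤ.+ (2 * d)) i ⟩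
    2 * d + ℤ.∣ i ∣           ∎)
    where
    4D : ∀ D → 2 * (2 * D) ≡ 4 * D
    4D = solve-∀
  h≤∣dot∣ : ∀ z → antiY y z < D ⊎ CY.dist y z < 2 * D → h ≤ ℤ.∣ dotY y z ∣
  h≤∣dot∣ z (inj₁ <D) = subst (h ≤_) (trans (cong ℤ.∣_∣ (dotY-neg y z)) (ℤₚ.∣-i∣≡∣i∣ (dotY y z)))
    (large (antiY y z) (dotY y (Vec.map negY z)) (dotY-dist y (Vec.map negY z)) (≤-trans <D (m≤m+n D (D + 0))))
  h≤∣dot∣ z (inj₂ <2D) = large (CY.dist y z) (dotY y z) (dotY-dist y z) <2D
  pointwise : ∀ z → h * h * f z ≤ nsq (ℤ.0ℤ ℤ.+ dotY y z)
  pointwise z rewrite ℤₚ.+-identityˡ (dotY y z) with f z | f≤1 z | f⇒ z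
  ... | zero        | _ | _ = ≤-trans (≤-reflexive (*-zeroʳ (h * h))) z≤n
  ... | suc zero    | _ | bad = ≤-trans (≤-reflexive (*-identityʳ (h * h)))
                                  (*-mono-≤ (h≤∣dot∣ z (bad ≤-refl)) (h≤∣dot∣ z (bad ≤-refl)))
  ... | suc (suc _) | s≤s () | _

-- Cauchy-Schwarz for 2a = (a + b) + (a + c) - (b + c); the gap is the usual sum of three squares.
nsq-triangle : ∀ a b c → 4 * nsq a ≤ 3 * (nsq (a ℤ.+ b) + nsq (a ℤ.+ c) + nsq (b ℤ.+ c))
nsq-triangle a b c = drop-≤ (begin
  ℤ.+ (3 * (nsq (a ℤ.+ b) + nsq (a ℤ.+ c) + nsq (b ℤ.+ c)))
    ≡⟨ ℤₚ.pos-* 3 (nsq (a ℤ.+ b) + nsq (a ℤ.+ c) + nsq (b ℤ.+ c)) ⟩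
  ℤ.+ 3 ℤ.* (ℤ.+ nsq (a ℤ.+ b) ℤ.+ ℤ.+ nsq (a ℤ.+ c) ℤ.+ ℤ.+ nsq (b ℤ.+ c))
    ≡⟨ cong (λ i → ℤ.+ 3 ℤ.* i) (cong₂ ℤ._+_ (cong₂ ℤ._+_ (∣i∣² (a ℤ.+ b)) (∣i∣² (a ℤ.+ c))) (∣i∣² (b ℤ.+ c))) ⟩
  _ ≡⟨ identity a b c ⟩
  ℤ.+ 4 ℤ.* (a ℤ.* a) ℤ.+ gap
    ≡⟨ cong (ℤ._+ gap) (trans (cong (λ i → ℤ.+ 4 ℤ.* i) (sym (∣i∣² a))) (sym (ℤₚ.pos-* 4 (nsq a)))) ⟩
  ℤ.+ (4 * nsq a) ℤ.+ gap ∎) (ℤₚ.+-mono-≤ (ℤₚ.+-mono-≤ (0≤nsq (b ℤ.- c)) (0≤nsq (a ℤ.+ b ℤ.+ (b ℤ.+ c)))) (0≤nsq (a ℤ.+ c ℤ.+ (b ℤ.+ c))))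
  where
  open ≡-Reasoning
  gap = (b ℤ.- c) ℤ.* (b ℤ.- c) ℤ.+ (a ℤ.+ b ℤ.+ (b ℤ.+ c)) ℤ.* (a ℤ.+ b ℤ.+ (b ℤ.+ c))
        ℤ.+ (a ℤ.+ c ℤ.+ (b ℤ.+ c)) ℤ.* (a ℤ.+ c ℤ.+ (b ℤ.+ c))
  identity : ∀ a b c → ℤ.+ 3 ℤ.* ((a ℤ.+ b) ℤ.* (a ℤ.+ b) ℤ.+ (a ℤ.+ c) ℤ.* (a ℤ.+ c) ℤ.+ (b ℤ.+ c) ℤ.* (b ℤ.+ c))
    ≡ ℤ.+ 4 ℤ.* (a ℤ.* a) ℤ.+ ((b ℤ.- c) ℤ.* (b ℤ.- c) ℤ.+ (a ℤ.+ b ℤ.+ (b ℤ.+ c)) ℤ.* (a ℤ.+ b ℤ.+ (b ℤ.+ c))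
        ℤ.+ (a ℤ.+ c ℤ.+ (b ℤ.+ c)) ℤ.* (a ℤ.+ c ℤ.+ (b ℤ.+ c)))
  identity = ℤ-Ring.solve-∀

-- Simple random walk and central binomial coefficients

∑-upTo-suc : ∀ n (f : ℕ → ℕ) → ∑ (upTo (suc n)) f ≡ f 0 + ∑ (upTo n) (f ∘ suc)
∑-upTo-suc n f = cong (f 0 +_) (sym (∑-applyUpTo-∘ id suc n f))

∑-upTo-last : ∀ n (f : ℕ → ℕ) → ∑ (upTo (suc n)) f ≡ ∑ (upTo n) f + f n
∑-upTo-last zero    f = +-identityʳ (f 0)
∑-upTo-last (suc n) f = begin
  ∑ (upTo (suc (suc n))) f                    ≡⟨ ∑-upTo-suc (suc n) f ⟩
  f 0 + ∑ (upTo (suc n)) (f ∘ suc)            ≡⟨ cong (f 0 +_) (∑-upTo-last n (f ∘ suc)) ⟩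
  f 0 + (∑ (upTo n) (f ∘ suc) + f (suc n))    ≡⟨ +-assoc (f 0) _ _ ⟨
  f 0 + ∑ (upTo n) (f ∘ suc) + f (suc n)      ≡⟨ cong (_+ f (suc n)) (∑-upTo-suc n f) ⟨
  ∑ (upTo (suc n)) f + f (suc n)              ∎
  where open ≡-Reasoning

∑-upTo-+ : ∀ m n (f : ℕ → ℕ) → ∑ (upTo (m + n)) f ≡ ∑ (upTo m) f + ∑ (upTo n) (λ i → f (m + i))
∑-upTo-+ zero    n f = refl
∑-upTo-+ (suc m) n f = begin
  ∑ (upTo (suc (m + n))) f                                                ≡⟨ ∑-upTo-suc (m + n) f ⟩
  f 0 + ∑ (upTo (m + n)) (f ∘ suc)                                        ≡⟨ cong (f 0 +_) (∑-upTo-+ m n (f ∘ suc)) ⟩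
  f 0 + (∑ (upTo m) (f ∘ suc) + ∑ (upTo n) (λ i → f (suc (m + i))))      ≡⟨ +-assoc (f 0) _ _ ⟨
  f 0 + ∑ (upTo m) (f ∘ suc) + ∑ (upTo n) (λ i → f (suc m + i))          ≡⟨ cong (_+ ∑ (upTo n) (λ i → f (suc m + i))) (∑-upTo-suc m f) ⟨
  ∑ (upTo (suc m)) f + ∑ (upTo n) (λ i → f (suc m + i))                  ∎
  where open ≡-Reasoning

-- The sum of ψ (number of +1's) over all sign sequences of length h.
walk : ℕ → (ℕ → ℕ) → ℕ
walk zero    ψ = ψ 0
walk (suc h) ψ = walk h ψ + walk h (ψ ∘ suc)

walk-cong : ∀ h {ψ ψ′ : ℕ → ℕ} → (∀ j → ψ j ≡ ψ′ j) → walk h ψ ≡ walk h ψ′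
walk-cong zero    eq = eq 0
walk-cong (suc h) eq = cong₂ _+_ (walk-cong h eq) (walk-cong h (eq ∘ suc))

walk-+ : ∀ h (ψ ψ′ : ℕ → ℕ) → walk h (λ j → ψ j + ψ′ j) ≡ walk h ψ + walk h ψ′
walk-+ zero    ψ ψ′ = refl
walk-+ (suc h) ψ ψ′ = trans (cong₂ _+_ (walk-+ h ψ ψ′) (walk-+ h (ψ ∘ suc) (ψ′ ∘ suc)))
  (eq (walk h ψ) (walk h ψ′) (walk h (ψ ∘ suc)) (walk h (ψ′ ∘ suc)))
  where
  eq : ∀ a b c d → (a + b) + (c + d) ≡ (a + c) + (b + d)
  eq = solve-∀

nC[1+n]≡0 : ∀ n → n C suc n ≡ 0
nC[1+n]≡0 n = k>n⇒nCk≡0 (n<1+n n)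

nC0≡1 : ∀ n → n C 0 ≡ 1
nC0≡1 n = refl

-- Splitting off one step of the walk is Pascal's rule.
walk-binomial : ∀ h ψ → walk h ψ ≡ ∑ (upTo (suc h)) (λ j → (h C j) * ψ j)
walk-binomial zero    ψ = eq (ψ 0)
  where
  eq : ∀ a → a ≡ 1 * a + 0
  eq = solve-∀
walk-binomial (suc h) ψ = begin
  walk h ψ + walk h (ψ ∘ suc)
    ≡⟨ cong₂ _+_ (walk-binomial h ψ) (walk-binomial h (ψ ∘ suc)) ⟩
  ∑ (upTo (suc h)) (λ j → (h C j) * ψ j) + S₂
    ≡⟨ cong (_+ S₂) (trans (sym (+-identityʳ _)) (cong (∑ (upTo (suc h)) (λ j → (h C j) * ψ j) +_) (sym (cong (_* ψ (suc h)) (nC[1+n]≡0 h))))) ⟩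
  ∑ (upTo (suc h)) (λ j → (h C j) * ψ j) + (h C suc h) * ψ (suc h) + S₂
    ≡⟨ cong (_+ S₂) (trans (sym (∑-upTo-last (suc h) (λ j → (h C j) * ψ j))) (∑-upTo-suc (suc h) (λ j → (h C j) * ψ j))) ⟩
  ((h C 0) * ψ 0 + S₁) + S₂
    ≡⟨ trans (+-assoc ((h C 0) * ψ 0) S₁ S₂) (cong₂ _+_ (cong (_* ψ 0) (trans (nC0≡1 h) (sym (nC0≡1 (suc h))))) (sym (∑-+ (upTo (suc h)) (λ j → (h C suc j) * ψ (suc j)) (λ j → (h C j) * ψ (suc j))))) ⟩
  (suc h C 0) * ψ 0 + ∑ (upTo (suc h)) (λ j → (h C suc j) * ψ (suc j) + (h C j) * ψ (suc j))
    ≡⟨ cong ((suc h C 0) * ψ 0 +_) (∑-cong (upTo (suc h)) (λ j → trans (sym (*-distribʳ-+ (ψ (suc j)) (h C suc j) (h C j)))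
         (cong (_* ψ (suc j)) (trans (+-comm (h C suc j) (h C j)) (nCk+nC[k+1]≡[n+1]C[k+1] h j))))) ⟩
  (suc h C 0) * ψ 0 + ∑ (upTo (suc h)) (λ j → (suc h C suc j) * ψ (suc j))
    ≡⟨ ∑-upTo-suc (suc h) (λ j → (suc h C j) * ψ j) ⟨
  ∑ (upTo (suc (suc h))) (λ j → (suc h C j) * ψ j) ∎
  where
  open ≡-Reasoning
  S₁ = ∑ (upTo (suc h)) (λ j → (h C suc j) * ψ (suc j))
  S₂ = ∑ (upTo (suc h)) (λ j → (h C j) * ψ (suc j))

[1+k]*nC[1+k]≡[n∸k]*nCk : ∀ n k → suc k * (n C suc k) ≡ (n ∸ k) * (n C k)
[1+k]*nC[1+k]≡[n∸k]*nCk zero    zero    = refl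
[1+k]*nC[1+k]≡[n∸k]*nCk zero    (suc k) = *-zeroʳ (suc (suc k))
[1+k]*nC[1+k]≡[n∸k]*nCk (suc n) zero    = trans (+-identityʳ _) (trans (nC1≡n (suc n))
  (sym (trans (cong (suc n *_) (nC0≡1 (suc n))) (*-identityʳ (suc n)))))
[1+k]*nC[1+k]≡[n∸k]*nCk (suc n) (suc k) with n ≤? k
... | yes n≤k rewrite m≤n⇒m∸n≡0 n≤k | k>n⇒nCk≡0 {suc n} {suc (suc k)} (s≤s (s≤s n≤k)) = *-zeroʳ (suc (suc k))
... | no n≰k = begin
  suc (suc k) * (suc n C suc (suc k))
    ≡⟨ cong (suc (suc k) *_) (nCk+nC[k+1]≡[n+1]C[k+1] n (suc k)) ⟨
  suc (suc k) * (a + b)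
    ≡⟨ eq₁ k a b ⟩
  a + (suc k * a + suc (suc k) * b)
    ≡⟨ cong (a +_) (cong₂ _+_ ([1+k]*nC[1+k]≡[n∸k]*nCk n k) ([1+k]*nC[1+k]≡[n∸k]*nCk n (suc k))) ⟩
  a + ((n ∸ k) * c + (n ∸ suc k) * a)
    ≡⟨ cong (λ z → a + (z * c + (n ∸ suc k) * a)) n∸k≡ ⟩
  a + (suc (n ∸ suc k) * c + (n ∸ suc k) * a)
    ≡⟨ eq₂ (n ∸ suc k) c a ⟩
  suc (n ∸ suc k) * (c + a)
    ≡⟨ cong₂ _*_ (sym n∸k≡) (nCk+nC[k+1]≡[n+1]C[k+1] n k) ⟩
  (n ∸ k) * (suc n C suc k) ∎
  where
  open ≡-Reasoning
  a = n C suc k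
  b = n C suc (suc k)
  c = n C k
  n∸k≡ : n ∸ k ≡ suc (n ∸ suc k)
  n∸k≡ = +-∸-assoc 1 (≰⇒> n≰k)
  eq₁ : ∀ k a b → suc (suc k) * (a + b) ≡ a + (suc k * a + suc (suc k) * b)
  eq₁ = solve-∀
  eq₂ : ∀ m c a → a + (suc m * c + m * a) ≡ suc m * (c + a)
  eq₂ = solve-∀

central : ℕ → ℕ
central g = (2 * g) C g

binomial-increasing : ∀ g j → j < g → (2 * g) C j ≤ (2 * g) C suc j
binomial-increasing g j j<g = *-cancelˡ-≤ (suc j) (begin
  suc j * ((2 * g) C j)          ≤⟨ *-monoˡ-≤ ((2 * g) C j) 1+j≤2g∸j ⟩
  (2 * g ∸ j) * ((2 * g) C j)    ≡⟨ [1+k]*nC[1+k]≡[n∸k]*nCk (2 * g) j ⟨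
  suc j * ((2 * g) C suc j)      ∎)
  where
  open ≤-Reasoning
  1+j≤2g∸j : suc j ≤ 2 * g ∸ j
  1+j≤2g∸j = m+n≤o⇒m≤o∸n (suc j) (≤-trans (+-mono-≤ j<g (<⇒≤ j<g)) (≤-reflexive (cong (g +_) (sym (+-identityʳ g)))))

binomial≤central-below : ∀ g j → j ≤ g → (2 * g) C j ≤ central g
binomial≤central-below g j j≤g = subst (λ z → (2 * g) C z ≤ central g) (m∸[m∸n]≡n j≤g) (go (g ∸ j) (m∸n≤m g j))
  where
  go : ∀ i → i ≤ g → (2 * g) C (g ∸ i) ≤ central g
  go zero    _   = ≤-refl
  go (suc i) i<g = ≤-trans (binomial-increasing g (g ∸ suc i) (∸-monoʳ-< z<s i<g))
    (subst (λ z → (2 * g) C z ≤ central g) (+-∸-assoc 1 i<g) (go i (<⇒≤ i<g)))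

binomial≤central : ∀ g j → (2 * g) C j ≤ central g
binomial≤central g j with j ≤? g | j ≤? 2 * g
... | yes j≤g | _        = binomial≤central-below g j j≤g
... | no _    | no j≰2g  = ≤-trans (≤-reflexive (k>n⇒nCk≡0 (≰⇒> j≰2g))) z≤n
... | no j≰g  | yes j≤2g = subst (_≤ central g) (sym (nCk≡nC[n∸k] j≤2g)) (binomial≤central-below g (2 * g ∸ j)
  (m≤n+o⇒m∸n≤o (2 * g) j (≤-trans (≤-reflexive (cong (g +_) (+-identityʳ g))) (+-monoˡ-≤ g (<⇒≤ (≰⇒> j≰g))))))

-- Passing from row 2g to row 2g + 2 uses the absorption identity twice and, in between, the
-- symmetry of row 2g + 1.
central-suc : ∀ g → suc g * central (suc g) ≡ 2 * suc (2 * g) * central g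
central-suc g = *-cancelˡ-≡ _ _ (suc g) (begin
  suc g * (suc g * ((2 * suc g) C suc g))
    ≡⟨ cong (λ z → suc g * (suc g * (z C suc g))) (2+2g g) ⟩
  suc g * (suc g * (suc (suc (2 * g)) C suc g))
    ≡⟨ cong (suc g *_) (absorb (suc (2 * g)) g) ⟩
  suc g * (suc (suc (2 * g)) * (suc (2 * g) C g))
    ≡⟨ cong (λ z → suc g * (suc (suc (2 * g)) * z)) symmetry ⟩
  suc g * (suc (suc (2 * g)) * (suc (2 * g) C suc g))
    ≡⟨ rearrange₁ (suc g) (suc (suc (2 * g))) (suc (2 * g) C suc g) ⟩
  suc (suc (2 * g)) * (suc g * (suc (2 * g) C suc g))
    ≡⟨ cong (suc (suc (2 * g)) *_) (absorb (2 * g) g) ⟩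
  suc (suc (2 * g)) * (suc (2 * g) * central g)
    ≡⟨ rearrange₂ g (central g) ⟩
  suc g * (2 * suc (2 * g) * central g) ∎)
  where
  open ≡-Reasoning
  2+2g : ∀ g → 2 * suc g ≡ suc (suc (2 * g))
  2+2g = solve-∀
  rearrange₁ : ∀ a b c → a * (b * c) ≡ b * (a * c)
  rearrange₁ = solve-∀
  rearrange₂ : ∀ g c → suc (suc (2 * g)) * (suc (2 * g) * c) ≡ suc g * (2 * suc (2 * g) * c)
  rearrange₂ = solve-∀
  absorb : ∀ n k → suc k * (suc n C suc k) ≡ suc n * (n C k)
  absorb n k with k ≤? n
  ... | yes k≤n = begin
    suc k * (suc n C suc k)                     ≡⟨ cong (suc k *_) (nCk+nC[k+1]≡[n+1]C[k+1] n k) ⟨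
    suc k * (n C k + n C suc k)                 ≡⟨ *-distribˡ-+ (suc k) (n C k) (n C suc k) ⟩
    suc k * (n C k) + suc k * (n C suc k)       ≡⟨ cong (suc k * (n C k) +_) ([1+k]*nC[1+k]≡[n∸k]*nCk n k) ⟩
    suc k * (n C k) + (n ∸ k) * (n C k)         ≡⟨ *-distribʳ-+ (n C k) (suc k) (n ∸ k) ⟨
    (suc k + (n ∸ k)) * (n C k)                 ≡⟨ cong (λ z → suc z * (n C k)) (m+[n∸m]≡n k≤n) ⟩
    suc n * (n C k)                             ∎
  ... | no k≰n rewrite k>n⇒nCk≡0 {n} {k} (≰⇒> k≰n) | k>n⇒nCk≡0 {suc n} {suc k} (s≤s (≰⇒> k≰n)) =
    trans (*-zeroʳ (suc k)) (sym (*-zeroʳ (suc n)))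
  symmetry : suc (2 * g) C g ≡ suc (2 * g) C suc g
  symmetry = trans (nCk≡nC[n∸k] (≤-trans (m≤m+n g (g + 0)) (n≤1+n _)))
    (cong (suc (2 * g) C_) (trans (cong (_∸ g) (split g)) (m+n∸n≡m (suc g) g)))
    where
    split : ∀ g → suc (2 * g) ≡ suc g + g
    split = solve-∀

-- This says that the central coefficient is at most 4^g / √(2g + 1), free of square roots. The
-- induction step comes down to (2g + 1)(2g + 3) ≤ 4(g + 1)².
central-bound : ∀ g → central g * central g * suc (2 * g) ≤ 16 ^ g
central-bound zero    = ≤-refl
central-bound (suc g) = *-cancelˡ-≤ (suc g * suc g) (begin
  suc g * suc g * (c′ * c′ * suc (2 * suc g))
    ≡⟨ eq₁ (suc g) c′ (suc (2 * suc g)) ⟩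
  (suc g * c′) * (suc g * c′) * suc (2 * suc g)
    ≡⟨ cong (λ z → z * z * suc (2 * suc g)) (central-suc g) ⟩
  (2 * suc (2 * g) * c) * (2 * suc (2 * g) * c) * suc (2 * suc g)
    ≡⟨ eq₂ g c ⟩
  (c * c * suc (2 * g)) * (4 * (suc (2 * g) * (3 + 2 * g)))
    ≤⟨ *-mono-≤ (central-bound g) (*-monoʳ-≤ 4 (≤-trans (m≤m+n (suc (2 * g) * (3 + 2 * g)) 1) (≤-reflexive (eq₃ g)))) ⟩
  16 ^ g * (4 * (4 * (suc g * suc g)))
    ≡⟨ eq₄ (16 ^ g) g ⟩
  suc g * suc g * (16 * 16 ^ g) ∎)
  where
  open ≤-Reasoning
  c = central g
  c′ = central (suc g)
  eq₁ : ∀ s c t → s * s * (c * c * t) ≡ (s * c) * (s * c) * t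
  eq₁ = solve-∀
  eq₂ : ∀ g c → (2 * suc (2 * g) * c) * (2 * suc (2 * g) * c) * suc (2 * suc g)
              ≡ (c * c * suc (2 * g)) * (4 * (suc (2 * g) * (3 + 2 * g)))
  eq₂ = solve-∀
  eq₃ : ∀ g → suc (2 * g) * (3 + 2 * g) + 1 ≡ 4 * (suc g * suc g)
  eq₃ = solve-∀
  eq₄ : ∀ p g → p * (4 * (4 * (suc g * suc g))) ≡ suc g * suc g * (16 * p)
  eq₄ = solve-∀

hits-suc : ∀ n (f : ℕ → ℕ) → f 0 ≤ 1 → ∀ {r} → ∑ (upTo n) (f ∘ suc) ≤ r → ∑ (upTo (suc n)) f ≤ suc r
hits-suc n f f0≤1 rest = ≤-trans (≤-reflexive (∑-upTo-suc n f)) (+-mono-≤ f0≤1 rest)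

module _ (M : ℕ) .{{_ : NonZero M}} (P : ℕ) where

  private
    hit : ℤ → ℕ
    hit z = ind (ℤ.∣ z ∣ ≤? P * M)

    pt : ℤ → ℕ → ℤ
    pt t j = t ℤ.+ ℤ.+ (2 * M * j)

    shift : ∀ t j → pt t (suc j) ≡ pt (t ℤ.+ ℤ.+ (2 * M)) j
    shift t j = trans (cong (λ z → t ℤ.+ ℤ.+ z) (*-suc (2 * M) j)) (sym (ℤₚ.+-assoc t (ℤ.+ (2 * M)) (ℤ.+ (2 * M * j))))

    ∑-shift : ∀ n t → ∑ (upTo n) (λ j → hit (pt t (suc j))) ≡ ∑ (upTo n) (λ j → hit (pt (t ℤ.+ ℤ.+ (2 * M)) j))
    ∑-shift n t = ∑-cong (upTo n) (λ j → cong hit (shift t j))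

    hit-above : ∀ z → ℤ.+ (P * M) ℤ.< z → hit z ≡ 0
    hit-above (ℤ.+ n) (ℤ.+<+ lt) = ind-no (n ≤? P * M) (<⇒≱ lt)

    hit-below : ∀ z → z ℤ.< ℤ.- (ℤ.+ (P * M)) → hit z ≡ 0
    hit-below z lt = trans (cong (λ n → ind (n ≤? P * M)) (sym (ℤₚ.∣-i∣≡∣i∣ z)))
      (hit-above (ℤ.- z) (subst (ℤ._< ℤ.- z) (ℤₚ.neg-involutive (ℤ.+ (P * M))) (ℤₚ.neg-mono-< lt)))

    ≤-shift : ∀ t → t ℤ.≤ t ℤ.+ ℤ.+ (2 * M)
    ≤-shift t = ℤₚ.i≤i+j t (ℤ.+ (2 * M))

    -- The progression increases: once past the window it never returns, so at most the first `r`
    -- terms can hit it.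
    few : ∀ n r t → ℤ.+ (P * M) ℤ.< t ℤ.+ ℤ.+ (2 * M * r) → ∑ (upTo n) (λ j → hit (pt t j)) ≤ r
    few zero    r t lt = z≤n
    few (suc n) zero t lt = ≤-trans (≤-reflexive (trans (∑-upTo-suc n _)
        (cong₂ _+_ (hit-above (pt t 0) lt) (∑-shift n t))))
      (few n zero (t ℤ.+ ℤ.+ (2 * M)) (ℤₚ.<-≤-trans lt (ℤₚ.+-monoˡ-≤ (ℤ.+ (2 * M * 0)) (≤-shift t))))
    few (suc n) (suc r) t lt = hits-suc n (λ j → hit (pt t j)) (ind≤1 (ℤ.∣ pt t 0 ∣ ≤? P * M))
      (≤-trans (≤-reflexive (∑-shift n t)) (few n r (t ℤ.+ ℤ.+ (2 * M)) (subst (ℤ.+ (P * M) ℤ.<_) (shift t r) lt)))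

  -- Terms below the window are skipped. From the first term that is at least -PM, a total advance
  -- of 2M(P + 1) = PM + (PM + 2M) leads beyond PM.
  progression-hits : ∀ n t → ∑ (upTo n) (λ j → ind (ℤ.∣ t ℤ.+ ℤ.+ (2 * M * j) ∣ ≤? P * M)) ≤ suc P
  progression-hits zero    t = z≤n
  progression-hits (suc n) t with t ℤ.<? ℤ.- (ℤ.+ (P * M))
  ... | yes lt = ≤-trans (≤-reflexive (trans (∑-upTo-suc n _) (cong₂ _+_
          (hit-below (pt t 0) (subst (ℤ._< _) (sym (trans (cong (λ z → t ℤ.+ ℤ.+ z) (*-zeroʳ (2 * M))) (ℤₚ.+-identityʳ t))) lt))
          (∑-shift n t))))
        (progression-hits n (t ℤ.+ ℤ.+ (2 * M)))
  ... | no ¬lt = few (suc n) (suc P) t (ℤₚ.<-≤-trans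
        (ℤ.+<+ (m<m+n (P * M) {2 * M} (≤-trans (>-nonZero⁻¹ M) (m≤m+n M (M + 0)))))
        (subst (ℤ._≤ t ℤ.+ ℤ.+ (2 * M * suc P)) (eq P M)
          (ℤₚ.+-monoˡ-≤ (ℤ.+ (2 * M * suc P)) (ℤₚ.≮⇒≥ ¬lt))))
    where
    eq : ∀ P M → ℤ.- ℤ.+ (P * M) ℤ.+ ℤ.+ (2 * M * suc P) ≡ ℤ.+ (P * M + 2 * M)
    eq P M = trans (cong (λ z → ℤ.- ℤ.+ (P * M) ℤ.+ ℤ.+ z) (split P M)) (cancel (ℤ.+ (P * M)) (ℤ.+ (P * M + 2 * M)))
      where
      split : ∀ P M → 2 * M * suc P ≡ P * M + (P * M + 2 * M)
      split = solve-∀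
      cancel : ∀ a b → ℤ.- a ℤ.+ (a ℤ.+ b) ≡ b
      cancel = ℤ-Ring.solve-∀

  walk-window : ∀ g t → walk (2 * g) (λ j → ind (ℤ.∣ t ℤ.+ ℤ.+ (2 * M * j) ∣ ≤? P * M)) ≤ central g * suc P
  walk-window g t = begin
    walk (2 * g) (λ j → hit (pt t j))                                      ≡⟨ walk-binomial (2 * g) _ ⟩
    ∑ (upTo (suc (2 * g))) (λ j → ((2 * g) C j) * hit (pt t j))            ≤⟨ ∑-mono (upTo (suc (2 * g))) (λ j → *-monoˡ-≤ (hit (pt t j)) (binomial≤central g j)) ⟩
    ∑ (upTo (suc (2 * g))) (λ j → central g * hit (pt t j))                ≡⟨ ∑-*ˡ (upTo (suc (2 * g))) (central g) _ ⟩
    central g * ∑ (upTo (suc (2 * g))) (λ j → hit (pt t j))                ≤⟨ *-monoʳ-≤ (central g) (progression-hits (suc (2 * g)) t) ⟩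
    central g * suc P                                                      ∎
    where open ≤-Reasoning

-- Inner products between the power of the square boundary and the sign cube

module RingGeometry (M : ℕ) where
  open Ring M public

  antiX : ∀ {h} → Vec Point h → Vec Point h → ℕ
  antiX x x′ = CX.dist x (Vec.map negX x′)

  qX-neg : ∀ k k′ → qX k (negX k′) ≡ nsq (px k ℤ.+ px k′) + nsq (py k ℤ.+ py k′)
  qX-neg k k′ rewrite px-neg k′ | py-neg k′ | ℤₚ.neg-involutive (px k′) | ℤₚ.neg-involutive (py k′) = refl

  antiX-sym : ∀ {h} (x x′ : Vec Point h) → antiX x x′ ≡ antiX x′ x
  antiX-sym []      []        = refl
  antiX-sym (k ∷ x) (k′ ∷ x′) = cong₂ _+_ (trans (qX-neg k k′) (trans
    (cong₂ (λ a b → nsq a + nsq b) (ℤₚ.+-comm (px k) (px k′)) (ℤₚ.+-comm (py k) (py k′))) (sym (qX-neg k′ k))))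
    (antiX-sym x x′)

  ∣sgn*M∣ : ∀ σ → ℤ.∣ sgn σ ℤ.* ℤ.+ M ∣ ≡ M
  ∣sgn*M∣ true  = cong ℤ.∣_∣ (ℤₚ.*-identityˡ (ℤ.+ M))
  ∣sgn*M∣ false = trans (cong ℤ.∣_∣ (ℤₚ.-1*i≡-i (ℤ.+ M))) (ℤₚ.∣-i∣≡∣i∣ (ℤ.+ M))

  M²≤ : ∀ k → M * M ≤ nsq (px k) + nsq (py k)
  M²≤ (σ , false , k) = ≤-trans (≤-reflexive (cong (λ n → n * n) (sym (∣sgn*M∣ σ)))) (m≤m+n _ _)
  M²≤ (σ , true , k) = ≤-trans (≤-reflexive (cong (λ n → n * n) (sym (∣sgn*M∣ σ)))) (m≤n+m _ (nsq (px (σ , true , k))))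

  -- Every point of the boundary has norm at least `M`, while by `nsq-triangle` three small pairwise
  -- sums would force the points towards the origin.
  antiX-triangle : ∀ {h} (x y z : Vec Point h) →
    4 * (h * (M * M)) ≤ 3 * (antiX x y + antiX x z + antiX y z)
  antiX-triangle [] [] [] = z≤n
  antiX-triangle {suc h} (i ∷ x) (j ∷ y) (k ∷ z) = begin
    4 * (suc h * (M * M))
      ≡⟨ *-distribˡ-+ 4 (M * M) (h * (M * M)) ⟩
    4 * (M * M) + 4 * (h * (M * M))
      ≤⟨ +-mono-≤ (*-monoʳ-≤ 4 (M²≤ i)) (antiX-triangle x y z) ⟩
    4 * (nsq (px i) + nsq (py i)) + R
      ≡⟨ cong (_+ R) (*-distribˡ-+ 4 (nsq (px i)) (nsq (py i))) ⟩
    4 * nsq (px i) + 4 * nsq (py i) + R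
      ≤⟨ +-monoˡ-≤ R (+-mono-≤ (nsq-triangle (px i) (px j) (px k)) (nsq-triangle (py i) (py j) (py k))) ⟩
    3 * (nsq (px i ℤ.+ px j) + nsq (px i ℤ.+ px k) + nsq (px j ℤ.+ px k))
      + 3 * (nsq (py i ℤ.+ py j) + nsq (py i ℤ.+ py k) + nsq (py j ℤ.+ py k)) + R
      ≡⟨ eq (nsq (px i ℤ.+ px j)) (nsq (px i ℤ.+ px k)) (nsq (px j ℤ.+ px k))
            (nsq (py i ℤ.+ py j)) (nsq (py i ℤ.+ py k)) (nsq (py j ℤ.+ py k)) (antiX x y) (antiX x z) (antiX y z) ⟩
    3 * ((nsq (px i ℤ.+ px j) + nsq (py i ℤ.+ py j) + antiX x y) + (nsq (px i ℤ.+ px k) + nsq (py i ℤ.+ py k) + antiX x z)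
      + (nsq (px j ℤ.+ px k) + nsq (py j ℤ.+ py k) + antiX y z))
      ≡⟨ cong (3 *_) (cong₂ _+_ (cong₂ _+_ (cong (_+ antiX x y) (sym (qX-neg i j))) (cong (_+ antiX x z) (sym (qX-neg i k))))
           (cong (_+ antiX y z) (sym (qX-neg j k)))) ⟩
    3 * (antiX (i ∷ x) (j ∷ y) + antiX (i ∷ x) (k ∷ z) + antiX (j ∷ y) (k ∷ z)) ∎
    where
    open ≤-Reasoning
    R = 3 * (antiX x y + antiX x z + antiX y z)
    eq : ∀ a b c a′ b′ c′ x y z → 3 * (a + b + c) + 3 * (a′ + b′ + c′) + 3 * (x + y + z)
      ≡ 3 * ((a + a′ + x) + (b + b′ + y) + (c + c′ + z))
    eq = solve-∀

  dot : ∀ {h} → Vec Point h → Vec Sign² h → ℤ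
  dot []      []            = ℤ.0ℤ
  dot (k ∷ x) ((a , b) ∷ y) = px k ℤ.* sgn a ℤ.+ py k ℤ.* sgn b ℤ.+ dot x y

  dot-neg : ∀ {h} (x : Vec Point h) y → dot x (Vec.map negY y) ≡ ℤ.- dot x y
  dot-neg []      []            = refl
  dot-neg (k ∷ x) ((a , b) ∷ y) rewrite dot-neg x y | sgn-not a | sgn-not b = eq (px k) (py k) (sgn a) (sgn b) (dot x y)
    where
    eq : ∀ p q a b d → p ℤ.* ℤ.- a ℤ.+ q ℤ.* ℤ.- b ℤ.+ ℤ.- d ≡ ℤ.- (p ℤ.* a ℤ.+ q ℤ.* b ℤ.+ d)
    eq = ℤ-Ring.solve-∀

  dot₄ : ∀ {h} → Vec Point h → Vec Point h → Vec Sign² h → Vec Sign² h → ℤ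
  dot₄ x x′ y y′ = (dot x y ℤ.+ dot x y′) ℤ.+ (dot x′ y ℤ.+ dot x′ y′)

  -- dot₄ is ⟨x + x′ , y + y′⟩, so this is Cauchy–Schwarz in the form 2k⟨u , v⟩ ≤ ∣u∣² + k²∣v∣².
  dot₄-bound : ∀ k {h} (x x′ : Vec Point h) (y y′ : Vec Sign² h) →
    ℤ.+ (2 * k) ℤ.* dot₄ x x′ y y′ ℤ.≤ ℤ.+ (antiX x x′ + k * k * (4 * antiY y y′))
  dot₄-bound k [] [] [] [] rewrite ℤₚ.*-zeroʳ (ℤ.+ (2 * k)) = ℤ.+≤+ z≤n
  dot₄-bound k (i ∷ x) (j ∷ x′) ((a , b) ∷ y) ((c , d) ∷ y′) = begin
    κ ℤ.* dot₄ (i ∷ x) (j ∷ x′) ((a , b) ∷ y) ((c , d) ∷ y′)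
      ≡⟨ expand κ (px i) (py i) (px j) (py j) (sgn a) (sgn b) (sgn c) (sgn d) (dot x y) (dot x y′) (dot x′ y) (dot x′ y′) ⟩
    (κ ℤ.* ((px i ℤ.+ px j) ℤ.* (sgn a ℤ.+ sgn c)) ℤ.+ κ ℤ.* ((py i ℤ.+ py j) ℤ.* (sgn b ℤ.+ sgn d)))
      ℤ.+ κ ℤ.* dot₄ x x′ y y′
      ≤⟨ ℤₚ.+-mono-≤ (ℤₚ.+-mono-≤ (cauchy (px i ℤ.+ px j) a c) (cauchy (py i ℤ.+ py j) b d)) (dot₄-bound k x x′ y y′) ⟩
    ℤ.+ ((nsq (px i ℤ.+ px j) + k * k * (4 * ham a (not c))) + (nsq (py i ℤ.+ py j) + k * k * (4 * ham b (not d)))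
      + (antiX x x′ + k * k * (4 * antiY y y′)))
      ≡⟨ cong ℤ.+_ (trans (eq (nsq (px i ℤ.+ px j)) (nsq (py i ℤ.+ py j)) (k * k) (ham a (not c)) (ham b (not d)) (antiX x x′) (antiY y y′))
           (cong (λ n → (n + antiX x x′) + k * k * (4 * (ham a (not c) + ham b (not d) + antiY y y′))) (sym (qX-neg i j)))) ⟩
    ℤ.+ (antiX (i ∷ x) (j ∷ x′) + k * k * (4 * antiY ((a , b) ∷ y) ((c , d) ∷ y′))) ∎
    where
    open ℤₚ.≤-Reasoning
    κ = ℤ.+ (2 * k)
    expand : ∀ κ p q p′ q′ a b c d e f g h →
      κ ℤ.* (((p ℤ.* a ℤ.+ q ℤ.* b ℤ.+ e) ℤ.+ (p ℤ.* c ℤ.+ q ℤ.* d ℤ.+ f))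
        ℤ.+ ((p′ ℤ.* a ℤ.+ q′ ℤ.* b ℤ.+ g) ℤ.+ (p′ ℤ.* c ℤ.+ q′ ℤ.* d ℤ.+ h)))
      ≡ (κ ℤ.* ((p ℤ.+ p′) ℤ.* (a ℤ.+ c)) ℤ.+ κ ℤ.* ((q ℤ.+ q′) ℤ.* (b ℤ.+ d))) ℤ.+ κ ℤ.* ((e ℤ.+ f) ℤ.+ (g ℤ.+ h))
    expand = ℤ-Ring.solve-∀
    eq : ∀ a b k c d e f → (a + k * (4 * c)) + (b + k * (4 * d)) + (e + k * (4 * f)) ≡ ((a + b) + e) + k * (4 * (c + d + f))
    eq = solve-∀
    bit : ∀ a c → nsq (sgn a ℤ.+ sgn c) ≡ 4 * ham a (not c)
    bit true  true  = refl
    bit true  false = refl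
    bit false true  = refl
    bit false false = refl
    cauchy : ∀ u a c → κ ℤ.* (u ℤ.* (sgn a ℤ.+ sgn c)) ℤ.≤ ℤ.+ (nsq u + k * k * (4 * ham a (not c)))
    cauchy u a c = ≤-from-gap (nsq (u ℤ.- ℤ.+ k ℤ.* v)) (trans
      (trans (cong (λ n → ℤ.+ (nsq u + k * k * n)) (sym (bit a c)))
        (cong₂ ℤ._+_ (∣i∣² u) (trans (ℤₚ.pos-* (k * k) (nsq v)) (cong₂ ℤ._*_ (ℤₚ.pos-* k k) (∣i∣² v)))))
      (trans (identity u (ℤ.+ k) v) (cong₂ ℤ._+_ (cong (ℤ._* (u ℤ.* v)) (sym (ℤₚ.pos-* 2 k))) (sym (∣i∣² (u ℤ.- ℤ.+ k ℤ.* v))))))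
      where
      v = sgn a ℤ.+ sgn c
      identity : ∀ u k v → u ℤ.* u ℤ.+ (k ℤ.* k) ℤ.* (v ℤ.* v)
        ≡ (ℤ.+ 2 ℤ.* k) ℤ.* (u ℤ.* v) ℤ.+ (u ℤ.- k ℤ.* v) ℤ.* (u ℤ.- k ℤ.* v)
      identity = ℤ-Ring.solve-∀

  -- Every ring point has a coordinate ±M; its sign performs a simple random walk with steps ±M.
  ∑-dot-walk : ∀ {h} (x : Vec Point h) (φ : ℤ → ℕ) (c : ℕ) →
    (∀ t → walk h (λ j → φ (t ℤ.+ ℤ.+ (2 * M * j))) ≤ c) →
    ∀ t → ∑ (allVec signs h) (λ y → φ (t ℤ.+ dot x y)) ≤ 2 ^ h * c
  ∑-dot-walk [] φ c bound t = ≤-trans (≤-reflexive (cong (_+ 0) (cong (λ z → φ (t ℤ.+ ℤ.+ z)) (sym (*-zeroʳ (2 * M))))))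
    (+-monoˡ-≤ 0 (bound t))
  ∑-dot-walk {suc h} (k ∷ x) φ c bound t = begin
    ∑ (allVec signs (suc h)) (λ y → φ (t ℤ.+ dot (k ∷ x) y))     ≡⟨ ∑-allVec signs h _ ⟩
    ∑ signs (λ (a , b) → S (px k) (py k) a b)                    ≤⟨ four k ⟩
    2 * (2 ^ h * c)                                              ≡⟨ *-assoc 2 (2 ^ h) c ⟨
    2 * 2 ^ h * c                                                ∎
    where
    open ≤-Reasoning
    Ω = allVec signs h
    S : ℤ → ℤ → Bool → Bool → ℕ
    S p q a b = ∑ Ω (λ v → φ (t ℤ.+ (p ℤ.* sgn a ℤ.+ q ℤ.* sgn b ℤ.+ dot x v)))
    -- Both outcomes of one step ±M at once. Starting the walk lower by `M` turns them into steps 0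
    -- and 2M, which is the form that `walk` counts.
    φ′ : ℤ → ℕ
    φ′ z = φ (z ℤ.- ℤ.+ M) + φ (z ℤ.+ ℤ.+ M)
    bound′ : ∀ t → walk h (λ j → φ′ (t ℤ.+ ℤ.+ (2 * M * j))) ≤ c
    bound′ t = ≤-trans (≤-reflexive (trans (walk-+ h _ _) (cong₂ _+_
        (walk-cong h (λ j → cong φ (eq₁ t (ℤ.+ (2 * M * j)) (ℤ.+ M))))
        (walk-cong h (λ j → cong φ (trans (eq₂ t (ℤ.+ (2 * M * j)) (ℤ.+ M)) (cong (λ z → t ℤ.- ℤ.+ M ℤ.+ ℤ.+ z) (eq₃ M j))))))))
      (bound (t ℤ.- ℤ.+ M))
      where
      eq₁ : ∀ t z M → t ℤ.+ z ℤ.- M ≡ t ℤ.- M ℤ.+ z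
      eq₁ = ℤ-Ring.solve-∀
      eq₂ : ∀ t z M → t ℤ.+ z ℤ.+ M ≡ t ℤ.- M ℤ.+ ((M ℤ.+ M) ℤ.+ z)
      eq₂ = ℤ-Ring.solve-∀
      eq₃ : ∀ M j → (M + M) + 2 * M * j ≡ 2 * M * suc j
      eq₃ = solve-∀
    pair : ∀ r → ∑ Ω (λ v → φ ((r ℤ.+ dot x v) ℤ.- ℤ.+ M)) + ∑ Ω (λ v → φ ((r ℤ.+ dot x v) ℤ.+ ℤ.+ M)) ≤ 2 ^ h * c
    pair r = ≤-trans (≤-reflexive (sym (∑-+ Ω _ _))) (∑-dot-walk x φ′ c bound′ r)
    pair± : ∀ σ w (f g : Vec Sign² h → ℤ) →
      (∀ v → f v ≡ t ℤ.+ (sgn σ ℤ.* ℤ.+ M ℤ.* ℤ.1ℤ ℤ.+ w ℤ.+ dot x v)) →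
      (∀ v → g v ≡ t ℤ.+ (sgn σ ℤ.* ℤ.+ M ℤ.* ℤ.-1ℤ ℤ.+ w ℤ.+ dot x v)) →
      ∑ Ω (φ ∘ f) + ∑ Ω (φ ∘ g) ≤ 2 ^ h * c
    pair± true w f g eqf eqg = ≤-trans (≤-reflexive (trans (+-comm (∑ Ω (φ ∘ f)) (∑ Ω (φ ∘ g))) (cong₂ _+_
        (∑-cong Ω (λ v → cong φ (trans (eqg v) (eq₂ t (ℤ.+ M) w (dot x v)))))
        (∑-cong Ω (λ v → cong φ (trans (eqf v) (eq₁ t (ℤ.+ M) w (dot x v)))))))) (pair (t ℤ.+ w))
      where
      eq₁ : ∀ t M w d → t ℤ.+ (ℤ.1ℤ ℤ.* M ℤ.* ℤ.1ℤ ℤ.+ w ℤ.+ d) ≡ t ℤ.+ w ℤ.+ d ℤ.+ M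
      eq₁ = ℤ-Ring.solve-∀
      eq₂ : ∀ t M w d → t ℤ.+ (ℤ.1ℤ ℤ.* M ℤ.* ℤ.-1ℤ ℤ.+ w ℤ.+ d) ≡ t ℤ.+ w ℤ.+ d ℤ.- M
      eq₂ = ℤ-Ring.solve-∀
    pair± false w f g eqf eqg = ≤-trans (≤-reflexive (cong₂ _+_
        (∑-cong Ω (λ v → cong φ (trans (eqf v) (eq₁ t (ℤ.+ M) w (dot x v)))))
        (∑-cong Ω (λ v → cong φ (trans (eqg v) (eq₂ t (ℤ.+ M) w (dot x v))))))) (pair (t ℤ.+ w))
      where
      eq₁ : ∀ t M w d → t ℤ.+ (ℤ.-1ℤ ℤ.* M ℤ.* ℤ.1ℤ ℤ.+ w ℤ.+ d) ≡ t ℤ.+ w ℤ.+ d ℤ.- M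
      eq₁ = ℤ-Ring.solve-∀
      eq₂ : ∀ t M w d → t ℤ.+ (ℤ.-1ℤ ℤ.* M ℤ.* ℤ.-1ℤ ℤ.+ w ℤ.+ d) ≡ t ℤ.+ w ℤ.+ d ℤ.+ M
      eq₂ = ℤ-Ring.solve-∀
    -- The sign that multiplies the coordinate ±M makes the step. The other sign is constant within
    -- each pair, its effect is absorbed by the starting point, and its two values give the factor
    -- 2.
    four : ∀ k → ∑ signs (λ (a , b) → S (px k) (py k) a b) ≤ 2 * (2 ^ h * c)
    four (σ , false , i) = ≤-trans
      (≤-reflexive (regroup (S (sgn σ ℤ.* ℤ.+ M) Q true false) (S (sgn σ ℤ.* ℤ.+ M) Q true true)
                            (S (sgn σ ℤ.* ℤ.+ M) Q false true) (S (sgn σ ℤ.* ℤ.+ M) Q false false)))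
      (+-mono-≤ (pair± σ (Q ℤ.* ℤ.1ℤ) _ _ (λ _ → refl) (λ _ → refl))
                (+-monoˡ-≤ 0 (pair± σ (Q ℤ.* ℤ.-1ℤ) _ _ (λ _ → refl) (λ _ → refl))))
      where
      Q = sgn σ ℤ.* side₂ false i
      regroup : ∀ a b c d → a + (b + (c + (d + 0))) ≡ (b + c) + ((a + d) + 0)
      regroup = solve-∀
    four (σ , true , i) = ≤-trans
      (≤-reflexive (regroup (S P (sgn σ ℤ.* ℤ.+ M) true false) (S P (sgn σ ℤ.* ℤ.+ M) true true)
                            (S P (sgn σ ℤ.* ℤ.+ M) false true) (S P (sgn σ ℤ.* ℤ.+ M) false false)))
      (+-mono-≤ (pair± σ (P ℤ.* ℤ.1ℤ) _ _ (λ v → swap (P ℤ.* ℤ.1ℤ) (sgn σ ℤ.* ℤ.+ M ℤ.* ℤ.1ℤ) v) (λ v → swap (P ℤ.* ℤ.1ℤ) (sgn σ ℤ.* ℤ.+ M ℤ.* ℤ.-1ℤ) v))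
                (+-monoˡ-≤ 0 (pair± σ (P ℤ.* ℤ.-1ℤ) _ _ (λ v → swap (P ℤ.* ℤ.-1ℤ) (sgn σ ℤ.* ℤ.+ M ℤ.* ℤ.1ℤ) v) (λ v → swap (P ℤ.* ℤ.-1ℤ) (sgn σ ℤ.* ℤ.+ M ℤ.* ℤ.-1ℤ) v))))
      where
      P = sgn σ ℤ.* side₁ true i
      swap : ∀ a b v → t ℤ.+ (a ℤ.+ b ℤ.+ dot x v) ≡ t ℤ.+ (b ℤ.+ a ℤ.+ dot x v)
      swap a b v = cong (λ z → t ℤ.+ (z ℤ.+ dot x v)) (ℤₚ.+-comm a b)
      regroup : ∀ a b c d → a + (b + (c + (d + 0))) ≡ (b + a) + ((c + d) + 0)
      regroup = solve-∀

-- What the colouring needs from the two spaces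

module _ {A : Set} (_≟_ : DecidableEquality A) where

  member? : (x : A) (xs : List A) → Dec (x ∈ xs)
  member? x xs = any? (x ≟_) xs

  sizeIn : List A → List A → ℕ
  sizeIn Ω As = ∑ Ω (λ x → ind (member? x As))

-- `L` will be the number of labels of the colouring, which makes density 1/(2L) the threshold for a
-- large set, and 1/E is the admissible loss of purple density. Nothing else about the two spaces is
-- needed afterwards, so their dimension stays hidden.
record Geometry (L E : ℕ) : Set₁ where
  field
    X Y   : Set
    _≟ˣ_  : DecidableEquality X
    _≟ʸ_  : DecidableEquality Y
    Ωx    : List X
    Ωy    : List Y
    Ωx≥1  : 1 ≤ length Ωx
    Ωy≥1  : 1 ≤ length Ωy
    nearX   : X → X → Set
    nearY   : Y → Y → Set
    closeY  : Y → Y → Set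
    cross   : X → Y → Set
    nearX?  : ∀ x x′ → Dec (nearX x x′)
    nearY?  : ∀ y y′ → Dec (nearY y y′)
    closeY? : ∀ y y′ → Dec (closeY y y′)
    cross?  : ∀ x y → Dec (cross x y)
    nearX-sym  : ∀ {x x′} → nearX x x′ → nearX x′ x
    nearY-sym  : ∀ {y y′} → nearY y y′ → nearY y′ y
    closeY-sym : ∀ {y y′} → closeY y y′ → closeY y′ y
    closeY-refl : ∀ y → closeY y y
    nearX-triangle-free : ∀ {a b c} → nearX a b → nearX a c → nearX b c → ⊥
    nearY-triangle-free : ∀ {a b c} → nearY a b → nearY a c → nearY b c → ⊥
    nearY-nearY⇒closeY  : ∀ {z a b} → nearY z a → nearY z b → closeY a b
    no-K₄ : ∀ {x x′ y y′} → nearX x x′ → nearY y y′ → cross x y → cross x y′ → cross x′ y → cross x′ y′ → ⊥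
    nearX-between : ∀ As Bs → length Ωx ≤ 2 * L * sizeIn _≟ˣ_ Ωx As → length Ωx ≤ 2 * L * sizeIn _≟ˣ_ Ωx Bs →
                    (∀ {a b} → a ∈ As → b ∈ Bs → ¬ nearX a b) → ⊥
    nearY-between : ∀ As Bs → length Ωy ≤ 2 * L * sizeIn _≟ʸ_ Ωy As → length Ωy ≤ 2 * L * sizeIn _≟ʸ_ Ωy Bs →
                    (∀ {a b} → a ∈ As → b ∈ Bs → ¬ nearY a b) → ⊥
    aligned-few : ∀ y → E * ∑ Ωy (λ z → ind (nearY? y z ⊎-dec closeY? y z)) ≤ length Ωy
    cross-half  : ∀ x → E * length Ωy ≤ 2 * E * ∑ Ωy (λ y → ind (cross? x y)) + length Ωy

module Between {A : Set} (_≟_ : DecidableEquality A) (ks : List A) (q : A → A → ℕ) (q-refl : ∀ k → q k k ≡ 0)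
  (τ : A → A) (τ-involutive : ∀ k → τ (τ k) ≡ k) (∑-τ : ∀ f → ∑ ks (f ∘ τ) ≡ ∑ ks f) where
  open Concentration _≟_ ks q q-refl

  map-τ-involutive : ∀ {h} (x : Vec A h) → Vec.map τ (Vec.map τ x) ≡ x
  map-τ-involutive []      = refl
  map-τ-involutive (k ∷ x) = cong₂ _∷_ (τ-involutive k) (map-τ-involutive x)

  size-reflect : ∀ {h} (Bs : List (Vec A h)) → size Bs ≤ size (map (Vec.map τ) Bs)
  size-reflect {h} Bs = ≤-trans (≤-reflexive (sym (∑-allVec-map ks τ ∑-τ h _)))
    (∑-mono (allVec ks h) (λ x → ind-mono (Vec.map τ x ∈? Bs) (x ∈? map (Vec.map τ) Bs)
      (λ x∈ → subst (_∈ map (Vec.map τ) Bs) (map-τ-involutive x) (∈-map⁺ (Vec.map τ) x∈))))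

  -- Reflecting `Bs` turns two sets without near-antipodal pairs into two distant sets of the same
  -- densities, to which concentration applies. Dividing by the number of points leaves an
  -- inequality between `D` and `h` only.
  reflected-concentration : Linked (λ k k′ → Step k k′ × Step k′ k) ks →
    ∀ {h} D L (As Bs : List (Vec A h)) → 1 ≤ length (allVec ks h) →
    length (allVec ks h) ≤ 2 * L * size As → length (allVec ks h) ≤ 2 * L * size Bs →
    (∀ {a b} → a ∈ As → b ∈ Bs → D ≤ dist a (Vec.map τ b)) →
    D * D ≤ 4 * (L * L) * (length ks * length ks) * (16 * D + 4 * h)
  reflected-concentration linked {h} D L As Bs n≥1 As-big Bs-big far = *-cancelˡ-≤ (n * n) {{n²≢0}} (begin
    n * n * (D * D)
      ≤⟨ *-monoˡ-≤ (D * D) (*-mono-≤ (≤-trans Bs-big (*-monoʳ-≤ (2 * L) (size-reflect Bs))) As-big) ⟩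
    (2 * L * size Bs′) * (2 * L * size As) * (D * D)
      ≡⟨ eq₁ L (size Bs′) (size As) (D * D) ⟩
    4 * (L * L) * (size Bs′ * size As * (D * D))
      ≤⟨ *-monoʳ-≤ (4 * (L * L)) (concentration linked D Bs′ As far′) ⟩
    4 * (L * L) * (m * m * (n * (n * (16 * D + 4 * h))))
      ≡⟨ eq₂ (4 * (L * L)) (m * m) n (16 * D + 4 * h) ⟩
    n * n * (4 * (L * L) * (m * m) * (16 * D + 4 * h)) ∎)
    where
    open ≤-Reasoning
    m = length ks
    n = length (allVec ks h)
    n²≢0 : NonZero (n * n)
    n²≢0 = >-nonZero (*-mono-≤ n≥1 n≥1)
    Bs′ = map (Vec.map τ) Bs
    far′ : ∀ {b a} → b ∈ Bs′ → a ∈ As → D ≤ dist a b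
    far′ b∈ a∈ with ∈-map⁻ (Vec.map τ) b∈
    ... | b , b∈Bs , refl = far a∈ b∈Bs
    eq₁ : ∀ L a b c → (2 * L * a) * (2 * L * b) * c ≡ 4 * (L * L) * (a * b * c)
    eq₁ = solve-∀
    eq₂ : ∀ l m n c → l * (m * (n * (n * c))) ≡ n * n * (l * m * c)
    eq₂ = solve-∀

length-allVec≥1 : {A : Set} (ks : List A) → 1 ≤ length ks → ∀ h → 1 ≤ length (allVec ks h)
length-allVec≥1 ks ks≥1 zero    = ≤-refl
length-allVec≥1 ks ks≥1 (suc h) = ≤-trans (*-mono-≤ ks≥1 (length-allVec≥1 ks ks≥1 h)) (≤-reflexive (sym (length-allVec ks h)))

∣i∣≡±i : ∀ i → ℤ.+ ℤ.∣ i ∣ ≡ i ⊎ ℤ.+ ℤ.∣ i ∣ ≡ ℤ.- i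
∣i∣≡±i (ℤ.+ n)      = inj₁ refl
∣i∣≡±i (ℤ.-[1+ n ]) = inj₂ refl

square-cancel-≤ : ∀ a b → a * a ≤ b * b → a ≤ b
square-cancel-≤ a b a²≤b² with a ≤? b
... | yes a≤b = a≤b
... | no a≰b  = ⊥-elim (<⇒≱ (*-mono-< (≰⇒> a≰b) (≰⇒> a≰b)) a²≤b²)

-- Choice of dimension and thresholds

module Construction (L E κ : ℕ) (L≥1 : 1 ≤ L) (E≥1 : 1 ≤ E) (κ≡ : κ ≡ 5120 * (L * L)) where

  -- Concentration reaches `Dx` of order h in the ring power, whose base has 8M points, and `Dy` of
  -- order √h in the cube. Cauchy-Schwarz then asks for μ of order √(Dx · Dy) = κKM, whereas the
  -- walk has spread of order M√h, that is K²M, up to constants. The ratio κ/K is made small by K =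
  -- 2κE. Taking M = K², T = M² makes the roots integral, and h is even for the sake of central
  -- binomial coefficients.
  K M T h Dx Dy μ : ℕ
  K = 2 * (κ * E)
  M = K * K
  T = M * M
  h = 2 * T
  Dx = κ * T
  Dy = κ * M
  μ = κ * K * M

  κ≥5120 : 5120 ≤ κ
  κ≥5120 = subst (5120 ≤_) (sym κ≡) (*-monoʳ-≤ 5120 (*-mono-≤ L≥1 L≥1))

  κ≥1 : 1 ≤ κ
  κ≥1 = ≤-trans (s≤s z≤n) κ≥5120

  2κ≤K : 2 * κ ≤ K
  2κ≤K = *-monoʳ-≤ 2 (≤-trans (≤-reflexive (sym (*-identityʳ κ))) (*-monoʳ-≤ κ E≥1))

  K≥1 : 1 ≤ K
  K≥1 = ≤-trans (≤-trans κ≥1 (m≤m+n κ (κ + 0))) 2κ≤K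

  M≥1 : 1 ≤ M
  M≥1 = *-mono-≤ K≥1 K≥1

  T≥1 : 1 ≤ T
  T≥1 = *-mono-≤ M≥1 M≥1

  K≤M : K ≤ M
  K≤M = ≤-trans (≤-reflexive (sym (*-identityʳ K))) (*-monoʳ-≤ K K≥1)

  M≤T : M ≤ T
  M≤T = ≤-trans (≤-reflexive (sym (*-identityʳ M))) (*-monoʳ-≤ M M≥1)

  2κ≤M : 2 * κ ≤ M
  2κ≤M = ≤-trans 2κ≤K K≤M

  instance
    M≢0 : NonZero M
    M≢0 = >-nonZero M≥1

  open RingGeometry M

  -- The origin of 5120 = 4096 + 1024: the term in κ has the factor 4 · 64 · 16 = 4096, and the
  -- remaining 1024κ absorbs 2048 because κ > 2. The same inequality refutes concentration in X,
  -- with S = T, and in Y, with S = M.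
  small-energy : ∀ S → 1 ≤ S → 4 * (L * L) * (64 * S) * (16 * (κ * S) + 4 * (2 * S)) < (κ * S) * (κ * S)
  small-energy S S≥1 = begin-strict
    4 * (L * L) * (64 * S) * (16 * (κ * S) + 4 * (2 * S))
      ≡⟨ eq₁ (L * L) S κ ⟩
    (4096 * (L * L) * κ + 2048 * (L * L)) * (S * S)
      <⟨ *-monoˡ-< (S * S) {{>-nonZero (*-mono-≤ S≥1 S≥1)}} (+-monoʳ-< (4096 * (L * L) * κ) 2048<) ⟩
    (4096 * (L * L) * κ + 1024 * (L * L) * κ) * (S * S)
      ≡⟨ eq₂ (L * L) S κ ⟩
    (5120 * (L * L) * S) * (κ * S)
      ≡⟨ cong (λ z → z * S * (κ * S)) κ≡ ⟨
    (κ * S) * (κ * S) ∎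
    where
    open ≤-Reasoning
    eq₁ : ∀ l S κ → 4 * l * (64 * S) * (16 * (κ * S) + 4 * (2 * S)) ≡ (4096 * l * κ + 2048 * l) * (S * S)
    eq₁ = solve-∀
    eq₂ : ∀ l S κ → (4096 * l * κ + 1024 * l * κ) * (S * S) ≡ (5120 * l * S) * (κ * S)
    eq₂ = solve-∀
    2048< : 2048 * (L * L) < 1024 * (L * L) * κ
    2048< = ≤-trans (≤-trans (≤-reflexive (+-comm 1 (2048 * (L * L)))) (≤-trans (+-monoʳ-≤ (2048 * (L * L)) (*-mono-≤ {1} {1024} (s≤s z≤n) (*-mono-≤ L≥1 L≥1)))
      (≤-reflexive (eq (L * L))))) (*-monoʳ-≤ (1024 * (L * L)) (≤-trans (s≤s (s≤s (s≤s z≤n))) κ≥5120))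
      where
      eq : ∀ l → 2048 * l + 1024 * l ≡ 1024 * l * 3
      eq = solve-∀

  ring≥1 : 1 ≤ length ring
  ring≥1 = ≤-trans (*-mono-≤ {1} {8} (s≤s z≤n) M≥1) (≤-reflexive (sym length-ring))

  module BX = Between _≟ᵖ_ ring qX (λ k → cong₂ _+_ (sqd-refl (px k)) (sqd-refl (py k))) negX
    (λ (σ , s , k) → cong (λ z → z , s , k) (not-involutive σ)) ∑-negX

  module BY = Between (×-≡-dec _≟ᵇ_ _≟ᵇ_) signs qY qY-refl negY
    (λ (a , b) → cong₂ _,_ (not-involutive a) (not-involutive b)) ∑-negY

  between-X : ∀ As Bs → length (allVec ring h) ≤ 2 * L * CX.size As → length (allVec ring h) ≤ 2 * L * CX.size Bs →
    (∀ {a b} → a ∈ As → b ∈ Bs → ¬ (antiX {h} a b < Dx)) → ⊥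
  between-X As Bs As-big Bs-big far = <⇒≱ (small-energy T T≥1) (begin
    (κ * T) * (κ * T)
      ≤⟨ BX.reflected-concentration ring-linked Dx L As Bs (length-allVec≥1 ring ring≥1 h) As-big Bs-big (λ a∈ b∈ → ≮⇒≥ (far a∈ b∈)) ⟩
    4 * (L * L) * (length ring * length ring) * (16 * Dx + 4 * h)
      ≡⟨ cong (λ m → 4 * (L * L) * m * (16 * Dx + 4 * h)) (trans (cong₂ _*_ length-ring length-ring) (eq M)) ⟩
    4 * (L * L) * (64 * T) * (16 * (κ * T) + 4 * (2 * T)) ∎)
    where
    open ≤-Reasoning
    eq : ∀ M → (8 * M) * (8 * M) ≡ 64 * (M * M)
    eq = solve-∀

  between-Y : ∀ As Bs → length (allVec signs h) ≤ 2 * L * CY.size As → length (allVec signs h) ≤ 2 * L * CY.size Bs →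
    (∀ {a b} → a ∈ As → b ∈ Bs → ¬ (antiY {h} a b < Dy)) → ⊥
  between-Y As Bs As-big Bs-big far = <⇒≱ (small-energy M M≥1) (begin
    (κ * M) * (κ * M)
      ≤⟨ BY.reflected-concentration signs-linked Dy L As Bs (length-allVec≥1 signs (s≤s z≤n) h) As-big Bs-big (λ a∈ b∈ → ≮⇒≥ (far a∈ b∈)) ⟩
    4 * (L * L) * 16 * (16 * (κ * M) + 4 * (2 * T))
      -- The term in κ is enlarged by a factor `M` merely to bring the estimate into the shape of
      -- `small-energy` at S = M.
      ≤⟨ *-monoʳ-≤ (4 * (L * L) * 16) (+-monoˡ-≤ (4 * (2 * T)) (≤-trans (≤-reflexive (sym (*-identityʳ (16 * (κ * M))))) (*-monoʳ-≤ (16 * (κ * M)) M≥1))) ⟩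
    4 * (L * L) * 16 * (16 * (κ * M) * M + 4 * (2 * T))
      ≡⟨ eq (L * L) κ M ⟩
    4 * (L * L) * (16 * M) * (16 * (κ * M) + 4 * (2 * M))
      ≤⟨ *-monoˡ-≤ (16 * (κ * M) + 4 * (2 * M)) (*-monoʳ-≤ (4 * (L * L)) (*-monoˡ-≤ M {16} {64} (m≤m+n 16 48))) ⟩
    4 * (L * L) * (64 * M) * (16 * (κ * M) + 4 * (2 * M)) ∎)
    where
    open ≤-Reasoning
    eq : ∀ l κ M → 4 * l * 16 * (16 * (κ * M) * M + 4 * (2 * (M * M))) ≡ 4 * l * (16 * M) * (16 * (κ * M) + 4 * (2 * M))
    eq = solve-∀

  three-< : ∀ {a b c D} → a < D → b < D → c < D → a + b + c < 3 * D
  three-< {a} {b} {c} {D} a< b< c< = ≤-trans (+-mono-<-≤ (+-mono-< a< b<) (<⇒≤ c<)) (≤-reflexive (eq D))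
    where
    eq : ∀ D → D + D + D ≡ 3 * D
    eq = solve-∀

  X-triangle-free : ∀ {a b c : Vec Point h} → antiX a b < Dx → antiX a c < Dx → antiX b c < Dx → ⊥
  X-triangle-free {a} {b} {c} ab ac bc = <⇒≱ (begin-strict
    3 * (antiX a b + antiX a c + antiX b c)     <⟨ *-monoʳ-< 3 (three-< ab ac bc) ⟩
    3 * (3 * (κ * T))                           ≤⟨ m≤m+n _ (7 * (κ * T)) ⟩
    3 * (3 * (κ * T)) + 7 * (κ * T)             ≡⟨ eq₁ κ T ⟩
    8 * (2 * κ * T)                             ≤⟨ *-monoʳ-≤ 8 (*-monoˡ-≤ T (≤-trans 2κ≤M M≤T)) ⟩
    8 * (T * T)                                 ≡⟨ eq₂ T (M * M) ⟩
    4 * (h * (M * M))                           ∎) (antiX-triangle a b c)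
    where
    open ≤-Reasoning
    eq₁ : ∀ κ T → 3 * (3 * (κ * T)) + 7 * (κ * T) ≡ 8 * (2 * κ * T)
    eq₁ = solve-∀
    eq₂ : ∀ T M → 8 * (T * M) ≡ 4 * (2 * T * M)
    eq₂ = solve-∀

  Y-triangle-free : ∀ {a b c : Vec Sign² h} → antiY a b < Dy → antiY a c < Dy → antiY b c < Dy → ⊥
  Y-triangle-free {a} {b} {c} ab ac bc = <⇒≱ (begin-strict
    antiY a b + antiY a c + antiY b c           <⟨ three-< ab ac bc ⟩
    3 * (κ * M)                                 ≤⟨ m≤m+n _ (5 * (κ * M)) ⟩
    3 * (κ * M) + 5 * (κ * M)                   ≡⟨ eq₁ κ M ⟩
    2 * (2 * (2 * κ * M))                       ≤⟨ *-monoʳ-≤ 2 (*-monoʳ-≤ 2 (*-monoˡ-≤ M 2κ≤M)) ⟩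
    2 * h                                       ∎) (antiY-triangle a b c)
    where
    open ≤-Reasoning
    eq₁ : ∀ κ M → 3 * (κ * M) + 5 * (κ * M) ≡ 2 * (2 * (2 * κ * M))
    eq₁ = solve-∀

  K₄-free : ∀ {x x′ : Vec Point h} {y y′ : Vec Sign² h} → antiX x x′ < Dx → antiY y y′ < Dy →
    ℤ.+ μ ℤ.< dot x y → ℤ.+ μ ℤ.< dot x y′ → ℤ.+ μ ℤ.< dot x′ y → ℤ.+ μ ℤ.< dot x′ y′ → ⊥
  K₄-free {x} {x′} {y} {y′} xx yy a b c d = <⇒≱ upper (ℤₚ.drop‿+≤+ (ℤₚ.≤-trans lower (dot₄-bound K x x′ y y′)))
    where
    four-μ : ℤ.+ (4 * μ) ℤ.≤ dot₄ x x′ y y′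
    four-μ = subst (ℤ._≤ dot₄ x x′ y y′) (cong ℤ.+_ (eq μ))
      (ℤₚ.+-mono-≤ (ℤₚ.+-mono-≤ (ℤₚ.<⇒≤ a) (ℤₚ.<⇒≤ b)) (ℤₚ.+-mono-≤ (ℤₚ.<⇒≤ c) (ℤₚ.<⇒≤ d)))
      where
      eq : ∀ μ → (μ + μ) + (μ + μ) ≡ 4 * μ
      eq = solve-∀
    lower : ℤ.+ (2 * K * (4 * μ)) ℤ.≤ ℤ.+ (2 * K) ℤ.* dot₄ x x′ y y′
    lower = subst (ℤ._≤ ℤ.+ (2 * K) ℤ.* dot₄ x x′ y y′) (sym (ℤₚ.pos-* (2 * K) (4 * μ)))
      (ℤₚ.*-monoˡ-≤-nonNeg (ℤ.+ (2 * K)) four-μ)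
    -- Weighting by K, with K² = M, turns both squared norms into multiples of κT: 1 + 4 of them on
    -- the left against 8 on the right.
    upper : antiX x x′ + K * K * (4 * antiY y y′) < 2 * K * (4 * μ)
    upper = begin-strict
      antiX x x′ + M * (4 * antiY y y′)   <⟨ +-mono-<-≤ xx (*-monoʳ-≤ M (*-monoʳ-≤ 4 (<⇒≤ yy))) ⟩
      κ * T + M * (4 * (κ * M))           ≤⟨ m≤m+n _ (3 * (κ * T)) ⟩
      κ * T + M * (4 * (κ * M)) + 3 * (κ * T) ≡⟨ eq κ K ⟩
      2 * K * (4 * μ)                     ∎
      where
      open ≤-Reasoning
      eq : ∀ κ K → κ * (K * K * (K * K)) + K * K * (4 * (κ * (K * K))) + 3 * (κ * (K * K * (K * K)))
                 ≡ 2 * K * (4 * (κ * K * (K * K)))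
      eq = solve-∀

  E≤T : E ≤ T
  E≤T = ≤-trans (≤-trans (≤-trans (≤-reflexive (sym (*-identityˡ E))) (*-monoˡ-≤ E κ≥1)) (m≤m+n (κ * E) (κ * E + 0))) (≤-trans K≤M M≤T)

  few-aligned : ∀ (y : Vec Sign² h) → E * ∑ (allVec signs h)
    (λ z → ind ((antiY y z <? Dy) ⊎-dec (CY.dist y z <? 2 * Dy))) ≤ length (allVec signs h)
  few-aligned y = ≤-trans (*-monoˡ-≤ S E≤T) (*-cancelˡ-≤ (4 * T) {{>-nonZero (*-mono-≤ {1} {4} (s≤s z≤n) T≥1)}} (begin
    4 * T * (T * S)             ≡⟨ eq₁ T S ⟩
    h * h * S                   ≤⟨ aligned-rare Dy 4Dy≤h y _ (λ z → ind≤1 (bad? z)) (λ z → ind⇒ (bad? z)) ⟩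
    2 * h * 4 ^ h               ≡⟨ cong₂ _*_ (eq₂ T) (sym (length-signs^ h)) ⟩
    4 * T * length (allVec signs h) ∎))
    where
    open ≤-Reasoning
    bad? : ∀ z → Dec (antiY y z < Dy ⊎ CY.dist y z < 2 * Dy)
    bad? z = (antiY y z <? Dy) ⊎-dec (CY.dist y z <? 2 * Dy)
    S = ∑ (allVec signs h) (λ z → ind (bad? z))
    eq₁ : ∀ T S → 4 * T * (T * S) ≡ 2 * T * (2 * T) * S
    eq₁ = solve-∀
    eq₂ : ∀ T → 2 * (2 * T) ≡ 4 * T
    eq₂ = solve-∀
    4Dy≤h : 4 * (κ * M) ≤ 2 * (M * M)
    4Dy≤h = ≤-trans (≤-reflexive (eq κ M)) (*-monoʳ-≤ 2 (*-monoˡ-≤ M 2κ≤M))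
      where
      eq : ∀ κ M → 4 * (κ * M) ≡ 2 * (2 * κ * M)
      eq = solve-∀

  -- A single value of the walk has proportion at most 1/M: the central coefficient is at most 4^T /
  -- √T, where 4^T = 2^h and √T = M.
  central-small : central T * M ≤ 2 ^ h
  central-small = square-cancel-≤ (central T * M) (2 ^ h) (begin
    (central T * M) * (central T * M)       ≡⟨ eq (central T) M ⟩
    central T * central T * T               ≤⟨ *-monoʳ-≤ (central T * central T) (≤-trans (m≤m+n T (T + 0)) (n≤1+n (2 * T))) ⟩
    central T * central T * suc (2 * T)     ≤⟨ central-bound T ⟩
    16 ^ T                                  ≡⟨ trans (^-*-assoc 2 4 T) (trans (cong (2 ^_) (4T T)) (^-distribˡ-+-* 2 (2 * T) (2 * T))) ⟩
    2 ^ h * 2 ^ h                           ∎)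
    where
    open ≤-Reasoning
    eq : ∀ c M → (c * M) * (c * M) ≡ c * c * (M * M)
    eq = solve-∀
    4T : ∀ T → 4 * T ≡ 2 * T + 2 * T
    4T = solve-∀

  -- The window |⟨x , y⟩| ≤ μ = (κK)M meets at most κK + 1 values of the walk, each of proportion at
  -- most 1/M, and E(κK + 1) ≤ 2κE · K = M.
  window-small : ∀ (x : Vec Point h) → E * ∑ (allVec signs h) (λ y → ind (ℤ.∣ dot x y ∣ ≤? μ)) ≤ length (allVec signs h)
  window-small x = *-cancelˡ-≤ M (begin
    M * (E * S)                                     ≤⟨ *-monoʳ-≤ M (*-monoʳ-≤ E S≤) ⟩
    M * (E * (2 ^ h * (central T * suc (κ * K))))   ≡⟨ eq₁ M E (2 ^ h) (central T) (suc (κ * K)) ⟩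
    (2 ^ h * (central T * M)) * (E * suc (κ * K))   ≤⟨ *-mono-≤ (*-monoʳ-≤ (2 ^ h) central-small) E[1+κK]≤M ⟩
    (2 ^ h * 2 ^ h) * M                             ≡⟨ *-comm _ M ⟩
    M * (2 ^ h * 2 ^ h)                             ≡⟨ cong (M *_) (trans (sym (^-distribˡ-+-* 2 h h)) (trans (cong (λ z → 2 ^ (h + z)) (sym (+-identityʳ h))) (trans (sym (^-*-assoc 2 2 h)) (sym (length-signs^ h))))) ⟩
    M * length (allVec signs h)                     ∎)
    where
    open ≤-Reasoning
    S = ∑ (allVec signs h) (λ y → ind (ℤ.∣ dot x y ∣ ≤? μ))
    S≤ : S ≤ 2 ^ h * (central T * suc (κ * K))
    S≤ = ≤-trans (≤-reflexive (∑-cong (allVec signs h) (λ y → cong (λ z → ind (ℤ.∣ z ∣ ≤? μ)) (sym (ℤₚ.+-identityˡ (dot x y))))))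
      (∑-dot-walk x (λ z → ind (ℤ.∣ z ∣ ≤? μ)) (central T * suc (κ * K)) (walk-window M (κ * K) T) ℤ.0ℤ)
    eq₁ : ∀ M E p c s → M * (E * (p * (c * s))) ≡ (p * (c * M)) * (E * s)
    eq₁ = solve-∀
    E[1+κK]≤M : E * suc (κ * K) ≤ K * K
    E[1+κK]≤M = ≤-trans (*-monoʳ-≤ E (≤-trans (+-monoˡ-≤ (κ * K) (*-mono-≤ κ≥1 K≥1)) (≤-reflexive refl)))
      (≤-reflexive (eq E κ K))
      where
      eq : ∀ E κ K → E * (κ * K + κ * K) ≡ 2 * (κ * E) * K
      eq = solve-∀

  -- The bijection y ↦ -y exchanges ⟨x , y⟩ > μ with ⟨x , y⟩ < -μ; what neither covers is the
  -- window.
  half-cross : ∀ (x : Vec Point h) → E * length (allVec signs h)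
    ≤ 2 * E * ∑ (allVec signs h) (λ y → ind (ℤ.+ μ ℤ.<? dot x y)) + length (allVec signs h)
  half-cross x = begin
    E * length Ω                                   ≤⟨ *-monoʳ-≤ E n≤ ⟩
    E * (∑ Ω c + ∑ Ω c + ∑ Ω w)                    ≡⟨ eq E (∑ Ω c) (∑ Ω w) ⟩
    2 * E * ∑ Ω c + E * ∑ Ω w                      ≤⟨ +-monoʳ-≤ (2 * E * ∑ Ω c) (window-small x) ⟩
    2 * E * ∑ Ω c + length Ω                       ∎
    where
    open ≤-Reasoning
    Ω = allVec signs h
    c w : Vec Sign² h → ℕ
    c y = ind (ℤ.+ μ ℤ.<? dot x y)
    w y = ind (ℤ.∣ dot x y ∣ ≤? μ)
    eq : ∀ E c w → E * (c + c + w) ≡ 2 * E * c + E * w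
    eq = solve-∀
    one : ∀ d → 1 ≤ ind (ℤ.+ μ ℤ.<? d) + ind (ℤ.+ μ ℤ.<? ℤ.- d) + ind (ℤ.∣ d ∣ ≤? μ)
    one d = trichotomy (ℤ.∣ d ∣ ≤? μ) (∣i∣≡±i d)
      where
      trichotomy : Dec (ℤ.∣ d ∣ ≤ μ) → ℤ.+ ℤ.∣ d ∣ ≡ d ⊎ ℤ.+ ℤ.∣ d ∣ ≡ ℤ.- d →
        1 ≤ ind (ℤ.+ μ ℤ.<? d) + ind (ℤ.+ μ ℤ.<? ℤ.- d) + ind (ℤ.∣ d ∣ ≤? μ)
      trichotomy (yes d≤) _ = ≤-trans (≤-reflexive (sym (ind-yes (ℤ.∣ d ∣ ≤? μ) d≤))) (m≤n+m _ _)
      trichotomy (no d≰) (inj₁ eq) = ≤-trans (≤-reflexive (sym (ind-yes (ℤ.+ μ ℤ.<? d)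
        (subst (ℤ.+ μ ℤ.<_) eq (ℤ.+<+ (≰⇒> d≰)))))) (≤-trans (m≤m+n _ _) (m≤m+n _ _))
      trichotomy (no d≰) (inj₂ eq) = ≤-trans (≤-reflexive (sym (ind-yes (ℤ.+ μ ℤ.<? ℤ.- d)
        (subst (ℤ.+ μ ℤ.<_) eq (ℤ.+<+ (≰⇒> d≰)))))) (≤-trans (m≤n+m _ (ind (ℤ.+ μ ℤ.<? d))) (m≤m+n _ _))
    n≤ : length Ω ≤ ∑ Ω c + ∑ Ω c + ∑ Ω w
    n≤ = begin
      length Ω                                                  ≡⟨ length-∑ Ω ⟩
      ∑ Ω (λ _ → 1)                                             ≤⟨ ∑-mono Ω (λ y → subst (λ z → 1 ≤ c y + ind (ℤ.+ μ ℤ.<? z) + w y) (sym (dot-neg x y)) (one (dot x y))) ⟩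
      ∑ Ω (λ y → c y + c (Vec.map negY y) + w y)                ≡⟨ trans (∑-+ Ω _ w) (cong (_+ ∑ Ω w) (∑-+ Ω c (c ∘ Vec.map negY))) ⟩
      ∑ Ω c + ∑ Ω (c ∘ Vec.map negY) + ∑ Ω w                    ≡⟨ cong (λ z → ∑ Ω c + z + ∑ Ω w) (∑-allVec-map signs negY ∑-negY h c) ⟩
      ∑ Ω c + ∑ Ω c + ∑ Ω w                                     ∎

  geometry : Geometry L E
  geometry = record
    { X = Vec Point h ; Y = Vec Sign² h
    ; _≟ˣ_ = ≡-dec _≟ᵖ_ ; _≟ʸ_ = ≡-dec (×-≡-dec _≟ᵇ_ _≟ᵇ_)
    ; Ωx = allVec ring h ; Ωy = allVec signs h
    ; Ωx≥1 = length-allVec≥1 ring ring≥1 h ; Ωy≥1 = length-allVec≥1 signs (s≤s z≤n) h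
    ; nearX = λ x x′ → antiX x x′ < Dx
    ; nearY = λ y y′ → antiY y y′ < Dy
    ; closeY = λ y y′ → CY.dist y y′ < 2 * Dy
    ; cross = λ x y → ℤ.+ μ ℤ.< dot x y
    ; nearX? = λ x x′ → antiX x x′ <? Dx
    ; nearY? = λ y y′ → antiY y y′ <? Dy
    ; closeY? = λ y y′ → CY.dist y y′ <? 2 * Dy
    ; cross? = λ x y → ℤ.+ μ ℤ.<? dot x y
    ; nearX-sym = λ {x} {x′} → subst (_< Dx) (antiX-sym x x′)
    ; nearY-sym = λ {y} {y′} → subst (_< Dy) (antiY-sym y y′)
    ; closeY-sym = λ {y} {y′} → subst (_< 2 * Dy) (distY-sym y y′)
    ; closeY-refl = λ y → subst (_< 2 * Dy) (sym (CY.dist-refl y)) (*-mono-≤ {1} {2} (s≤s z≤n) (*-mono-≤ κ≥1 M≥1))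
    ; nearX-triangle-free = λ {a} {b} {c} → X-triangle-free {a} {b} {c}
    ; nearY-triangle-free = λ {a} {b} {c} → Y-triangle-free {a} {b} {c}
    ; nearY-nearY⇒closeY = λ {z} {a} {b} za zb → ≤-<-trans (distY≤antiY+antiY z a b)
        (≤-trans (+-mono-<-≤ za (<⇒≤ zb)) (≤-reflexive (cong (Dy +_) (sym (+-identityʳ Dy)))))
    ; no-K₄ = λ {x} {x′} {y} {y′} → K₄-free {x} {x′} {y} {y′}
    ; nearX-between = between-X
    ; nearY-between = between-Y
    ; aligned-few = few-aligned
    ; cross-half = half-cross
    }

geometry-exists : ∀ L E → 1 ≤ L → 1 ≤ E → Geometry L E
geometry-exists L E L≥1 E≥1 = Construction.geometry L E (5120 * (L * L)) L≥1 E≥1 refl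

-- Circles

∑-∈ : {xs : List A} (f : A → ℕ) {x : A} → x ∈ xs → f x ≤ ∑ xs f
∑-∈ f (here refl) = m≤m+n _ _
∑-∈ {xs = y ∷ _} f (there x∈) = ≤-trans (∑-∈ f x∈) (m≤n+m _ (f y))

∑-positive : (xs : List A) (f : A → ℕ) → 1 ≤ ∑ xs f → ∃ λ x → x ∈ xs × 1 ≤ f x
∑-positive (x ∷ xs) f pos with 1 ≤? f x
... | yes fx≥1 = x , here refl , fx≥1
... | no fx≱1 with ∑-positive xs f (subst (λ z → 1 ≤ z + ∑ xs f) (n<1⇒n≡0 (≰⇒> fx≱1)) pos)
...   | y , y∈ , fy≥1 = y , there y∈ , fy≥1

∑-zero : (xs : List A) (f : A → ℕ) → (∀ {x} → x ∈ xs → f x ≡ 0) → ∑ xs f ≡ 0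
∑-zero []       f f≡0 = refl
∑-zero (x ∷ xs) f f≡0 = cong₂ _+_ (f≡0 (here refl)) (∑-zero xs f (f≡0 ∘ there))

∑-exclusive : {xs : List A} → Unique xs → (f : A → ℕ) (b : ℕ) → (∀ x → f x ≤ b) →
  (∀ {x y} → 1 ≤ f x → 1 ≤ f y → x ≡ y) → ∑ xs f ≤ b
∑-exclusive {xs = []} [] f b f≤b excl = z≤n
∑-exclusive {xs = x ∷ xs} (x∉ ∷ uniq) f b f≤b excl with 1 ≤? f x
... | yes fx≥1 = ≤-trans (≤-reflexive (trans (cong (f x +_) (∑-zero xs f others)) (+-identityʳ (f x)))) (f≤b x)
  where
  others : ∀ {y} → y ∈ xs → f y ≡ 0
  others {y} y∈ with 1 ≤? f y
  ... | yes fy≥1 = ⊥-elim (All.lookup x∉ y∈ (excl fx≥1 fy≥1))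
  ... | no fy≱1  = n<1⇒n≡0 (≰⇒> fy≱1)
... | no fx≱1 = subst (λ z → z + ∑ xs f ≤ b) (sym (n<1⇒n≡0 (≰⇒> fx≱1))) (∑-exclusive uniq f b f≤b excl)

∑-ind-≟ : ∀ {k} (i : Fin k) → ∑ (allFin k) (λ j → ind (i Fin.≟ j)) ≡ 1
∑-ind-≟ {k} i = ≤-antisym
  (∑-exclusive (allFin⁺ k) (λ j → ind (i Fin.≟ j)) 1 (λ j → ind≤1 (i Fin.≟ j)) (λ {x} {y} px py → trans (sym (ind⇒ (i Fin.≟ x) px)) (ind⇒ (i Fin.≟ y) py)))
  (≤-trans (≤-reflexive (sym (ind-yes (i Fin.≟ i) refl))) (∑-∈ (λ j → ind (i Fin.≟ j)) (∈-allFin i)))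

∑-replicate : ∀ n (x : A) (f : A → ℕ) → ∑ (replicate n x) f ≡ n * f x
∑-replicate zero    x f = refl
∑-replicate (suc n) x f = cong (f x +_) (∑-replicate n x f)

length-filter-∑ : {P : A → Set} (P? : ∀ x → Dec (P x)) (xs : List A) → length (filter P? xs) ≡ ∑ xs (λ x → ind (P? x))
length-filter-∑ P? []       = refl
length-filter-∑ P? (x ∷ xs) with P? x
... | yes _ = cong suc (length-filter-∑ P? xs)
... | no _  = length-filter-∑ P? xs

m≤n≤o⇒∣m-n∣+∣n-o∣≡∣m-o∣ : ∀ {m n o} → m ≤ n → n ≤ o → ∣ m - n ∣ + ∣ n - o ∣ ≡ ∣ m - o ∣
m≤n≤o⇒∣m-n∣+∣n-o∣≡∣m-o∣ {m} m≤n n≤o with m≤n⇒∃[o]m+o≡n m≤n | m≤n⇒∃[o]m+o≡n n≤o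
... | a , refl | b , refl = trans (cong₂ _+_ (∣m-m+n∣≡n m a) (∣m-m+n∣≡n (m + a) b))
  (sym (trans (cong (λ z → ∣ m - z ∣) (+-assoc m a b)) (∣m-m+n∣≡n m (a + b))))

∣-∣-collinear : ∀ a b c → (∣ a - b ∣ + ∣ b - c ∣ ≡ ∣ a - c ∣) ⊎ (∣ a - c ∣ + ∣ b - c ∣ ≡ ∣ a - b ∣) ⊎ (∣ a - c ∣ + ∣ a - b ∣ ≡ ∣ b - c ∣)
∣-∣-collinear a b c with ≤-total a b | ≤-total b c | ≤-total a c
... | inj₁ a≤b | inj₁ b≤c | _        = inj₁ (m≤n≤o⇒∣m-n∣+∣n-o∣≡∣m-o∣ a≤b b≤c)
... | inj₁ a≤b | inj₂ c≤b | inj₁ a≤c = inj₂ (inj₁ (trans (cong (∣ a - c ∣ +_) (∣-∣-comm b c)) (m≤n≤o⇒∣m-n∣+∣n-o∣≡∣m-o∣ a≤c c≤b)))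
... | inj₁ a≤b | inj₂ c≤b | inj₂ c≤a = inj₂ (inj₂ (trans (cong (_+ ∣ a - b ∣) (∣-∣-comm a c)) (trans (m≤n≤o⇒∣m-n∣+∣n-o∣≡∣m-o∣ c≤a a≤b) (∣-∣-comm c b))))
... | inj₂ b≤a | inj₁ b≤c | inj₁ a≤c = inj₂ (inj₂ (trans (+-comm ∣ a - c ∣ ∣ a - b ∣) (trans (cong (_+ ∣ a - c ∣) (∣-∣-comm a b)) (m≤n≤o⇒∣m-n∣+∣n-o∣≡∣m-o∣ b≤a a≤c))))
... | inj₂ b≤a | inj₁ b≤c | inj₂ c≤a = inj₂ (inj₁ (trans (+-comm ∣ a - c ∣ ∣ b - c ∣) (trans (cong (∣ b - c ∣ +_) (∣-∣-comm a c)) (trans (m≤n≤o⇒∣m-n∣+∣n-o∣≡∣m-o∣ b≤c c≤a) (∣-∣-comm b a)))))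
... | inj₂ b≤a | inj₂ c≤b | _        = inj₁ (trans (+-comm ∣ a - b ∣ ∣ b - c ∣) (trans (cong₂ _+_ (∣-∣-comm b c) (∣-∣-comm a b)) (trans (m≤n≤o⇒∣m-n∣+∣n-o∣≡∣m-o∣ c≤b b≤a) (∣-∣-comm c a))))

-- Positions are naturals, but Apart and Opposite treat a difference d like N − d, as on a circle of length N.
module Circle (N s lo hi : ℕ) (lo+hi≡N : lo + hi ≡ N) (hi≡lo+s : hi ≡ lo + s) (3s<N : 3 * s < N) where

  -- `Opposite` describes an arc of s + 1 positions around the antipode. `Apart` means circular
  -- distance more than s, which is when the opposite arcs of `p` and `p′` are disjoint.
  Apart Opposite : ℕ → ℕ → Set
  Apart p p′ = s < ∣ p - p′ ∣ × ∣ p - p′ ∣ + s < N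
  Opposite p p′ = lo ≤ ∣ p - p′ ∣ × ∣ p - p′ ∣ ≤ hi

  apart? : ∀ p p′ → Dec (Apart p p′)
  apart? p p′ = (s <? ∣ p - p′ ∣) ×-dec (∣ p - p′ ∣ + s <? N)

  opposite? : ∀ p p′ → Dec (Opposite p p′)
  opposite? p p′ = (lo ≤? ∣ p - p′ ∣) ×-dec (∣ p - p′ ∣ ≤? hi)

  apart-sym : ∀ {p p′} → Apart p p′ → Apart p′ p
  apart-sym {p} {p′} = subst (λ d → s < d × d + s < N) (∣-∣-comm p p′)

  opposite-sym : ∀ {p p′} → Opposite p p′ → Opposite p′ p
  opposite-sym {p} {p′} = subst (λ d → lo ≤ d × d ≤ hi) (∣-∣-comm p p′)

  N≡2lo+s : N ≡ lo + lo + s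
  N≡2lo+s = trans (sym lo+hi≡N) (trans (cong (lo +_) hi≡lo+s) (sym (+-assoc lo lo s)))

  -- This is where c < 1/A enters, in the form 3s < N: an opposite arc is shorter than its distance
  -- from the point it belongs to.
  s<lo : s < lo
  s<lo = *-cancelˡ-< 2 s lo (+-cancelʳ-< s (2 * s) (2 * lo) (subst₂ _<_ (eq₁ s) (trans N≡2lo+s (eq₂ lo s)) 3s<N))
    where
    eq₁ : ∀ s → 3 * s ≡ 2 * s + s
    eq₁ = solve-∀
    eq₂ : ∀ l s → l + l + s ≡ 2 * l + s
    eq₂ = solve-∀

  hi<2lo : hi < lo + lo
  hi<2lo = subst (_< lo + lo) (sym hi≡lo+s) (+-monoʳ-< lo s<lo)

  -- On a line the distance from `a` to `c` is either the sum of the other two, hence at least 2lo =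
  -- N - s, or their difference, hence at most hi - lo = s. In both cases the circular distance is
  -- at most s.
  opposite-opposite⇒¬apart : ∀ {a b c} → Opposite a b → Opposite b c → ¬ Apart a c
  opposite-opposite⇒¬apart {a} {b} {c} (lo≤ab , ab≤hi) (lo≤bc , bc≤hi) (s<ac , ac+s<N) with ∣-∣-collinear a b c
  ... | inj₁ eq        = <⇒≱ ac+s<N (≤-trans (≤-reflexive N≡2lo+s) (+-monoˡ-≤ s (≤-trans (+-mono-≤ lo≤ab lo≤bc) (≤-reflexive eq))))
  ... | inj₂ (inj₁ eq) = <⇒≱ s<ac (+-cancelʳ-≤ lo _ _ (≤-trans (+-monoʳ-≤ ∣ a - c ∣ lo≤bc)
                           (≤-trans (≤-reflexive eq) (≤-trans ab≤hi (≤-reflexive (trans hi≡lo+s (+-comm lo s)))))))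
  ... | inj₂ (inj₂ eq) = <⇒≱ s<ac (+-cancelʳ-≤ lo _ _ (≤-trans (+-monoʳ-≤ ∣ a - c ∣ lo≤ab)
                           (≤-trans (≤-reflexive eq) (≤-trans bc≤hi (≤-reflexive (trans hi≡lo+s (+-comm lo s)))))))

  -- The largest of three collinear distances is the sum of the others, thus at least 2lo, which
  -- exceeds hi.
  opposite-triangle-free : ∀ {a b c} → Opposite a b → Opposite a c → Opposite b c → ⊥
  opposite-triangle-free {a} {b} {c} (lo≤ab , ab≤hi) (lo≤ac , ac≤hi) (lo≤bc , bc≤hi) with ∣-∣-collinear a b c
  ... | inj₁ eq        = <⇒≱ hi<2lo (≤-trans (+-mono-≤ lo≤ab lo≤bc) (≤-trans (≤-reflexive eq) ac≤hi))
  ... | inj₂ (inj₁ eq) = <⇒≱ hi<2lo (≤-trans (+-mono-≤ lo≤ac lo≤bc) (≤-trans (≤-reflexive eq) ab≤hi))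
  ... | inj₂ (inj₂ eq) = <⇒≱ hi<2lo (≤-trans (+-mono-≤ lo≤ac lo≤ab) (≤-trans (≤-reflexive eq) bc≤hi))

  -- If 0 is in the family then the rest lies in [1 , s] ∪ [N − s , N − 1], and of i and N − s − 1 + i
  -- at most one belongs to it.
  family-through-0 : (φ : ℕ → ℕ) → (∀ p → φ p ≤ 1) → (∀ p p′ → 1 ≤ φ p → 1 ≤ φ p′ → ¬ Apart p p′) →
    1 ≤ φ 0 → ∑ (upTo N) φ ≤ suc s
  family-through-0 φ φ≤1 indep φ0≥1 = begin
    ∑ (upTo N) φ                       ≡⟨ cong (λ n → ∑ (upTo n) φ) N≡ ⟩
    ∑ (upTo (suc (s + (r + s)))) φ     ≡⟨ ∑-upTo-suc (s + (r + s)) φ ⟩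
    φ 0 + ∑ (upTo (s + (r + s))) (φ ∘ suc)
      ≡⟨ cong (φ 0 +_) (trans (∑-upTo-+ s (r + s) (φ ∘ suc)) (cong (∑ (upTo s) (φ ∘ suc) +_) (∑-upTo-+ r s (λ i → φ (suc (s + i)))))) ⟩
    φ 0 + (∑ (upTo s) (φ ∘ suc) + (∑ (upTo r) (λ i → φ (suc (s + i))) + ∑ (upTo s) (λ i → φ (suc (s + (r + i))))))
      ≡⟨ cong (λ z → φ 0 + (∑ (upTo s) (φ ∘ suc) + (z + ∑ (upTo s) (λ i → φ (suc (s + (r + i))))))) (∑-zero (upTo r) _ (middle ∘ ∈-upTo⁻)) ⟩
    φ 0 + (∑ (upTo s) (φ ∘ suc) + ∑ (upTo s) (λ i → φ (suc (s + (r + i)))))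
      ≡⟨ cong (φ 0 +_) (∑-+ (upTo s) (φ ∘ suc) (λ i → φ (suc (s + (r + i))))) ⟨
    φ 0 + ∑ (upTo s) (λ i → φ (suc i) + φ (suc (s + (r + i))))
      ≤⟨ +-mono-≤ (φ≤1 0) (∑-mono (upTo s) paired) ⟩
    1 + ∑ (upTo s) (λ _ → 1)           ≡⟨ cong suc (trans (∑-const (upTo s) 1) (trans (*-identityʳ _) (length-applyUpTo id s))) ⟩
    suc s                              ∎
    where
    open ≤-Reasoning
    r = N ∸ suc (s + s)
    2s<N : s + s < N
    2s<N = ≤-<-trans (≤-trans (m≤m+n (s + s) s) (≤-reflexive (eq s))) 3s<N
      where
      eq : ∀ s → s + s + s ≡ 3 * s
      eq = solve-∀
    N≡ : N ≡ suc (s + (r + s))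
    N≡ = trans (sym (m+[n∸m]≡n 2s<N)) (eq s r)
      where
      eq : ∀ s r → suc (s + s) + r ≡ suc (s + (r + s))
      eq = solve-∀
    r≥1 : s < s + r
    r≥1 = m<m+n s (m<n⇒0<n∸m (≤-trans (s≤s (≤-reflexive (sym (+-suc s s))))
      (≤-trans (+-mono-≤ s<lo s<lo) (≤-trans (m≤m+n (lo + lo) s) (≤-reflexive (sym N≡2lo+s))))))
    middle : ∀ {i} → i < r → φ (suc (s + i)) ≡ 0
    middle {i} i<r with 1 ≤? φ (suc (s + i))
    ... | no ¬p = n<1⇒n≡0 (≰⇒> ¬p)
    ... | yes p = ⊥-elim (indep 0 (suc (s + i)) φ0≥1 p (s≤s (m≤m+n s i) ,
          subst (suc (s + i) + s <_) (sym N≡) (s≤s (subst₂ _≤_ (eq₁ s i) refl (+-monoʳ-≤ s (+-monoˡ-≤ s i<r))))))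
      where
      eq₁ : ∀ s i → s + (suc i + s) ≡ suc (s + i) + s
      eq₁ = solve-∀
    paired : ∀ i → φ (suc i) + φ (suc (s + (r + i))) ≤ 1
    paired i with 1 ≤? φ (suc i) | 1 ≤? φ (suc (s + (r + i)))
    ... | no ¬p | _     rewrite n<1⇒n≡0 (≰⇒> ¬p) = φ≤1 _
    ... | yes _ | no ¬p rewrite n<1⇒n≡0 (≰⇒> ¬p) | +-identityʳ (φ (suc i)) = φ≤1 _
    ... | yes p | yes q = ⊥-elim (indep (suc i) (suc (s + (r + i))) p q
          (subst (s <_) (sym diff) r≥1 , subst₂ (λ d n → d + s < n) (sym diff) (sym N≡) (s≤s (≤-reflexive (+-assoc s r s)))))
      where
      diff : ∣ suc i - suc (s + (r + i)) ∣ ≡ s + r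
      diff = trans (cong (λ z → ∣ i - z ∣) (eq s r i)) (∣m-m+n∣≡n i (s + r))
        where
        eq : ∀ s r i → s + (r + i) ≡ i + (s + r)
        eq = solve-∀

  -- `Apart` depends on the difference of positions only, so the family is shifted until it contains
  -- 0; the segment that remains is then extended to a full turn.
  family-≤ : ∀ n → n ≤ N → (φ : ℕ → ℕ) → (∀ p → φ p ≤ 1) → (∀ p p′ → 1 ≤ φ p → 1 ≤ φ p′ → ¬ Apart p p′) →
    ∑ (upTo n) φ ≤ suc s
  family-≤ zero    n≤N φ φ≤1 indep = z≤n
  family-≤ (suc n) n<N φ φ≤1 indep with 1 ≤? φ 0
  ... | yes φ0≥1 = ≤-trans (≤-trans (m≤m+n _ _) (≤-reflexive (sym (trans (cong (λ z → ∑ (upTo z) φ) (sym (m+[n∸m]≡n n<N))) (∑-upTo-+ (suc n) (N ∸ suc n) φ)))))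
                     (family-through-0 φ φ≤1 indep φ0≥1)
  ... | no φ0≱1  = ≤-trans (≤-reflexive (trans (∑-upTo-suc n φ) (cong (_+ ∑ (upTo n) (φ ∘ suc)) (n<1⇒n≡0 (≰⇒> φ0≱1)))))
                     (family-≤ n (<⇒≤ n<N) (φ ∘ suc) (φ≤1 ∘ suc) (λ p p′ → indep (suc p) (suc p′)))

  -- Cut the arc [p + lo , p + hi] at N and move the part beyond N back by N.
  opposite-many : ∀ p → p < N → suc s ≤ ∑ (upTo N) (λ p′ → ind (opposite? p p′))
  opposite-many p p<N = begin
    suc s
      ≡⟨ trans (∑-const (upTo (suc s)) 1) (trans (*-identityʳ _) (length-applyUpTo id (suc s))) ⟨
    ∑ (upTo (suc s)) (λ _ → 1)
      ≤⟨ ∑-mono-∈ (upTo (suc s)) (λ j j∈ → ≤-reflexive (sym (ind-yes (arc? (p + lo + j)) (inside (∈-upTo⁻ j∈))))) ⟩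
    ∑ (upTo (suc s)) (λ j → w (p + lo + j))
      ≤⟨ ≤-trans (m≤m+n _ _) (m≤n+m _ (∑ (upTo (p + lo)) w)) ⟩
    ∑ (upTo (p + lo)) w + (∑ (upTo (suc s)) (λ j → w (p + lo + j)) + ∑ (upTo rest) (λ j → w (p + lo + (suc s + j))))
      ≡⟨ trans (∑-upTo-+ (p + lo) (suc s + rest) w) (cong (∑ (upTo (p + lo)) w +_) (∑-upTo-+ (suc s) rest (λ j → w (p + lo + j)))) ⟨
    ∑ (upTo (p + lo + (suc s + rest))) w
      ≡⟨ cong (λ n → ∑ (upTo n) w) (trans (sym (+-assoc (p + lo) (suc s) rest)) (m+[n∸m]≡n fits)) ⟩
    ∑ (upTo (N + N)) w
      ≡⟨ trans (∑-upTo-+ N N w) (sym (∑-+ (upTo N) w (λ p′ → w (N + p′)))) ⟩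
    ∑ (upTo N) (λ p′ → w p′ + w (N + p′))
      ≤⟨ ∑-mono (upTo N) wrap ⟩
    ∑ (upTo N) (λ p′ → ind (opposite? p p′)) ∎
    where
    open ≤-Reasoning
    arc? : ∀ z → Dec (p + lo ≤ z × z ≤ p + hi)
    arc? z = (p + lo ≤? z) ×-dec (z ≤? p + hi)
    w : ℕ → ℕ
    w z = ind (arc? z)
    hi≤N : hi ≤ N
    hi≤N = ≤-trans (m≤n+m hi lo) (≤-reflexive lo+hi≡N)
    inside : ∀ {j} → j < suc s → p + lo ≤ p + lo + j × p + lo + j ≤ p + hi
    inside {j} j<1+s = m≤m+n (p + lo) j , ≤-trans (≤-reflexive (+-assoc p lo j))
      (+-monoʳ-≤ p (≤-trans (+-monoʳ-≤ lo (s≤s⁻¹ j<1+s)) (≤-reflexive (sym hi≡lo+s))))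
    fits : p + lo + suc s ≤ N + N
    fits = ≤-trans (≤-reflexive (trans (eq p lo s) (cong (suc p +_) (sym hi≡lo+s)))) (+-mono-≤ p<N hi≤N)
      where
      eq : ∀ p l s → p + l + suc s ≡ suc p + (l + s)
      eq = solve-∀
    rest = N + N ∸ (p + lo + suc s)
    direct : ∀ p′ → p + lo ≤ p′ × p′ ≤ p + hi → Opposite p p′
    direct p′ (below , above) with m≤n⇒∃[o]m+o≡n (≤-trans (m≤m+n p lo) below)
    ... | d , refl = subst (λ z → lo ≤ z × z ≤ hi) (sym (∣m-m+n∣≡n p d)) (+-cancelˡ-≤ p lo d below , +-cancelˡ-≤ p d hi above)
    wrapped : ∀ p′ → p + lo ≤ N + p′ × N + p′ ≤ p + hi → Opposite p p′
    wrapped p′ (below , above) with m≤n⇒∃[o]m+o≡n (+-cancelˡ-≤ N p′ p (≤-trans above (≤-trans (+-monoʳ-≤ p hi≤N) (≤-reflexive (+-comm p N)))))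
    ... | d , refl = subst (λ z → lo ≤ z × z ≤ hi) (sym (trans (∣-∣-comm (p′ + d) p′) (∣m-m+n∣≡n p′ d)))
      ( +-cancelʳ-≤ (hi + p′) lo d (≤-trans (≤-reflexive (trans (sym (+-assoc lo hi p′)) (cong (_+ p′) lo+hi≡N))) (≤-trans above (≤-reflexive (eq₁ p′ d hi))))
      , +-cancelʳ-≤ (lo + p′) d hi (≤-trans (≤-reflexive (eq₂ p′ d lo)) (≤-trans below (≤-reflexive (trans (cong (_+ p′) (sym lo+hi≡N)) (eq₃ lo hi p′))))))
      where
      eq₁ : ∀ p d h → p + d + h ≡ d + (h + p)
      eq₁ = solve-∀
      eq₂ : ∀ p d l → d + (l + p) ≡ p + d + l
      eq₂ = solve-∀
      eq₃ : ∀ l h p → l + h + p ≡ h + (l + p)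
      eq₃ = solve-∀
    wrap : ∀ p′ → w p′ + w (N + p′) ≤ ind (opposite? p p′)
    wrap p′ = go (arc? p′) (arc? (N + p′))
      where
      go : (a : Dec (p + lo ≤ p′ × p′ ≤ p + hi)) (b : Dec (p + lo ≤ N + p′ × N + p′ ≤ p + hi)) → ind a + ind b ≤ ind (opposite? p p′)
      go (no _)  b       = ind-mono b (opposite? p p′) (wrapped p′)
      go (yes a) (no _)  = ≤-reflexive (sym (ind-yes (opposite? p p′) (direct p′ a)))
      go (yes (below , _)) (yes (_ , above)) = ⊥-elim (<⇒≱ (≤-<-trans hi≤N (m<m+n N (≤-<-trans z≤n s<lo)))
        (+-cancelˡ-≤ p (N + lo) hi (≤-trans (≤-trans (≤-reflexive (eq p N lo)) (+-monoʳ-≤ N below)) above)))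
        where
        eq : ∀ p N l → p + (N + l) ≡ N + (p + l)
        eq = solve-∀

-- The colouring of cells and its cliques

module _ {R : A → A → Set} (R-sym : ∀ {x y} → R x y → R y x) where

  allPairs-lookup : ∀ {xs} → AllPairs R xs → ∀ {x y} → x ∈ xs → y ∈ xs → x ≢ y → R x y
  allPairs-lookup (rs ∷ ps) (here refl) (here refl) x≢y = ⊥-elim (x≢y refl)
  allPairs-lookup (rs ∷ ps) (here refl) (there y∈)  x≢y = All.lookup rs y∈
  allPairs-lookup (rs ∷ ps) (there x∈)  (here refl) x≢y = R-sym (All.lookup rs x∈)
  allPairs-lookup (rs ∷ ps) (there x∈)  (there y∈)  x≢y = allPairs-lookup ps x∈ y∈ x≢y

≤1-if-no-pair : {R : A → A → Set} {P : A → Set} → (∀ {a b} → P a → P b → ¬ R a b) →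
  ∀ {xs} → All P xs → AllPairs R xs → length xs ≤ 1
≤1-if-no-pair free []            _                   = z≤n
≤1-if-no-pair free (_ ∷ [])      _                   = ≤-refl
≤1-if-no-pair free (p ∷ q ∷ _) ((r ∷ _) ∷ _)         = ⊥-elim (free p q r)

≤2-if-no-triangle : {R : A → A → Set} {P : A → Set} →
  (∀ {a b c} → P a → P b → P c → R a b → R a c → R b c → ⊥) →
  ∀ {xs} → All P xs → AllPairs R xs → length xs ≤ 2
≤2-if-no-triangle free []              _ = z≤n
≤2-if-no-triangle free (_ ∷ [])        _ = s≤s z≤n
≤2-if-no-triangle free (_ ∷ _ ∷ [])    _ = ≤-refl
≤2-if-no-triangle free (p ∷ q ∷ r ∷ _) ((ab ∷ ac ∷ _) ∷ (bc ∷ _) ∷ _) = ⊥-elim (free p q r ab ac bc)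

length-allFin : ∀ k → length (allFin k) ≡ k
length-allFin k = length-tabulate {n = k} id

data Piece : Set where
  X̂ Ŷ Ẑ₁ Ẑ₂ : Piece

_≟ᵂ_ : DecidableEquality Piece
X̂  ≟ᵂ X̂  = yes refl
X̂  ≟ᵂ Ŷ  = no λ ()
X̂  ≟ᵂ Ẑ₁ = no λ ()
X̂  ≟ᵂ Ẑ₂ = no λ ()
Ŷ  ≟ᵂ X̂  = no λ ()
Ŷ  ≟ᵂ Ŷ  = yes refl
Ŷ  ≟ᵂ Ẑ₁ = no λ ()
Ŷ  ≟ᵂ Ẑ₂ = no λ ()
Ẑ₁ ≟ᵂ X̂  = no λ ()
Ẑ₁ ≟ᵂ Ŷ  = no λ ()
Ẑ₁ ≟ᵂ Ẑ₁ = yes refl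
Ẑ₁ ≟ᵂ Ẑ₂ = no λ ()
Ẑ₂ ≟ᵂ X̂  = no λ ()
Ẑ₂ ≟ᵂ Ŷ  = no λ ()
Ẑ₂ ≟ᵂ Ẑ₁ = no λ ()
Ẑ₂ ≟ᵂ Ẑ₂ = yes refl

pick : {P : Set} → Dec P → Colour → Colour → Colour
pick p a b = if does p then a else b

pick-cong : {P Q : Set} (p : Dec P) (q : Dec Q) {a b b′ : Colour} → (P → Q) → (Q → P) → b ≡ b′ → pick p a b ≡ pick q a b′
pick-cong (yes _) (yes _) _ _ _    = refl
pick-cong (yes p) (no ¬q) f _ _    = ⊥-elim (¬q (f p))
pick-cong (no ¬p) (yes q) _ g _    = ⊥-elim (¬p (g q))
pick-cong (no _)  (no _)  _ _ refl = refl

pick-yes : {P : Set} (p : Dec P) {a b : Colour} → P → pick p a b ≡ a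
pick-yes (yes _) _ = refl
pick-yes (no ¬p) p = ⊥-elim (¬p p)

pick-no : {P : Set} (p : Dec P) {a b : Colour} → ¬ P → pick p a b ≡ b
pick-no (yes p) ¬p = ⊥-elim (¬p p)
pick-no (no _)  _  = refl

¬InRP-blue : ¬ InRP blue
¬InRP-blue (inj₁ ())
¬InRP-blue (inj₂ ())

InRP-pick : {P : Set} (p : Dec P) {a b : Colour} → InRP (pick p a b) → P ⊎ InRP b
InRP-pick (yes p) _ = inj₁ p
InRP-pick (no _)  r = inj₂ r

InRP-pick-blue : {P : Set} (p : Dec P) {a : Colour} → InRP (pick p a blue) → P
InRP-pick-blue (yes p) _ = p
InRP-pick-blue (no _)  r = ⊥-elim (¬InRP-blue r)

module Cells {L E : ℕ} (g : Geometry L E) (k N s lo hi : ℕ)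
  (lo+hi≡N : lo + hi ≡ N) (hi≡lo+s : hi ≡ lo + s) (3s<N : 3 * s < N) where

  open Geometry g public
  open Circle N s lo hi lo+hi≡N hi≡lo+s 3s<N public

  -- Every cell carries a point of X and one of Y, even where the colouring ignores them. All labels
  -- then have equally many cells, and relative sizes are a matter of the multiplicities of labels
  -- alone.
  Label Cell : Set
  Label = Piece ⊎ (Fin k × ℕ)
  Cell = Label × X × Y

  _≟ᴸ_ : DecidableEquality Label
  _≟ᴸ_ = ⊎-≡-dec _≟ᵂ_ (×-≡-dec Fin._≟_ _≟_)

  _≟ᶜ_ : DecidableEquality Cell
  _≟ᶜ_ = ×-≡-dec _≟ᴸ_ (×-≡-dec _≟ˣ_ _≟ʸ_)

  mixed : Y → Y → Colour
  mixed y y′ = pick (nearY? y y′) red purple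

  core : Piece → Piece → X → Y → X → Y → Colour
  core X̂  X̂  x y x′ y′ = pick (nearX? x x′) red blue
  core X̂  Ŷ  x y x′ y′ = pick (cross? x y′) purple blue
  core X̂  Ẑ₁ x y x′ y′ = purple
  core X̂  Ẑ₂ x y x′ y′ = blue
  core Ŷ  X̂  x y x′ y′ = pick (cross? x′ y) purple blue
  core Ŷ  Ŷ  x y x′ y′ = pick (nearY? y y′) red blue
  core Ŷ  Ẑ₁ x y x′ y′ = blue
  core Ŷ  Ẑ₂ x y x′ y′ = purple
  core Ẑ₁ X̂  x y x′ y′ = purple
  core Ẑ₁ Ŷ  x y x′ y′ = blue
  core Ẑ₁ Ẑ₁ x y x′ y′ = blue
  core Ẑ₁ Ẑ₂ x y x′ y′ = mixed y y′
  core Ẑ₂ X̂  x y x′ y′ = blue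
  core Ẑ₂ Ŷ  x y x′ y′ = purple
  core Ẑ₂ Ẑ₁ x y x′ y′ = mixed y y′
  core Ẑ₂ Ẑ₂ x y x′ y′ = blue

  -- Close points of Y are denied purple because two red edges at one vertex have close far ends; a
  -- purple edge between these would complete a triangle.
  circle : ℕ → ℕ → Y → Y → Colour
  circle p p′ y y′ = pick (nearY? y y′ ×-dec apart? p p′) red
                    (pick (opposite? p p′ ×-dec ¬? (closeY? y y′)) purple blue)

  circles : ∀ {i j : Fin k} → Dec (i ≡ j) → ℕ → ℕ → Y → Y → Colour
  circles (yes _) p p′ y y′ = circle p p′ y y′
  circles (no _)  p p′ y y′ = mixed y y′

  col : Cell → Cell → Colour
  col (inj₁ a , x , y)       (inj₁ b , x′ , y′)        = core a b x y x′ y′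
  col (inj₁ _ , _ , y)       (inj₂ _ , _ , y′)         = mixed y y′
  col (inj₂ _ , _ , y)       (inj₁ _ , _ , y′)         = mixed y y′
  col (inj₂ (i , p) , _ , y) (inj₂ (j , p′) , _ , y′)  = circles (i Fin.≟ j) p p′ y y′

  mixed-sym : ∀ y y′ → mixed y y′ ≡ mixed y′ y
  mixed-sym y y′ = pick-cong (nearY? y y′) (nearY? y′ y) nearY-sym nearY-sym refl

  core-sym : ∀ a b x y x′ y′ → core a b x y x′ y′ ≡ core b a x′ y′ x y
  core-sym X̂  X̂  x y x′ y′ = pick-cong (nearX? x x′) (nearX? x′ x) nearX-sym nearX-sym refl
  core-sym X̂  Ŷ  x y x′ y′ = refl
  core-sym X̂  Ẑ₁ x y x′ y′ = refl
  core-sym X̂  Ẑ₂ x y x′ y′ = refl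
  core-sym Ŷ  X̂  x y x′ y′ = refl
  core-sym Ŷ  Ŷ  x y x′ y′ = pick-cong (nearY? y y′) (nearY? y′ y) nearY-sym nearY-sym refl
  core-sym Ŷ  Ẑ₁ x y x′ y′ = refl
  core-sym Ŷ  Ẑ₂ x y x′ y′ = refl
  core-sym Ẑ₁ X̂  x y x′ y′ = refl
  core-sym Ẑ₁ Ŷ  x y x′ y′ = refl
  core-sym Ẑ₁ Ẑ₁ x y x′ y′ = refl
  core-sym Ẑ₁ Ẑ₂ x y x′ y′ = mixed-sym y y′
  core-sym Ẑ₂ X̂  x y x′ y′ = refl
  core-sym Ẑ₂ Ŷ  x y x′ y′ = refl
  core-sym Ẑ₂ Ẑ₁ x y x′ y′ = mixed-sym y y′
  core-sym Ẑ₂ Ẑ₂ x y x′ y′ = refl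

  circle-sym : ∀ p p′ y y′ → circle p p′ y y′ ≡ circle p′ p y′ y
  circle-sym p p′ y y′ = pick-cong (nearY? y y′ ×-dec apart? p p′) (nearY? y′ y ×-dec apart? p′ p)
    (λ (n , a) → nearY-sym n , apart-sym {p} a) (λ (n , a) → nearY-sym n , apart-sym {p′} a)
    (pick-cong (opposite? p p′ ×-dec ¬? (closeY? y y′)) (opposite? p′ p ×-dec ¬? (closeY? y′ y))
      (λ (o , f) → opposite-sym {p} o , f ∘ closeY-sym) (λ (o , f) → opposite-sym {p′} o , f ∘ closeY-sym) refl)

  col-sym : ∀ u v → col u v ≡ col v u
  col-sym (inj₁ a , x , y)       (inj₁ b , x′ , y′)        = core-sym a b x y x′ y′
  col-sym (inj₁ _ , _ , y)       (inj₂ _ , _ , y′)         = mixed-sym y y′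
  col-sym (inj₂ _ , _ , y)       (inj₁ _ , _ , y′)         = mixed-sym y y′
  col-sym (inj₂ (i , p) , _ , y) (inj₂ (j , p′) , _ , y′) with i Fin.≟ j | j Fin.≟ i
  ... | yes _   | yes _   = circle-sym p p′ y y′
  ... | yes i≡j | no j≢i  = ⊥-elim (j≢i (sym i≡j))
  ... | no i≢j  | yes j≡i = ⊥-elim (i≢j (sym j≡i))
  ... | no _    | no _    = mixed-sym y y′

  ¬nearX-refl : ∀ {x} → ¬ nearX x x
  ¬nearX-refl n = nearX-triangle-free n n n

  ¬nearY-refl : ∀ {y} → ¬ nearY y y
  ¬nearY-refl n = nearY-triangle-free n n n

  col-diagonal : ∀ u → col u u ≡ blue
  col-diagonal (inj₁ X̂  , x , y) = pick-no (nearX? x x) ¬nearX-refl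
  col-diagonal (inj₁ Ŷ  , x , y) = pick-no (nearY? y y) ¬nearY-refl
  col-diagonal (inj₁ Ẑ₁ , x , y) = refl
  col-diagonal (inj₁ Ẑ₂ , x , y) = refl
  col-diagonal (inj₂ (i , p) , x , y) with i Fin.≟ i
  ... | no i≢i = ⊥-elim (i≢i refl)
  ... | yes _  = trans (pick-no (nearY? y y ×-dec apart? p p) (λ (n , _) → ¬nearY-refl n))
                       (pick-no (opposite? p p ×-dec ¬? (closeY? y y)) (λ (_ , f) → f (closeY-refl y)))

  Adj : Cell → Cell → Set
  Adj u v = InRP (col u v)

  Adj-sym : ∀ {u v} → Adj u v → Adj v u
  Adj-sym {u} {v} = subst InRP (col-sym u v)

  circle-Adj : ∀ p p′ y y′ → InRP (circle p p′ y y′) → (nearY y y′ × Apart p p′) ⊎ (Opposite p p′ × ¬ closeY y y′)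
  circle-Adj p p′ y y′ r with InRP-pick (nearY? y y′ ×-dec apart? p p′) r
  ... | inj₁ n = inj₁ n
  ... | inj₂ o = inj₂ (InRP-pick-blue (opposite? p p′ ×-dec ¬? (closeY? y y′)) o)

  -- By the number of near edges: three form a near triangle in Y; two make their far ends close,
  -- which forbids the third edge; one joins positions with a common opposite position although they
  -- are apart; none leaves a triangle of opposite positions.
  circle-triangle-free : ∀ p q r x y z →
    InRP (circle p q x y) → InRP (circle p r x z) → InRP (circle q r y z) → ⊥
  circle-triangle-free p q r x y z pq pr qr
    with circle-Adj p q x y pq | circle-Adj p r x z pr | circle-Adj q r y z qr
  ... | inj₁ (xy , _) | inj₁ (xz , _) | inj₁ (yz , _) = nearY-triangle-free xy xz yz
  ... | inj₁ (xy , _) | inj₁ (xz , _) | inj₂ (_ , yz) = yz (nearY-nearY⇒closeY xy xz)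
  ... | inj₁ (xy , _) | inj₂ (_ , xz) | inj₁ (yz , _) = xz (nearY-nearY⇒closeY (nearY-sym xy) yz)
  ... | inj₂ (_ , xy) | inj₁ (xz , _) | inj₁ (yz , _) = xy (nearY-nearY⇒closeY (nearY-sym xz) (nearY-sym yz))
  ... | inj₁ (_ , pq) | inj₂ (pr , _) | inj₂ (qr , _) = opposite-opposite⇒¬apart {p} {r} {q} pr (opposite-sym {q} qr) pq
  ... | inj₂ (pq , _) | inj₁ (_ , pr) | inj₂ (qr , _) = opposite-opposite⇒¬apart {p} {q} {r} pq qr pr
  ... | inj₂ (pq , _) | inj₂ (pr , _) | inj₁ (_ , qr) = opposite-opposite⇒¬apart {q} {p} {r} (opposite-sym {p} pq) pr qr
  ... | inj₂ (pq , _) | inj₂ (pr , _) | inj₂ (qr , _) = opposite-triangle-free {p} {q} {r} pq pr qr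

  data InPiece (a : Piece) : Cell → Set where
    inPiece : ∀ x y → InPiece a (inj₁ a , x , y)

  data InCircle (i : Fin k) : Cell → Set where
    inCircle : ∀ p x y → InCircle i (inj₂ (i , p) , x , y)

  inPiece? : ∀ a u → Dec (InPiece a u)
  inPiece? a (inj₂ _ , x , y) = no λ ()
  inPiece? a (inj₁ b , x , y) with a ≟ᵂ b
  ... | yes refl = yes (inPiece x y)
  ... | no a≢b   = no λ { (inPiece _ _) → a≢b refl }

  inCircle? : ∀ i u → Dec (InCircle i u)
  inCircle? i (inj₁ _ , x , y) = no λ ()
  inCircle? i (inj₂ (j , p) , x , y) with i Fin.≟ j
  ... | yes refl = yes (inCircle p x y)
  ... | no i≢j   = no λ { (inCircle _ _ _) → i≢j refl }

  circle-≤2 : ∀ {i cs} → All (InCircle i) cs → AllPairs Adj cs → length cs ≤ 2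
  circle-≤2 {i} = ≤2-if-no-triangle λ { (inCircle p _ x) (inCircle q _ y) (inCircle r _ z) pq pr qr → triangle p q r x y z pq pr qr }
    where
    triangle : ∀ p q r x y z → InRP (circles (i Fin.≟ i) p q x y) → InRP (circles (i Fin.≟ i) p r x z) →
               InRP (circles (i Fin.≟ i) q r y z) → ⊥
    triangle with i Fin.≟ i
    ... | yes _  = circle-triangle-free
    ... | no i≢i = ⊥-elim (i≢i refl)

  X-Adj : ∀ x y x′ y′ → Adj (inj₁ X̂ , x , y) (inj₁ X̂ , x′ , y′) → nearX x x′
  X-Adj x y x′ y′ = InRP-pick-blue (nearX? x x′)

  Y-Adj : ∀ x y x′ y′ → Adj (inj₁ Ŷ , x , y) (inj₁ Ŷ , x′ , y′) → nearY y y′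
  Y-Adj x y x′ y′ = InRP-pick-blue (nearY? y y′)

  XY-Adj : ∀ x y x′ y′ → Adj (inj₁ X̂ , x , y) (inj₁ Ŷ , x′ , y′) → cross x y′
  XY-Adj x y x′ y′ = InRP-pick-blue (cross? x y′)

  X-≤2 : ∀ {cs} → All (InPiece X̂) cs → AllPairs Adj cs → length cs ≤ 2
  X-≤2 = ≤2-if-no-triangle λ { (inPiece x y) (inPiece x′ y′) (inPiece x″ y″) a b c →
    nearX-triangle-free (X-Adj x y x′ y′ a) (X-Adj x y x″ y″ b) (X-Adj x′ y′ x″ y″ c) }

  Y-≤2 : ∀ {cs} → All (InPiece Ŷ) cs → AllPairs Adj cs → length cs ≤ 2
  Y-≤2 = ≤2-if-no-triangle λ { (inPiece x y) (inPiece x′ y′) (inPiece x″ y″) a b c →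
    nearY-triangle-free (Y-Adj x y x′ y′ a) (Y-Adj x y x″ y″ b) (Y-Adj x′ y′ x″ y″ c) }

  Z₁-≤1 : ∀ {cs} → All (InPiece Ẑ₁) cs → AllPairs Adj cs → length cs ≤ 1
  Z₁-≤1 = ≤1-if-no-pair λ { (inPiece _ _) (inPiece _ _) → ¬InRP-blue }

  Z₂-≤1 : ∀ {cs} → All (InPiece Ẑ₂) cs → AllPairs Adj cs → length cs ≤ 1
  Z₂-≤1 = ≤1-if-no-pair λ { (inPiece _ _) (inPiece _ _) → ¬InRP-blue }

  Joined : List Cell → List Cell → Set
  Joined us vs = ∀ {u v} → u ∈ us → v ∈ vs → Adj u v

  not-X-Z₂ : ∀ {u us v vs} → All (InPiece X̂) (u ∷ us) → All (InPiece Ẑ₂) (v ∷ vs) → ¬ Joined (u ∷ us) (v ∷ vs)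
  not-X-Z₂ (inPiece _ _ ∷ _) (inPiece _ _ ∷ _) j = ¬InRP-blue (j (here refl) (here refl))

  not-Y-Z₁ : ∀ {u us v vs} → All (InPiece Ŷ) (u ∷ us) → All (InPiece Ẑ₁) (v ∷ vs) → ¬ Joined (u ∷ us) (v ∷ vs)
  not-Y-Z₁ (inPiece _ _ ∷ _) (inPiece _ _ ∷ _) j = ¬InRP-blue (j (here refl) (here refl))

  not-XX-YY : ∀ {u u′ us v v′ vs} → All (InPiece X̂) (u ∷ u′ ∷ us) → All (InPiece Ŷ) (v ∷ v′ ∷ vs) →
    AllPairs Adj (u ∷ u′ ∷ us) → AllPairs Adj (v ∷ v′ ∷ vs) → ¬ Joined (u ∷ u′ ∷ us) (v ∷ v′ ∷ vs)
  not-XX-YY (inPiece x a ∷ inPiece x′ a′ ∷ _) (inPiece b y ∷ inPiece b′ y′ ∷ _) ((xx ∷ _) ∷ _) ((yy ∷ _) ∷ _) j =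
    no-K₄ (X-Adj x a x′ a′ xx) (Y-Adj b y b′ y′ yy)
      (XY-Adj x a b y (j (here refl) (here refl))) (XY-Adj x a b′ y′ (j (here refl) (there (here refl))))
      (XY-Adj x′ a′ b y (j (there (here refl)) (here refl))) (XY-Adj x′ a′ b′ y′ (j (there (here refl)) (there (here refl))))

  -- Since X-Z₂ and Y-Z₁ are blue, a clique lives in X ∪ Y, X ∪ Z₁, Y ∪ Z₂ or Z₁ ∪ Z₂. Only X ∪ Y
  -- leaves room for four vertices, two from each side, and those would be the K₄ excluded by
  -- `no-K₄`.
  core-≤3 : ∀ xs ys zs ws → All (InPiece X̂) xs → All (InPiece Ŷ) ys → All (InPiece Ẑ₁) zs → All (InPiece Ẑ₂) ws →
    AllPairs Adj xs → AllPairs Adj ys → AllPairs Adj zs → AllPairs Adj ws →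
    Joined xs ys → Joined xs ws → Joined ys zs → length xs + length ys + length zs + length ws ≤ 3
  core-≤3 [] [] zs ws _ _ az aw _ _ pz pw _ _ _ = ≤-trans (+-mono-≤ (Z₁-≤1 az pz) (Z₂-≤1 aw pw)) (n≤1+n 2)
  core-≤3 [] (y ∷ ys) (z ∷ zs) ws _ ay az _ _ _ _ _ _ _ yz = ⊥-elim (not-Y-Z₁ ay az yz)
  core-≤3 [] ys@(_ ∷ _) [] ws _ ay _ aw _ py _ pw _ _ _ = +-mono-≤ (≤-trans (≤-reflexive (+-identityʳ (length ys))) (Y-≤2 ay py)) (Z₂-≤1 aw pw)
  core-≤3 (x ∷ xs) ys zs (w ∷ ws) ax _ _ aw _ _ _ _ _ xw _ = ⊥-elim (not-X-Z₂ ax aw xw)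
  core-≤3 xs@(_ ∷ _) [] zs [] ax _ az _ px _ pz _ _ _ _ =
    ≤-trans (≤-reflexive (trans (+-identityʳ _) (cong (_+ length zs) (+-identityʳ (length xs))))) (+-mono-≤ (X-≤2 ax px) (Z₁-≤1 az pz))
  core-≤3 (x ∷ xs) (y ∷ ys) (z ∷ zs) [] _ ay az _ _ _ _ _ _ _ yz = ⊥-elim (not-Y-Z₁ ay az yz)
  core-≤3 (x ∷ x′ ∷ xs) (y ∷ y′ ∷ ys) [] [] ax ay _ _ px py _ _ xy _ _ = ⊥-elim (not-XX-YY ax ay px py xy)
  core-≤3 (x ∷ []) ys@(_ ∷ _) [] [] _ ay _ _ _ py _ _ _ _ _ =
    ≤-trans (≤-reflexive (trans (+-identityʳ _) (+-identityʳ _))) (s≤s (Y-≤2 ay py))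
  core-≤3 xs@(_ ∷ _ ∷ _) (y ∷ []) [] [] ax _ _ _ px _ _ _ _ _ _ =
    ≤-trans (≤-reflexive (trans (+-identityʳ _) (+-identityʳ _))) (+-mono-≤ (X-≤2 ax px) (≤-refl {1}))

  -- With k = ℓ - 2 circles the bound is 2ℓ - 1.
  clique-≤ : ∀ cs → AllPairs Adj cs → length cs ≤ 3 + 2 * k
  clique-≤ cs pairs = begin
    length cs
      ≡⟨ length-∑ cs ⟩
    ∑ cs (λ _ → 1)
      ≤⟨ ∑-mono cs cover ⟩
    ∑ cs (λ u → #p X̂ u + #p Ŷ u + #p Ẑ₁ u + #p Ẑ₂ u + ∑ (allFin k) (λ i → #c i u))
      ≡⟨ trans (∑-+ cs (λ u → #p X̂ u + #p Ŷ u + #p Ẑ₁ u + #p Ẑ₂ u) (λ u → ∑ (allFin k) (λ i → #c i u)))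
           (cong₂ _+_ (trans (∑-+ cs (λ u → #p X̂ u + #p Ŷ u + #p Ẑ₁ u) (#p Ẑ₂))
             (cong (_+ ∑ cs (#p Ẑ₂)) (trans (∑-+ cs (λ u → #p X̂ u + #p Ŷ u) (#p Ẑ₁)) (cong (_+ ∑ cs (#p Ẑ₁)) (∑-+ cs (#p X̂) (#p Ŷ))))))
             (∑-swap cs (allFin k) (λ u i → #c i u))) ⟩
    ∑ cs (#p X̂) + ∑ cs (#p Ŷ) + ∑ cs (#p Ẑ₁) + ∑ cs (#p Ẑ₂) + ∑ (allFin k) (λ i → ∑ cs (#c i))
      ≡⟨ cong₂ _+_ (cong₂ _+_ (cong₂ _+_ (cong₂ _+_ (lengths X̂) (lengths Ŷ)) (lengths Ẑ₁)) (lengths Ẑ₂))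
           (∑-cong (allFin k) (λ i → sym (length-filter-∑ (inCircle? i) cs))) ⟩
    length (part X̂) + length (part Ŷ) + length (part Ẑ₁) + length (part Ẑ₂)
      + ∑ (allFin k) (λ i → length (filter (inCircle? i) cs))
      ≤⟨ +-mono-≤
           (core-≤3 (part X̂) (part Ŷ) (part Ẑ₁) (part Ẑ₂) (all X̂) (all Ŷ) (all Ẑ₁) (all Ẑ₂)
             (inner X̂) (inner Ŷ) (inner Ẑ₁) (inner Ẑ₂) (joined X̂ Ŷ (λ ())) (joined X̂ Ẑ₂ (λ ())) (joined Ŷ Ẑ₁ (λ ())))
           (∑-mono (allFin k) (λ i → circle-≤2 (all-filter (inCircle? i) cs) (AllPairsₚ.filter⁺ (inCircle? i) pairs))) ⟩
    3 + ∑ (allFin k) (λ _ → 2)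
      ≡⟨ cong (3 +_) (trans (∑-const (allFin k) 2) (trans (cong (_* 2) (length-allFin k)) (*-comm k 2))) ⟩
    3 + 2 * k ∎
    where
    open ≤-Reasoning
    #p : Piece → Cell → ℕ
    #p a u = ind (inPiece? a u)
    #c : Fin k → Cell → ℕ
    #c i u = ind (inCircle? i u)
    part : Piece → List Cell
    part a = filter (inPiece? a) cs
    lengths : ∀ a → ∑ cs (#p a) ≡ length (part a)
    lengths a = sym (length-filter-∑ (inPiece? a) cs)
    all : ∀ a → All (InPiece a) (part a)
    all a = all-filter (inPiece? a) cs
    inner : ∀ a → AllPairs Adj (part a)
    inner a = AllPairsₚ.filter⁺ (inPiece? a) pairs
    joined : ∀ a b → a ≢ b → Joined (part a) (part b)
    joined a b a≢b {u} {v} u∈ v∈ with ∈-filter⁻ (inPiece? a) {xs = cs} u∈ | ∈-filter⁻ (inPiece? b) {xs = cs} v∈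
    ... | u∈cs , inPiece _ _ | v∈cs , inPiece _ _ =
      allPairs-lookup (λ {u} {v} → Adj-sym {u} {v}) pairs u∈cs v∈cs (λ { refl → a≢b refl })
    cover : ∀ u → 1 ≤ #p X̂ u + #p Ŷ u + #p Ẑ₁ u + #p Ẑ₂ u + ∑ (allFin k) (λ i → #c i u)
    cover (inj₁ X̂  , x , y) = s≤s z≤n
    cover (inj₁ Ŷ  , x , y) = s≤s z≤n
    cover (inj₁ Ẑ₁ , x , y) = s≤s z≤n
    cover (inj₁ Ẑ₂ , x , y) = s≤s z≤n
    cover u@(inj₂ (i , p) , x , y) = ≤-trans (≤-reflexive (sym (ind-yes (inCircle? i u) (inCircle p x y))))
      (∑-∈ (λ i → #c i u) (∈-allFin i))

-- Sets without red pairs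

module Weighted {L E : ℕ} (g : Geometry L E) (k N s lo hi : ℕ)
  (lo+hi≡N : lo + hi ≡ N) (hi≡lo+s : hi ≡ lo + s) (3s<N : 3 * s < N)
  (a : ℕ) (L≡ : L ≡ 2 * a + 2 * s + k * N) (L≥1 : 1 ≤ L) where

  open Cells g k N s lo hi lo+hi≡N hi≡lo+s 3s<N public

  -- Repetition encodes size, in the unit in which one position of a circle has size 1.
  pieces : List Piece
  pieces = replicate a X̂ ++ replicate a Ŷ ++ replicate s Ẑ₁ ++ replicate s Ẑ₂

  labels : List Label
  labels = map inj₁ pieces ++ map inj₂ (cartesianProductWith _,_ (allFin k) (upTo N))

  Ω : List (X × Y)
  Ω = cartesianProductWith _,_ Ωx Ωy

  cells : List Cell
  cells = cartesianProductWith _,_ labels Ω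

  n : ℕ
  n = length Ωx * length Ωy

  ∑-pieces : (f : Piece → ℕ) → ∑ pieces f ≡ a * f X̂ + (a * f Ŷ + (s * f Ẑ₁ + s * f Ẑ₂))
  ∑-pieces f = trans (∑-++ (replicate a X̂) _ f) (cong₂ _+_ (∑-replicate a X̂ f)
    (trans (∑-++ (replicate a Ŷ) _ f) (cong₂ _+_ (∑-replicate a Ŷ f)
    (trans (∑-++ (replicate s Ẑ₁) _ f) (cong₂ _+_ (∑-replicate s Ẑ₁ f) (∑-replicate s Ẑ₂ f))))))

  ∑-labels : (f : Label → ℕ) → ∑ labels f
    ≡ ∑ pieces (f ∘ inj₁) + ∑ (allFin k) (λ i → ∑ (upTo N) (λ p → f (inj₂ (i , p))))
  ∑-labels f = trans (∑-++ (map inj₁ pieces) _ f) (cong₂ _+_ (∑-map inj₁ pieces f)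
    (trans (∑-map inj₂ (cartesianProductWith _,_ (allFin k) (upTo N)) f) (∑-cartesian _,_ (allFin k) (upTo N) (f ∘ inj₂))))

  ∑-Ω : (f : X × Y → ℕ) → ∑ Ω f ≡ ∑ Ωx (λ x → ∑ Ωy (λ y → f (x , y)))
  ∑-Ω f = ∑-cartesian _,_ Ωx Ωy f

  ∑-cells : (f : Cell → ℕ) → ∑ cells f ≡ ∑ labels (λ l → ∑ Ω (λ xy → f (l , xy)))
  ∑-cells f = ∑-cartesian _,_ labels Ω f

  length-positions : length (upTo N) ≡ N
  length-positions = length-applyUpTo id N

  length-labels : length labels ≡ L
  length-labels = begin
    length labels                     ≡⟨ length-∑ labels ⟩
    ∑ labels (λ _ → 1)                ≡⟨ ∑-labels (λ _ → 1) ⟩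
    ∑ pieces (λ _ → 1) + ∑ (allFin k) (λ i → ∑ (upTo N) (λ p → 1))
      ≡⟨ cong₂ _+_ (∑-pieces (λ _ → 1)) (trans (∑-const (allFin k) _) (cong₂ _*_ (length-allFin k) (trans (sym (length-∑ (upTo N))) length-positions))) ⟩
    a * 1 + (a * 1 + (s * 1 + s * 1)) + k * N
      ≡⟨ eq a s (k * N) ⟩
    2 * a + 2 * s + k * N             ≡⟨ L≡ ⟨
    L                                 ∎
    where
    open ≡-Reasoning
    eq : ∀ a s z → a * 1 + (a * 1 + (s * 1 + s * 1)) + z ≡ 2 * a + 2 * s + z
    eq = solve-∀

  length-Ω : length Ω ≡ n
  length-Ω = trans (length-∑ Ω) (trans (∑-Ω (λ _ → 1)) (trans (∑-const Ωx _) (cong (length Ωx *_) (sym (length-∑ Ωy)))))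

  length-cells : length cells ≡ L * n
  length-cells = trans (length-∑ cells) (trans (∑-cells (λ _ → 1)) (trans (∑-const labels _)
    (cong₂ _*_ length-labels (trans (sym (length-∑ Ω)) length-Ω))))

  -- Label pairs at which near points force red. Two such labels cannot both contain many cells of a
  -- set without red pairs.
  RedX RedY : Label → Label → Set
  RedX l l′ = ∀ {x x′ y y′} → nearX x x′ → col (l , x , y) (l′ , x′ , y′) ≡ red
  RedY l l′ = ∀ {x x′ y y′} → nearY y y′ → col (l , x , y) (l′ , x′ , y′) ≡ red

  redY-mixed : ∀ {y y′} → nearY y y′ → mixed y y′ ≡ red
  redY-mixed {y} {y′} = pick-yes (nearY? y y′)

  redY-circles : ∀ i j p p′ → i ≢ j → RedY (inj₂ (i , p)) (inj₂ (j , p′))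
  redY-circles i j p p′ i≢j near with i Fin.≟ j
  ... | yes i≡j = ⊥-elim (i≢j i≡j)
  ... | no _    = redY-mixed near

  redY-circle : ∀ i p p′ → Apart p p′ → RedY (inj₂ (i , p)) (inj₂ (i , p′))
  redY-circle i p p′ apart {y = y} {y′} near with i Fin.≟ i
  ... | yes _  = pick-yes (nearY? y y′ ×-dec apart? p p′) (near , apart)
  ... | no i≢i = ⊥-elim (i≢i refl)

  module Independent (I : List Cell) (indep : ∀ {u v} → u ∈ I → v ∈ I → col u v ≢ red) where

    count : Label → ℕ
    count l = ∑ Ω (λ xy → ind (member? _≟ᶜ_ (l , xy) I))

    -- Below the threshold 1/(2L), all thin labels together contribute at most half of the cells of
    -- one label. This half is the summand 1 in `independent-≤`.
    Thick : Label → Set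
    Thick l = n ≤ 2 * L * count l

    thick? : ∀ l → Dec (Thick l)
    thick? l = n ≤? 2 * L * count l

    at : Label → List Cell
    at l = filter (λ u → l ≟ᴸ proj₁ u) I

    xs ys : Label → List _
    xs l = map (proj₁ ∘ proj₂) (at l)
    ys l = map (proj₂ ∘ proj₂) (at l)

    ∈-at : ∀ {l x y} → (l , x , y) ∈ I → (l , x , y) ∈ at l
    ∈-at {l} u∈ = ∈-filter⁺ (λ u → l ≟ᴸ proj₁ u) u∈ refl

    thick-xs : ∀ {l} → Thick l → length Ωx ≤ 2 * L * sizeIn _≟ˣ_ Ωx (xs l)
    thick-xs {l} thick = *-cancelʳ-≤ _ _ (length Ωy) {{>-nonZero Ωy≥1}} (≤-trans thick (begin
      2 * L * count l
        ≡⟨ cong (2 * L *_) (∑-Ω _) ⟩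
      2 * L * ∑ Ωx (λ x → ∑ Ωy (λ y → ind (member? _≟ᶜ_ (l , x , y) I)))
        ≤⟨ *-monoʳ-≤ (2 * L) (∑-mono Ωx (λ x → ∑-mono Ωy (λ y →
             ind-mono (member? _≟ᶜ_ (l , x , y) I) (member? _≟ˣ_ x (xs l)) (λ u∈ → ∈-map⁺ (proj₁ ∘ proj₂) (∈-at u∈))))) ⟩
      2 * L * ∑ Ωx (λ x → ∑ Ωy (λ y → ind (member? _≟ˣ_ x (xs l))))
        ≡⟨ cong (2 * L *_) (trans (∑-cong Ωx (λ x → trans (∑-const Ωy _) (*-comm (length Ωy) _))) (∑-*ʳ Ωx (length Ωy) _)) ⟩
      2 * L * (sizeIn _≟ˣ_ Ωx (xs l) * length Ωy)
        ≡⟨ *-assoc (2 * L) _ _ ⟨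
      2 * L * sizeIn _≟ˣ_ Ωx (xs l) * length Ωy ∎))
      where open ≤-Reasoning

    thick-ys : ∀ {l} → Thick l → length Ωy ≤ 2 * L * sizeIn _≟ʸ_ Ωy (ys l)
    thick-ys {l} thick = *-cancelˡ-≤ (length Ωx) {{>-nonZero Ωx≥1}} (≤-trans thick (begin
      2 * L * count l
        ≡⟨ cong (2 * L *_) (∑-Ω _) ⟩
      2 * L * ∑ Ωx (λ x → ∑ Ωy (λ y → ind (member? _≟ᶜ_ (l , x , y) I)))
        ≤⟨ *-monoʳ-≤ (2 * L) (∑-mono Ωx (λ x → ∑-mono Ωy (λ y →
             ind-mono (member? _≟ᶜ_ (l , x , y) I) (member? _≟ʸ_ y (ys l)) (λ u∈ → ∈-map⁺ (proj₂ ∘ proj₂) (∈-at u∈))))) ⟩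
      2 * L * ∑ Ωx (λ x → sizeIn _≟ʸ_ Ωy (ys l))
        ≡⟨ cong (2 * L *_) (∑-const Ωx _) ⟩
      2 * L * (length Ωx * sizeIn _≟ʸ_ Ωy (ys l))
        ≡⟨ eq (2 * L) (length Ωx) _ ⟩
      length Ωx * (2 * L * sizeIn _≟ʸ_ Ωy (ys l)) ∎))
      where
      open ≤-Reasoning
      eq : ∀ a b c → a * (b * c) ≡ b * (a * c)
      eq = solve-∀

    ¬thick-redX : ∀ {l l′} → RedX l l′ → Thick l → ¬ Thick l′
    ¬thick-redX {l} {l′} redX tl tl′ = nearX-between (xs l) (xs l′) (thick-xs tl) (thick-xs tl′) far
      where
      far : ∀ {a b} → a ∈ xs l → b ∈ xs l′ → ¬ nearX a b
      far a∈ b∈ near with ∈-map⁻ (proj₁ ∘ proj₂) a∈ | ∈-map⁻ (proj₁ ∘ proj₂) b∈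
      ... | (_ , _ , _) , u∈ , refl | (_ , _ , _) , v∈ , refl
        with ∈-filter⁻ (λ u → l ≟ᴸ proj₁ u) {xs = I} u∈ | ∈-filter⁻ (λ u → l′ ≟ᴸ proj₁ u) {xs = I} v∈
      ... | u∈I , refl | v∈I , refl = indep u∈I v∈I (redX near)

    ¬thick-redY : ∀ {l l′} → RedY l l′ → Thick l → ¬ Thick l′
    ¬thick-redY {l} {l′} redY tl tl′ = nearY-between (ys l) (ys l′) (thick-ys tl) (thick-ys tl′) far
      where
      far : ∀ {a b} → a ∈ ys l → b ∈ ys l′ → ¬ nearY a b
      far a∈ b∈ near with ∈-map⁻ (proj₂ ∘ proj₂) a∈ | ∈-map⁻ (proj₂ ∘ proj₂) b∈
      ... | (_ , _ , _) , u∈ , refl | (_ , _ , _) , v∈ , refl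
        with ∈-filter⁻ (λ u → l ≟ᴸ proj₁ u) {xs = I} u∈ | ∈-filter⁻ (λ u → l′ ≟ᴸ proj₁ u) {xs = I} v∈
      ... | u∈I , refl | v∈I , refl = indep u∈I v∈I (redY near)

    t : Label → ℕ
    t l = ind (thick? l)

    t≤1 : ∀ l → t l ≤ 1
    t≤1 l = ind≤1 (thick? l)

    t⇒ : ∀ {l} → 1 ≤ t l → Thick l
    t⇒ {l} = ind⇒ (thick? l)

    ¬thick⇒0 : ∀ {l} → ¬ Thick l → t l ≡ 0
    ¬thick⇒0 {l} = ind-no (thick? l)

    circle-sum : Fin k → ℕ
    circle-sum i = ∑ (upTo N) (λ p → t (inj₂ (i , p)))

    -- Near points over different circles are red, so only one circle can have thick labels. Its
    -- thick positions are pairwise not apart, and such a family has at most s + 1 members.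
    thick-circles : ∑ (allFin k) circle-sum ≤ suc s
    thick-circles = ∑-exclusive (allFin⁺ k) circle-sum (suc s)
      (λ i → family-≤ N ≤-refl (λ p → t (inj₂ (i , p))) (λ p → t≤1 (inj₂ (i , p)))
        (λ p p′ tp tp′ apart → ¬thick-redY (λ {x} {x′} {y} {y′} → redY-circle i p p′ apart {x} {x′} {y} {y′}) (t⇒ {inj₂ (i , p)} tp) (t⇒ {inj₂ (i , p′)} tp′)))
      same
      where
      same : ∀ {i j} → 1 ≤ circle-sum i → 1 ≤ circle-sum j → i ≡ j
      same {i} {j} ci cj with i Fin.≟ j
      ... | yes i≡j = i≡j
      ... | no i≢j with ∑-positive (upTo N) (λ p → t (inj₂ (i , p))) ci | ∑-positive (upTo N) (λ p → t (inj₂ (j , p))) cj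
      ...   | p , _ , tp | p′ , _ , tp′ = ⊥-elim (¬thick-redY (λ {x} {x′} {y} {y′} → redY-circles i j p p′ i≢j {x} {x′} {y} {y′}) (t⇒ {inj₂ (i , p)} tp) (t⇒ {inj₂ (j , p′)} tp′))

    tX≡0 : t (inj₁ X̂) ≡ 0
    tX≡0 = ¬thick⇒0 {inj₁ X̂} (λ th → ¬thick-redX {inj₁ X̂} {inj₁ X̂} (λ {x} {x′} → pick-yes (nearX? x x′)) th th)

    tY≡0 : t (inj₁ Ŷ) ≡ 0
    tY≡0 = ¬thick⇒0 {inj₁ Ŷ} (λ th → ¬thick-redY {inj₁ Ŷ} {inj₁ Ŷ} (λ {_} {_} {y} {y′} → pick-yes (nearY? y y′)) th th)

    no-circles : ∀ {b} → Thick (inj₁ b) → ∑ (allFin k) circle-sum ≡ 0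
    no-circles {b} th = ∑-zero (allFin k) circle-sum (λ {i} _ → ∑-zero (upTo N) _ (λ {p} _ →
      ¬thick⇒0 {inj₂ (i , p)} (¬thick-redY {inj₁ b} {inj₂ (i , p)} redY-mixed th)))

    -- X and Y contain red pairs in any two large subsets and are never thick. Of Z₁, Z₂ and the
    -- circles each excludes the other two, and they offer s, s and s + 1 labels.
    thick-≤ : ∑ labels t ≤ suc s
    thick-≤ = ≤-trans (≤-reflexive (trans (∑-labels t) (cong (_+ ∑ (allFin k) circle-sum)
        (trans (∑-pieces (t ∘ inj₁)) (trans (cong₂ (λ u v → a * u + (a * v + (s * t₁ + s * t₂))) tX≡0 tY≡0) (eq a (s * t₁) (s * t₂)))))))
      (cases (thick? (inj₁ Ẑ₁)) (thick? (inj₁ Ẑ₂)))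
      where
      t₁ = t (inj₁ Ẑ₁)
      t₂ = t (inj₁ Ẑ₂)
      C′ = ∑ (allFin k) circle-sum
      eq : ∀ a b c → a * 0 + (a * 0 + (b + c)) ≡ b + c
      eq = solve-∀
      s≥ : ∀ l → s * t l ≤ s
      s≥ l = ≤-trans (*-monoʳ-≤ s (t≤1 l)) (≤-reflexive (*-identityʳ s))
      zeros : ∀ b → ¬ Thick (inj₁ b) → s * t (inj₁ b) ≡ 0
      zeros b ¬th = trans (cong (s *_) (¬thick⇒0 {inj₁ b} ¬th)) (*-zeroʳ s)
      cases : Dec (Thick (inj₁ Ẑ₁)) → Dec (Thick (inj₁ Ẑ₂)) → s * t₁ + s * t₂ + C′ ≤ suc s
      cases (yes th₁) _ = ≤-trans (≤-reflexive (trans (cong₂ (λ u v → s * t₁ + u + v)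
          (zeros Ẑ₂ (¬thick-redY {inj₁ Ẑ₁} {inj₁ Ẑ₂} redY-mixed th₁)) (no-circles th₁)) (trans (+-identityʳ _) (+-identityʳ _))))
        (≤-trans (s≥ (inj₁ Ẑ₁)) (n≤1+n s))
      cases (no ¬th₁) (yes th₂) = ≤-trans (≤-reflexive (trans (cong₂ (λ u v → u + s * t₂ + v)
          (zeros Ẑ₁ ¬th₁) (no-circles th₂)) (+-identityʳ _)))
        (≤-trans (s≥ (inj₁ Ẑ₂)) (n≤1+n s))
      cases (no ¬th₁) (no ¬th₂) = ≤-trans (≤-reflexive (cong₂ (λ u v → u + v + C′) (zeros Ẑ₁ ¬th₁) (zeros Ẑ₂ ¬th₂))) thick-circles

    count≤n : ∀ l → count l ≤ n
    count≤n l = ≤-trans (∑-mono Ω (λ xy → ind≤1 (member? _≟ᶜ_ (l , xy) I))) (≤-reflexive (trans (sym (length-∑ Ω)) length-Ω))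

    independent-≤ : 2 * sizeIn _≟ᶜ_ cells I ≤ (2 * suc s + 1) * n
    independent-≤ = *-cancelˡ-≤ L {{>-nonZero L≥1}} (begin
      L * (2 * sizeIn _≟ᶜ_ cells I)
        ≡⟨ cong (λ z → L * (2 * z)) (∑-cells _) ⟩
      L * (2 * ∑ labels count)
        ≡⟨ trans (eq₁ L (∑ labels count)) (sym (∑-*ˡ labels (2 * L) count)) ⟩
      ∑ labels (λ l → 2 * L * count l)
        ≤⟨ ∑-mono labels (λ l → split l (thick? l)) ⟩
      ∑ labels (λ l → 2 * L * n * t l + n)
        ≡⟨ trans (∑-+ labels (λ l → 2 * L * n * t l) (λ _ → n)) (cong₂ _+_ (∑-*ˡ labels (2 * L * n) t) (trans (∑-const labels n) (cong (_* n) length-labels))) ⟩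
      2 * L * n * ∑ labels t + L * n
        ≤⟨ +-monoˡ-≤ (L * n) (*-monoʳ-≤ (2 * L * n) thick-≤) ⟩
      2 * L * n * suc s + L * n
        ≡⟨ eq₂ L n (suc s) ⟩
      L * ((2 * suc s + 1) * n) ∎)
      where
      open ≤-Reasoning
      eq₁ : ∀ L c → L * (2 * c) ≡ 2 * L * c
      eq₁ = solve-∀
      eq₂ : ∀ L n s → 2 * L * n * s + L * n ≡ L * ((2 * s + 1) * n)
      eq₂ = solve-∀
      split : ∀ l (d : Dec (Thick l)) → 2 * L * count l ≤ 2 * L * n * ind d + n
      split l (yes _) = ≤-trans (*-monoʳ-≤ (2 * L) (count≤n l)) (≤-trans (≤-reflexive (sym (*-identityʳ (2 * L * n)))) (m≤m+n _ n))
      split l (no ¬p) = ≤-trans (<⇒≤ (≰⇒> ¬p)) (m≤n+m n _)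

-- Purple density

purple# : Colour → ℕ
purple# c = if isPurple c then 1 else 0

module PurplePairs {L E : ℕ} (g : Geometry L E) (k N s lo hi : ℕ)
  (lo+hi≡N : lo + hi ≡ N) (hi≡lo+s : hi ≡ lo + s) (3s<N : 3 * s < N)
  (a : ℕ) (L≡ : L ≡ 2 * a + 2 * s + k * N) (L≥1 : 1 ≤ L) where

  open Weighted g k N s lo hi lo+hi≡N hi≡lo+s 3s<N a L≡ L≥1 public

  between : Label → Label → ℕ
  between l l′ = ∑ Ω (λ xy → ∑ Ω (λ xy′ → purple# (col (l , xy) (l′ , xy′))))

  -- Twice the limiting purple density between two labels.
  coreDensity : Piece → Piece → ℕ
  coreDensity X̂  X̂  = 0
  coreDensity X̂  Ŷ  = 1
  coreDensity X̂  Ẑ₁ = 2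
  coreDensity X̂  Ẑ₂ = 0
  coreDensity Ŷ  X̂  = 1
  coreDensity Ŷ  Ŷ  = 0
  coreDensity Ŷ  Ẑ₁ = 0
  coreDensity Ŷ  Ẑ₂ = 2
  coreDensity Ẑ₁ X̂  = 2
  coreDensity Ẑ₁ Ŷ  = 0
  coreDensity Ẑ₁ Ẑ₁ = 0
  coreDensity Ẑ₁ Ẑ₂ = 2
  coreDensity Ẑ₂ X̂  = 0
  coreDensity Ẑ₂ Ŷ  = 2
  coreDensity Ẑ₂ Ẑ₁ = 2
  coreDensity Ẑ₂ Ẑ₂ = 0

  circlesDensity : ∀ {i j : Fin k} → Dec (i ≡ j) → ℕ → ℕ → ℕ
  circlesDensity (yes _) p p′ = 2 * ind (opposite? p p′)
  circlesDensity (no _)  p p′ = 2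

  density : Label → Label → ℕ
  density (inj₁ b)       (inj₁ b′)       = coreDensity b b′
  density (inj₁ _)       (inj₂ _)        = 2
  density (inj₂ _)       (inj₁ _)        = 2
  density (inj₂ (i , p)) (inj₂ (j , p′)) = circlesDensity (i Fin.≟ j) p p′

  -- Both `aligned-few` and `cross-half` average over a single point of Y. With `x`, `y`, `x′` held
  -- fixed their relative error passes unchanged to all pairs of cells.
  fibre : ∀ l l′ D → (∀ x y x′ → D * (E * length Ωy) ≤ 2 * E * ∑ Ωy (λ y′ → purple# (col (l , x , y) (l′ , x′ , y′))) + 2 * length Ωy) →
    D * (E * (n * n)) ≤ 2 * E * between l l′ + 2 * (n * n)
  fibre l l′ D fib = begin
    D * (E * (n * n))
      ≡⟨ eq₁ D E (length Ωx) (length Ωy) ⟩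
    length Ωx * (length Ωy * (length Ωx * (D * (E * length Ωy))))
      ≡⟨ triple (D * (E * length Ωy)) ⟨
    ∑ Ωx (λ x → ∑ Ωy (λ y → ∑ Ωx (λ x′ → D * (E * length Ωy))))
      ≤⟨ ∑-mono Ωx (λ x → ∑-mono Ωy (λ y → ∑-mono Ωx (λ x′ → fib x y x′))) ⟩
    ∑ Ωx (λ x → ∑ Ωy (λ y → ∑ Ωx (λ x′ → 2 * E * F x y x′ + 2 * length Ωy)))
      ≡⟨ ∑-cong Ωx (λ x → trans (∑-cong Ωy (λ y → ∑-+ Ωx _ _)) (∑-+ Ωy _ _)) ⟩
    ∑ Ωx (λ x → ∑ Ωy (λ y → ∑ Ωx (λ x′ → 2 * E * F x y x′)) + ∑ Ωy (λ y → ∑ Ωx (λ x′ → 2 * length Ωy)))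
      ≡⟨ ∑-+ Ωx _ _ ⟩
    ∑ Ωx (λ x → ∑ Ωy (λ y → ∑ Ωx (λ x′ → 2 * E * F x y x′))) + ∑ Ωx (λ x → ∑ Ωy (λ y → ∑ Ωx (λ x′ → 2 * length Ωy)))
      ≡⟨ cong₂ _+_ pull (trans (triple (2 * length Ωy)) (eq₂ (length Ωx) (length Ωy))) ⟩
    2 * E * between l l′ + 2 * (n * n) ∎
    where
    open ≤-Reasoning
    F : X → Y → X → ℕ
    F x y x′ = ∑ Ωy (λ y′ → purple# (col (l , x , y) (l′ , x′ , y′)))
    triple : ∀ c → ∑ Ωx (λ x → ∑ Ωy (λ y → ∑ Ωx (λ x′ → c))) ≡ length Ωx * (length Ωy * (length Ωx * c))
    triple c = trans (∑-const Ωx _) (cong (length Ωx *_) (trans (∑-const Ωy _) (cong (length Ωy *_) (∑-const Ωx c))))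
    pull : ∑ Ωx (λ x → ∑ Ωy (λ y → ∑ Ωx (λ x′ → 2 * E * F x y x′))) ≡ 2 * E * between l l′
    pull = trans (∑-cong Ωx (λ x → trans (∑-cong Ωy (λ y → trans (∑-*ˡ Ωx (2 * E) (F x y)) (cong (2 * E *_) (sym (∑-Ω (λ xy′ → purple# (col (l , x , y) (l′ , xy′))))))))
        (∑-*ˡ Ωy (2 * E) _)))
      (trans (∑-*ˡ Ωx (2 * E) _) (cong (2 * E *_) (sym (∑-Ω _))))
    eq₁ : ∀ D E p q → D * (E * ((p * q) * (p * q))) ≡ p * (q * (p * (D * (E * q))))
    eq₁ = solve-∀
    eq₂ : ∀ p q → p * (q * (p * (2 * q))) ≡ 2 * ((p * q) * (p * q))
    eq₂ = solve-∀

  Bad : Y → Y → Set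
  Bad y y′ = nearY y y′ ⊎ closeY y y′

  fibre-full : ∀ y (f : Y → Colour) → (∀ y′ → ¬ Bad y y′ → f y′ ≡ purple) →
    2 * (E * length Ωy) ≤ 2 * E * ∑ Ωy (λ y′ → purple# (f y′)) + 2 * length Ωy
  fibre-full y f good = ≤-trans (*-monoʳ-≤ 2 (begin
    E * length Ωy                                                     ≡⟨ cong (E *_) (length-∑ Ωy) ⟩
    E * ∑ Ωy (λ _ → 1)                                                ≤⟨ *-monoʳ-≤ E (∑-mono Ωy (λ y′ → one y′ (nearY? y y′ ⊎-dec closeY? y y′))) ⟩
    E * ∑ Ωy (λ y′ → purple# (f y′) + bad y′)                         ≡⟨ trans (cong (E *_) (∑-+ Ωy _ bad)) (*-distribˡ-+ E _ _) ⟩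
    E * ∑ Ωy (λ y′ → purple# (f y′)) + E * ∑ Ωy bad                   ≤⟨ +-monoʳ-≤ _ (aligned-few y) ⟩
    E * ∑ Ωy (λ y′ → purple# (f y′)) + length Ωy                      ∎)) (≤-reflexive (eq E (∑ Ωy (λ y′ → purple# (f y′))) (length Ωy)))
    where
    open ≤-Reasoning
    bad : Y → ℕ
    bad y′ = ind (nearY? y y′ ⊎-dec closeY? y y′)
    one : ∀ y′ (d : Dec (Bad y y′)) → 1 ≤ purple# (f y′) + ind d
    one y′ (yes _) = m≤n+m 1 _
    one y′ (no ¬b) rewrite good y′ ¬b = s≤s z≤n
    eq : ∀ E p m → 2 * (E * p + m) ≡ 2 * E * p + 2 * m
    eq = solve-∀

  mixed-purple : ∀ y y′ → ¬ Bad y y′ → mixed y y′ ≡ purple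
  mixed-purple y y′ ¬bad = pick-no (nearY? y y′) (¬bad ∘ inj₁)

  circle-purple : ∀ p p′ y y′ → Opposite p p′ → ¬ Bad y y′ → circle p p′ y y′ ≡ purple
  circle-purple p p′ y y′ opp ¬bad = trans
    (pick-no (nearY? y y′ ×-dec apart? p p′) (λ (near , _) → ¬bad (inj₁ near)))
    (pick-yes (opposite? p p′ ×-dec ¬? (closeY? y y′)) (opp , ¬bad ∘ inj₂))

  between-sym : ∀ l l′ → between l l′ ≡ between l′ l
  between-sym l l′ = trans (∑-swap Ω Ω _) (∑-cong Ω (λ xy → ∑-cong Ω (λ xy′ → cong purple# (col-sym (l , xy′) (l′ , xy)))))

  Dense : ℕ → Label → Label → Set
  Dense D l l′ = D * (E * (n * n)) ≤ 2 * E * between l l′ + 2 * (n * n)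

  dense-full : ∀ l l′ → (∀ x y x′ y′ → ¬ Bad y y′ → col (l , x , y) (l′ , x′ , y′) ≡ purple) → Dense 2 l l′
  dense-full l l′ full = fibre l l′ 2 (λ x y x′ → fibre-full y (λ y′ → col (l , x , y) (l′ , x′ , y′)) (λ y′ → full x y x′ y′))

  dense-XY : Dense 1 (inj₁ X̂) (inj₁ Ŷ)
  dense-XY = fibre (inj₁ X̂) (inj₁ Ŷ) 1 (λ x y x′ → ≤-trans (≤-reflexive (+-identityʳ _))
    (≤-trans (cross-half x) (+-mono-≤ (≤-reflexive (cong (2 * E *_) (∑-cong Ωy (λ y′ → sym (purple#-pick (cross? x y′)))))) (m≤m+n _ _))))
    where
    purple#-pick : {P : Set} (p : Dec P) → purple# (pick p purple blue) ≡ ind p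
    purple#-pick (yes _) = refl
    purple#-pick (no _)  = refl

  dense : ∀ l l′ → Dense (density l l′) l l′
  dense (inj₁ X̂)  (inj₁ X̂)  = z≤n
  dense (inj₁ X̂)  (inj₁ Ŷ)  = dense-XY
  dense (inj₁ X̂)  (inj₁ Ẑ₁) = dense-full (inj₁ X̂) (inj₁ Ẑ₁) (λ _ _ _ _ _ → refl)
  dense (inj₁ X̂)  (inj₁ Ẑ₂) = z≤n
  dense (inj₁ Ŷ)  (inj₁ X̂)  = subst (λ z → 1 * (E * (n * n)) ≤ 2 * E * z + 2 * (n * n)) (between-sym (inj₁ X̂) (inj₁ Ŷ)) dense-XY
  dense (inj₁ Ŷ)  (inj₁ Ŷ)  = z≤n
  dense (inj₁ Ŷ)  (inj₁ Ẑ₁) = z≤n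
  dense (inj₁ Ŷ)  (inj₁ Ẑ₂) = dense-full (inj₁ Ŷ) (inj₁ Ẑ₂) (λ _ _ _ _ _ → refl)
  dense (inj₁ Ẑ₁) (inj₁ X̂)  = dense-full (inj₁ Ẑ₁) (inj₁ X̂) (λ _ _ _ _ _ → refl)
  dense (inj₁ Ẑ₁) (inj₁ Ŷ)  = z≤n
  dense (inj₁ Ẑ₁) (inj₁ Ẑ₁) = z≤n
  dense (inj₁ Ẑ₁) (inj₁ Ẑ₂) = dense-full (inj₁ Ẑ₁) (inj₁ Ẑ₂) (λ _ y _ y′ → mixed-purple y y′)
  dense (inj₁ Ẑ₂) (inj₁ X̂)  = z≤n
  dense (inj₁ Ẑ₂) (inj₁ Ŷ)  = dense-full (inj₁ Ẑ₂) (inj₁ Ŷ) (λ _ _ _ _ _ → refl)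
  dense (inj₁ Ẑ₂) (inj₁ Ẑ₁) = dense-full (inj₁ Ẑ₂) (inj₁ Ẑ₁) (λ _ y _ y′ → mixed-purple y y′)
  dense (inj₁ Ẑ₂) (inj₁ Ẑ₂) = z≤n
  dense (inj₁ b)  (inj₂ c)  = dense-full (inj₁ b) (inj₂ c) (λ _ y _ y′ → mixed-purple y y′)
  dense (inj₂ c)  (inj₁ b)  = dense-full (inj₂ c) (inj₁ b) (λ _ y _ y′ → mixed-purple y y′)
  dense (inj₂ (i , p)) (inj₂ (j , p′)) = go (i Fin.≟ j) refl
    where
    -- The equation is kept because `between` still mentions the undecided `i Fin.≟ j`, which must
    -- be rewritten to the outcome.
    go : (d : Dec (i ≡ j)) → (i Fin.≟ j) ≡ d →
         Dense (circlesDensity d p p′) (inj₂ (i , p)) (inj₂ (j , p′))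
    go (no _) eq = dense-full (inj₂ (i , p)) (inj₂ (j , p′)) (λ x y x′ y′ ¬bad →
      trans (cong (λ d → circles d p p′ y y′) eq) (mixed-purple y y′ ¬bad))
    go (yes _) eq = same (opposite? p p′)
      where
      same : (o : Dec (Opposite p p′)) → Dense (2 * ind o) (inj₂ (i , p)) (inj₂ (j , p′))
      same (no _)    = z≤n
      same (yes opp) = dense-full (inj₂ (i , p)) (inj₂ (j , p′)) (λ x y x′ y′ ¬bad →
        trans (cong (λ d → circles d p p′ y y′) eq) (circle-purple p p′ y y′ opp ¬bad))

  purplePairs : ℕ
  purplePairs = ∑ cells (λ u → ∑ cells (λ v → purple# (col u v)))

  totalDensity : ℕ
  totalDensity = ∑ labels (λ l → ∑ labels (density l))

  purplePairs-≥ : totalDensity * (E * (n * n)) ≤ 2 * E * purplePairs + 2 * (n * n) * (L * L)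
  purplePairs-≥ = begin
    totalDensity * (E * (n * n))
      ≡⟨ trans (sym (∑-*ʳ labels (E * (n * n)) _)) (∑-cong labels (λ l → sym (∑-*ʳ labels (E * (n * n)) _))) ⟩
    ∑ labels (λ l → ∑ labels (λ l′ → density l l′ * (E * (n * n))))
      ≤⟨ ∑-mono labels (λ l → ∑-mono labels (λ l′ → dense l l′)) ⟩
    ∑ labels (λ l → ∑ labels (λ l′ → 2 * E * between l l′ + 2 * (n * n)))
      ≡⟨ trans (∑-cong labels (λ l → trans (∑-+ labels _ _) (cong₂ _+_ (∑-*ˡ labels (2 * E) (between l)) (∑-const labels (2 * (n * n)))))) (∑-+ labels _ _) ⟩
    ∑ labels (λ l → 2 * E * ∑ labels (between l)) + ∑ labels (λ _ → length labels * (2 * (n * n)))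
      ≡⟨ cong₂ _+_ (trans (∑-*ˡ labels (2 * E) _) (cong (2 * E *_) expand)) (trans (∑-const labels _) (trans (cong (λ m → m * (m * (2 * (n * n)))) length-labels) (eq L (2 * (n * n))))) ⟩
    2 * E * purplePairs + 2 * (n * n) * (L * L) ∎
    where
    open ≤-Reasoning
    eq : ∀ L m → L * (L * m) ≡ m * (L * L)
    eq = solve-∀
    expand : ∑ labels (λ l → ∑ labels (between l)) ≡ purplePairs
    expand = sym (trans (∑-cells _) (∑-cong labels (λ l → trans (∑-cong Ω (λ xy → ∑-cells _)) (∑-swap Ω labels _))))

  circleDensity : Fin k → ℕ → ℕ
  circleDensity i p = ∑ (allFin k) (λ j → ∑ (upTo N) (λ p′ → density (inj₂ (i , p)) (inj₂ (j , p′))))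

  -- The other circles contribute 2N each, but the circle of `p` itself only 2 for each of at least
  -- s + 1 opposite positions. Its missing 2N stands on the right to avoid a subtraction.
  circleDensity-≥ : ∀ i p → p < N → k * (2 * N) + 2 * suc s ≤ circleDensity i p + 2 * N
  circleDensity-≥ i p p<N = begin
    k * (2 * N) + 2 * suc s
      ≤⟨ +-monoʳ-≤ (k * (2 * N)) (*-monoʳ-≤ 2 (opposite-many p p<N)) ⟩
    k * (2 * N) + 2 * o
      ≡⟨ cong₂ _+_ (trans (cong (_* (2 * N)) (sym (length-allFin k))) (sym (∑-const (allFin k) (2 * N))))
           (trans (sym (*-identityˡ (2 * o))) (cong (_* (2 * o)) (sym (∑-ind-≟ i)))) ⟩
    ∑ (allFin k) (λ _ → 2 * N) + ∑ (allFin k) (λ j → ind (i Fin.≟ j)) * (2 * o)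
      ≡⟨ trans (cong (∑ (allFin k) (λ _ → 2 * N) +_) (sym (∑-*ʳ (allFin k) (2 * o) _))) (sym (∑-+ (allFin k) _ _)) ⟩
    ∑ (allFin k) (λ j → 2 * N + ind (i Fin.≟ j) * (2 * o))
      ≡⟨ ∑-cong (allFin k) (λ j → exchange (i Fin.≟ j)) ⟩
    ∑ (allFin k) (λ j → ∑ (upTo N) (λ p′ → circlesDensity (i Fin.≟ j) p p′) + ind (i Fin.≟ j) * (2 * N))
      ≡⟨ trans (∑-+ (allFin k) _ _) (cong (circleDensity i p +_) (trans (∑-*ʳ (allFin k) (2 * N) _) (trans (cong (_* (2 * N)) (∑-ind-≟ i)) (*-identityˡ (2 * N))))) ⟩
    circleDensity i p + 2 * N ∎
    where
    open ≤-Reasoning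
    o = ∑ (upTo N) (λ p′ → ind (opposite? p p′))
    exchange : ∀ {j} (d : Dec (i ≡ j)) → 2 * N + ind d * (2 * o) ≡ ∑ (upTo N) (λ p′ → circlesDensity d p p′) + ind d * (2 * N)
    exchange (yes _) = trans (cong (2 * N +_) (*-identityˡ (2 * o))) (trans (+-comm (2 * N) (2 * o))
      (cong₂ _+_ (sym (∑-*ˡ (upTo N) 2 _)) (sym (*-identityˡ (2 * N)))))
    exchange (no _) = cong (_+ 0) (trans (*-comm 2 N) (trans (cong (_* 2) (sym length-positions)) (sym (∑-const (upTo N) 2))))

  -- With every pair counted in both orders and densities doubled: 2a² is X-Y, 8as is X-Z₁ and Y-Z₂,
  -- 4s² is Z₁-Z₂, and the term in (a + s)kN joins these pieces to the circles. The last summand on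
  -- each side corrects for pairs within one circle.
  totalDensity-≥ : 2 * (a * a) + 8 * (a * s) + 4 * (s * s) + 8 * ((a + s) * (k * N)) + 2 * (k * N * (k * N)) + 2 * (k * N * suc s)
                 ≤ totalDensity + 2 * (k * (N * N))
  totalDensity-≥ = begin
    2 * (a * a) + 8 * (a * s) + 4 * (s * s) + 8 * ((a + s) * (k * N)) + 2 * (k * N * (k * N)) + 2 * (k * N * suc s)
      ≡⟨ eq a s k N ⟩
    W + k * (N * (c + (k * (2 * N) + 2 * suc s)))
      ≤⟨ +-monoʳ-≤ W (≤-trans (≤-reflexive (sym (double (c + (k * (2 * N) + 2 * suc s)))))
           (∑-mono (allFin k) (λ i → ∑-mono-∈ (upTo N) (λ p p∈ → +-monoʳ-≤ c (circleDensity-≥ i p (∈-upTo⁻ p∈)))))) ⟩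
    W + ∑ (allFin k) (λ i → ∑ (upTo N) (λ p → c + (circleDensity i p + 2 * N)))
      ≡⟨ cong (W +_) (trans (∑-cong (allFin k) (λ i → trans (∑-cong (upTo N) (λ p → sym (+-assoc c (circleDensity i p) (2 * N)))) (∑-+ (upTo N) _ _))) (∑-+ (allFin k) _ _)) ⟩
    W + (V + ∑ (allFin k) (λ i → ∑ (upTo N) (λ p → 2 * N)))
      ≡⟨ trans (cong (λ z → W + (V + z)) (trans (double (2 * N)) (eq′ k N))) (sym (+-assoc W V (2 * (k * (N * N))))) ⟩
    W + V + 2 * (k * (N * N))
      ≡⟨ cong (_+ 2 * (k * (N * N))) (sym total) ⟩
    totalDensity + 2 * (k * (N * N)) ∎
    where
    open ≤-Reasoning
    c = 4 * a + 4 * s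
    X-row = a + 2 * s + k * (N * 2)
    Z-row = 2 * a + 2 * s + k * (N * 2)
    W = a * X-row + (a * X-row + (s * Z-row + s * Z-row))
    V = ∑ (allFin k) (λ i → ∑ (upTo N) (λ p → c + circleDensity i p))
    double : ∀ z → ∑ (allFin k) (λ i → ∑ (upTo N) (λ p → z)) ≡ k * (N * z)
    double z = trans (∑-const (allFin k) _) (cong₂ _*_ (length-allFin k) (trans (∑-const (upTo N) z) (cong (_* z) length-positions)))
    eq′ : ∀ k N → k * (N * (2 * N)) ≡ 2 * (k * (N * N))
    eq′ = solve-∀
    eq : ∀ a s k N → 2 * (a * a) + 8 * (a * s) + 4 * (s * s) + 8 * ((a + s) * (k * N)) + 2 * (k * N * (k * N)) + 2 * (k * N * suc s)
      ≡ a * (a + 2 * s + k * (N * 2)) + (a * (a + 2 * s + k * (N * 2)) + (s * (2 * a + 2 * s + k * (N * 2)) + s * (2 * a + 2 * s + k * (N * 2))))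
        + k * (N * (4 * a + 4 * s + (k * (2 * N) + 2 * suc s)))
    eq = solve-∀
    row : Piece → ℕ
    row b = ∑ labels (density (inj₁ b))
    row-eq : ∀ b {z} → a * coreDensity b X̂ + (a * coreDensity b Ŷ + (s * coreDensity b Ẑ₁ + s * coreDensity b Ẑ₂)) ≡ z → row b ≡ z + k * (N * 2)
    row-eq b eqz = trans (∑-labels (density (inj₁ b))) (cong₂ _+_ (trans (∑-pieces (coreDensity b)) eqz) (double 2))
    eqX : ∀ a s → a * 0 + (a * 1 + (s * 2 + s * 0)) ≡ a + 2 * s
    eqX = solve-∀
    eqY : ∀ a s → a * 1 + (a * 0 + (s * 0 + s * 2)) ≡ a + 2 * s
    eqY = solve-∀
    eqZ₁ : ∀ a s → a * 2 + (a * 0 + (s * 0 + s * 2)) ≡ 2 * a + 2 * s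
    eqZ₁ = solve-∀
    eqZ₂ : ∀ a s → a * 0 + (a * 2 + (s * 2 + s * 0)) ≡ 2 * a + 2 * s
    eqZ₂ = solve-∀
    eqc : ∀ a s → a * 2 + (a * 2 + (s * 2 + s * 2)) ≡ 4 * a + 4 * s
    eqc = solve-∀
    total : totalDensity ≡ W + V
    total = trans (∑-labels _) (cong₂ _+_
      (trans (∑-pieces row) (cong₂ _+_ (cong (a *_) (row-eq X̂ (eqX a s))) (cong₂ _+_ (cong (a *_) (row-eq Ŷ (eqY a s)))
        (cong₂ _+_ (cong (s *_) (row-eq Ẑ₁ (eqZ₁ a s))) (cong (s *_) (row-eq Ẑ₂ (eqZ₂ a s)))))))
      (∑-cong (allFin k) (λ i → ∑-cong (upTo N) (λ p → trans (∑-labels _)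
        (cong (_+ circleDensity i p) (trans (∑-pieces _) (eqc a s)))))))

-- A finite colouring whose blow-ups prove the theorem for ℓ = k + 2 and c = p / q, up to an error 2 / E;
-- the last field is  purple / W² ≥ (3k + 1) / (3k + 4) + c − c² − 2 / E  with denominators cleared.
record Pattern (k p q E : ℕ) : Set₁ where
  field
    Cell         : Set
    _≟ᶜ_         : DecidableEquality Cell
    cells        : List Cell
    col          : Cell → Cell → Colour
    col-sym      : ∀ u v → col u v ≡ col v u
    col-diagonal : ∀ u → col u u ≡ blue
    cells≥1      : 1 ≤ length cells
    clique-≤     : ∀ cs → AllPairs (λ u v → InRP (col u v)) cs → length cs ≤ 3 + 2 * k
    independent-< : ∀ I → (∀ {u v} → u ∈ I → v ∈ I → col u v ≢ red) → q * sizeIn _≟ᶜ_ cells I < p * length cells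
  W : ℕ
  W = length cells
  purplePairs : ℕ
  purplePairs = ∑ cells (λ u → ∑ cells (λ v → purple# (col u v)))
  field
    purplePairs-≥ : W * W * E * ((3 * k + 1) * (q * q) + (3 * k + 4) * (p * q))
      ≤ (3 * k + 4) * (q * q) * (E * purplePairs) + W * W * E * ((3 * k + 4) * (p * p)) + 2 * (W * W) * ((3 * k + 4) * (q * q))

-- The identity 2a² + 8as + 4s² = 2(a + s)(a + 3s) - 2s² separates the term that becomes -c².
-- Everything else is linear in s once a + s = 2u is inserted.
halve-density : ∀ k u s a N E n P T → a + s ≡ 2 * u → N ≡ 3 * u →
  2 * (a * a) + 8 * (a * s) + 4 * (s * s) + 8 * ((a + s) * (k * N)) + 2 * (k * N * (k * N)) + 2 * (k * N * suc s) ≤ T + 2 * (k * (N * N)) →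
  T * (E * (n * n)) ≤ 2 * E * P + 2 * (n * n) * ((3 * k + 4) * u * ((3 * k + 4) * u)) →
  E * (n * n) * ((3 * k + 4) * (3 * k + 1) * (u * u) + (3 * k + 4) * (u * s))
    ≤ E * (n * n) * (s * s) + E * P + (n * n) * ((3 * k + 4) * u * ((3 * k + 4) * u))
halve-density k u s a N E n P T a+s≡2u refl T-≥ P-≥ = *-cancelˡ-≤ 2 (begin
  2 * (E * (n * n) * main)                                              ≡⟨ eq₁ (E * (n * n)) main ⟩
  2 * main * (E * (n * n))                                              ≤⟨ *-monoˡ-≤ (E * (n * n)) main≤ ⟩
  (T + 2 * (s * s)) * (E * (n * n))                                     ≡⟨ *-distribʳ-+ (E * (n * n)) T (2 * (s * s)) ⟩
  T * (E * (n * n)) + 2 * (s * s) * (E * (n * n))                       ≤⟨ +-monoˡ-≤ _ P-≥ ⟩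
  2 * E * P + 2 * (n * n) * Λ + 2 * (s * s) * (E * (n * n))             ≡⟨ eq₂ E P (n * n) Λ (s * s) ⟩
  2 * (E * (n * n) * (s * s) + E * P + n * n * Λ)                       ∎)
  where
  open ≤-Reasoning
  main = (3 * k + 4) * (3 * k + 1) * (u * u) + (3 * k + 4) * (u * s)
  Λ = (3 * k + 4) * u * ((3 * k + 4) * u)
  eq₁ : ∀ e m → 2 * (e * m) ≡ 2 * m * e
  eq₁ = solve-∀
  eq₂ : ∀ E P n Λ s → 2 * E * P + 2 * n * Λ + 2 * s * (E * n) ≡ 2 * (E * n * s + E * P + n * Λ)
  eq₂ = solve-∀
  eq₃ : ∀ k u s → 2 * ((3 * k + 4) * (3 * k + 1) * (u * u) + (3 * k + 4) * (u * s)) + 2 * (k * (3 * u * (3 * u))) + 6 * (k * u)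
      ≡ 2 * ((2 * u) * (2 * u + 2 * s)) + 8 * (2 * u * (k * (3 * u))) + 2 * (k * (3 * u) * (k * (3 * u))) + 2 * (k * (3 * u) * suc s)
  eq₃ = solve-∀
  eq₄ : ∀ a s K K′ K″ → 2 * ((a + s) * (a + s + 2 * s)) + K + K′ + K″
      ≡ (2 * (a * a) + 8 * (a * s) + 4 * (s * s) + K + K′ + K″) + 2 * (s * s)
  eq₄ = solve-∀
  eq₅ : ∀ T a b → T + a + b ≡ T + b + a
  eq₅ = solve-∀
  main≤ : 2 * main ≤ T + 2 * (s * s)
  main≤ = +-cancelʳ-≤ (2 * (k * (3 * u * (3 * u)))) _ _ (begin
    2 * main + 2 * (k * (3 * u * (3 * u)))
      -- The slack 6ku comes from the s + 1 opposite positions, of which only s are needed.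
      ≤⟨ m≤m+n _ (6 * (k * u)) ⟩
    2 * main + 2 * (k * (3 * u * (3 * u))) + 6 * (k * u)
      ≡⟨ eq₃ k u s ⟩
    2 * ((2 * u) * (2 * u + 2 * s)) + 8 * (2 * u * (k * (3 * u))) + 2 * (k * (3 * u) * (k * (3 * u))) + 2 * (k * (3 * u) * suc s)
      ≡⟨ cong (λ z → 2 * (z * (z + 2 * s)) + 8 * (z * (k * (3 * u))) + 2 * (k * (3 * u) * (k * (3 * u))) + 2 * (k * (3 * u) * suc s)) (sym a+s≡2u) ⟩
    2 * ((a + s) * (a + s + 2 * s)) + 8 * ((a + s) * (k * (3 * u))) + 2 * (k * (3 * u) * (k * (3 * u))) + 2 * (k * (3 * u) * suc s)
      ≡⟨ eq₄ a s (8 * ((a + s) * (k * (3 * u)))) (2 * (k * (3 * u) * (k * (3 * u)))) (2 * (k * (3 * u) * suc s)) ⟩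
    _ ≤⟨ +-monoˡ-≤ (2 * (s * s)) T-≥ ⟩
    T + 2 * (k * (3 * u * (3 * u))) + 2 * (s * s)
      ≡⟨ eq₅ T _ _ ⟩
    T + 2 * (s * s) + 2 * (k * (3 * u * (3 * u))) ∎)

-- Here s / (A u) = c − 2 / (A u); replacing it by c costs at most 2 / (A u) ≤ 1 / E.
clear-denominators : ∀ A B u s E n P p q → A * p * u ≡ q * (s + 2) → 2 * E ≤ A * u →
  E * (n * n) * (A * B * (u * u) + A * (u * s)) ≤ E * (n * n) * (s * s) + E * P + n * n * (A * u * (A * u)) →
  A * u * n * (A * u * n) * E * (B * (q * q) + A * (p * q))
    ≤ A * (q * q) * (E * P) + A * u * n * (A * u * n) * E * (A * (p * p)) + 2 * (A * u * n * (A * u * n)) * (A * (q * q))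
clear-denominators A B u s E n P p q Apu≡ 2E≤Au bound = begin
  A * u * n * (A * u * n) * E * (B * (q * q) + A * (p * q))
    ≡⟨ eq₁ A B u E n p q ⟩
  A * (q * q) * (E * (n * n) * (A * B * (u * u))) + A * A * u * (n * n) * E * q * (A * p * u)
    ≡⟨ cong (λ z → A * (q * q) * (E * (n * n) * (A * B * (u * u))) + A * A * u * (n * n) * E * q * z) Apu≡ ⟩
  A * (q * q) * (E * (n * n) * (A * B * (u * u))) + A * A * u * (n * n) * E * q * (q * (s + 2))
    ≡⟨ eq₂ A B u s E n q ⟩
  A * (q * q) * (E * (n * n) * (A * B * (u * u) + A * (u * s))) + A * A * u * (n * n) * (q * q) * (2 * E)
    ≤⟨ +-mono-≤ (*-monoʳ-≤ (A * (q * q)) bound) (*-monoʳ-≤ (A * A * u * (n * n) * (q * q)) 2E≤Au) ⟩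
  A * (q * q) * (E * (n * n) * (s * s) + E * P + n * n * (A * u * (A * u))) + A * A * u * (n * n) * (q * q) * (A * u)
    ≤⟨ m≤m+n _ (A * (q * q) * (E * (n * n)) * (4 * s + 4)) ⟩
  A * (q * q) * (E * (n * n) * (s * s) + E * P + n * n * (A * u * (A * u))) + A * A * u * (n * n) * (q * q) * (A * u)
    + A * (q * q) * (E * (n * n)) * (4 * s + 4)
    ≡⟨ eq₃ A u s E n P q ⟩
  A * (q * q) * (E * P) + A * (n * n) * E * (q * (s + 2) * (q * (s + 2))) + 2 * (A * u * n * (A * u * n)) * (A * (q * q))
    ≡⟨ cong (λ z → A * (q * q) * (E * P) + A * (n * n) * E * (z * z) + 2 * (A * u * n * (A * u * n)) * (A * (q * q))) (sym Apu≡) ⟩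
  A * (q * q) * (E * P) + A * (n * n) * E * (A * p * u * (A * p * u)) + 2 * (A * u * n * (A * u * n)) * (A * (q * q))
    ≡⟨ eq₄ A u E n P p q ⟩
  A * (q * q) * (E * P) + A * u * n * (A * u * n) * E * (A * (p * p)) + 2 * (A * u * n * (A * u * n)) * (A * (q * q)) ∎
  where
  open ≤-Reasoning
  eq₁ : ∀ A B u E n p q → A * u * n * (A * u * n) * E * (B * (q * q) + A * (p * q))
    ≡ A * (q * q) * (E * (n * n) * (A * B * (u * u))) + A * A * u * (n * n) * E * q * (A * p * u)
  eq₁ = solve-∀
  eq₂ : ∀ A B u s E n q → A * (q * q) * (E * (n * n) * (A * B * (u * u))) + A * A * u * (n * n) * E * q * (q * (s + 2))
    ≡ A * (q * q) * (E * (n * n) * (A * B * (u * u) + A * (u * s))) + A * A * u * (n * n) * (q * q) * (2 * E)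
  eq₂ = solve-∀
  eq₃ : ∀ A u s E n P q → A * (q * q) * (E * (n * n) * (s * s) + E * P + n * n * (A * u * (A * u))) + A * A * u * (n * n) * (q * q) * (A * u)
    + A * (q * q) * (E * (n * n)) * (4 * s + 4)
    ≡ A * (q * q) * (E * P) + A * (n * n) * E * (q * (s + 2) * (q * (s + 2))) + 2 * (A * u * n * (A * u * n)) * (A * (q * q))
  eq₃ = solve-∀
  eq₄ : ∀ A u E n P p q → A * (q * q) * (E * P) + A * (n * n) * E * (A * p * u * (A * p * u)) + 2 * (A * u * n * (A * u * n)) * (A * (q * q))
    ≡ A * (q * q) * (E * P) + A * u * n * (A * u * n) * E * (A * (p * p)) + 2 * (A * u * n * (A * u * n)) * (A * (q * q))
  eq₄ = solve-∀

-- Integer sizes that realise the fractions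

module Parameters (k p q E m : ℕ) (q≥1 : 1 ≤ q) (E≥1 : 1 ≤ E) (pA<q : p * (3 * k + 4) < q)
  (1+m≡ : suc m ≡ p * (3 * k + 4) * E) where

  -- The total is L = Au = 2AqE, so cL = 2ApE = s + 2. The deficit of 2 leaves room for the s + 1
  -- thick labels and the half label of thin ones. Evenness of u makes N/2 = 3qE an integer, and
  -- evenness of s centres the arc from lo to hi there.
  u s N lo hi a L : ℕ
  u = 2 * (q * E)
  s = 2 * m
  N = 3 * u
  lo = 3 * (q * E) ∸ m
  hi = 3 * (q * E) + m
  a = 2 * u ∸ s
  L = (3 * k + 4) * u

  m<qE : m < q * E
  m<qE = ≤-trans (≤-reflexive 1+m≡) (*-monoˡ-≤ E (<⇒≤ pA<q))

  m≤3qE : m ≤ 3 * (q * E)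
  m≤3qE = ≤-trans (<⇒≤ m<qE) (m≤m+n (q * E) _)

  lo+hi≡N : lo + hi ≡ N
  lo+hi≡N = trans (cong (lo +_) (+-comm (3 * (q * E)) m)) (trans (sym (+-assoc lo m _))
    (trans (cong (_+ 3 * (q * E)) (m∸n+n≡m m≤3qE)) (eq (q * E))))
    where
    eq : ∀ z → 3 * z + 3 * z ≡ 3 * (2 * z)
    eq = solve-∀

  hi≡lo+s : hi ≡ lo + s
  hi≡lo+s = trans (cong (_+ m) (sym (m∸n+n≡m m≤3qE))) (eq lo m)
    where
    eq : ∀ l m → l + m + m ≡ l + 2 * m
    eq = solve-∀

  3s<N : 3 * s < N
  3s<N = *-monoʳ-< 3 (*-monoʳ-< 2 m<qE)

  a+s≡2u : a + s ≡ 2 * u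
  a+s≡2u = m∸n+n≡m (*-monoʳ-≤ 2 (≤-trans (<⇒≤ m<qE) (m≤m+n (q * E) _)))

  L≡ : L ≡ 2 * a + 2 * s + k * N
  L≡ = trans (eq k u) (cong (_+ k * N) (trans (cong (2 *_) (sym a+s≡2u)) (*-distribˡ-+ 2 a s)))
    where
    eq : ∀ k u → (3 * k + 4) * u ≡ 2 * (2 * u) + k * (3 * u)
    eq = solve-∀

  L≥1 : 1 ≤ L
  L≥1 = *-mono-≤ (m≤n⇒m≤o+n (3 * k) (s≤s z≤n)) (*-mono-≤ {1} {2} (s≤s z≤n) (*-mono-≤ q≥1 E≥1))

  Apu≡ : (3 * k + 4) * p * u ≡ q * (s + 2)
  Apu≡ = trans (eq₁ (3 * k + 4) p q E) (trans (cong (λ z → 2 * (q * z)) (sym 1+m≡)) (eq₂ q m))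
    where
    eq₁ : ∀ A p q E → A * p * (2 * (q * E)) ≡ 2 * (q * (p * A * E))
    eq₁ = solve-∀
    eq₂ : ∀ q m → 2 * (q * suc m) ≡ q * (2 * m + 2)
    eq₂ = solve-∀

  2E≤Au : 2 * E ≤ (3 * k + 4) * u
  2E≤Au = ≤-trans (*-monoʳ-≤ 2 (≤-trans (≤-reflexive (sym (*-identityˡ E))) (*-monoˡ-≤ E q≥1)))
    (≤-trans (≤-reflexive (sym (*-identityˡ u))) (*-monoˡ-≤ u (m≤n⇒m≤o+n (3 * k) (s≤s z≤n))))

  module Build (g : Geometry L E) where

    module PP = PurplePairs g k N s lo hi lo+hi≡N hi≡lo+s 3s<N a L≡ L≥1

    n≥1 : 1 ≤ PP.n
    n≥1 = *-mono-≤ PP.Ωx≥1 PP.Ωy≥1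

    sparse : ∀ I → (∀ {u v} → u ∈ I → v ∈ I → PP.col u v ≢ red) → q * sizeIn PP._≟ᶜ_ PP.cells I < p * length PP.cells
    sparse I indep = *-cancelˡ-< 2 _ _ (begin-strict
      2 * (q * S)                       ≡⟨ eq₁ q S ⟩
      q * (2 * S)                       ≤⟨ *-monoʳ-≤ q (PP.Independent.independent-≤ I indep) ⟩
      q * ((2 * suc s + 1) * PP.n)      <⟨ *-monoʳ-< q {{>-nonZero q≥1}} (*-monoˡ-< PP.n {{>-nonZero n≥1}} (s≤s (≤-reflexive (eq₂ m)))) ⟩
      q * (4 * suc m * PP.n)            ≡⟨ cong (λ z → q * (4 * z * PP.n)) 1+m≡ ⟩
      q * (4 * (p * (3 * k + 4) * E) * PP.n)  ≡⟨ eq₃ q p (3 * k + 4) E PP.n ⟩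
      2 * (p * (L * PP.n))              ≡⟨ cong (λ z → 2 * (p * z)) PP.length-cells ⟨
      2 * (p * length PP.cells)         ∎)
      where
      open ≤-Reasoning
      S = sizeIn PP._≟ᶜ_ PP.cells I
      eq₁ : ∀ q S → 2 * (q * S) ≡ q * (2 * S)
      eq₁ = solve-∀
      eq₂ : ∀ m → 2 * suc (2 * m) + 1 ≡ m + 3 * suc m
      eq₂ = solve-∀
      eq₃ : ∀ q p A E n → q * (4 * (p * A * E) * n) ≡ 2 * (p * (A * (2 * (q * E)) * n))
      eq₃ = solve-∀

    colouring-pattern : Pattern k p q E
    colouring-pattern = record
      { Cell = PP.Cell ; _≟ᶜ_ = PP._≟ᶜ_ ; cells = PP.cells ; col = PP.col ; col-sym = PP.col-sym
      ; col-diagonal = PP.col-diagonal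
      ; cells≥1 = ≤-trans (*-mono-≤ L≥1 n≥1) (≤-reflexive (sym PP.length-cells))
      ; clique-≤ = PP.clique-≤
      ; independent-< = sparse
      ; purplePairs-≥ = subst (λ W → W * W * E * ((3 * k + 1) * (q * q) + (3 * k + 4) * (p * q))
          ≤ (3 * k + 4) * (q * q) * (E * PP.purplePairs) + W * W * E * ((3 * k + 4) * (p * p)) + 2 * (W * W) * ((3 * k + 4) * (q * q)))
          (sym PP.length-cells)
          (clear-denominators (3 * k + 4) (3 * k + 1) u s E PP.n PP.purplePairs p q Apu≡ 2E≤Au
            (halve-density k u s a N E PP.n PP.purplePairs PP.totalDensity a+s≡2u refl PP.totalDensity-≥ PP.purplePairs-≥))
      }

pattern-exists : ∀ k p q E → 1 ≤ p → 1 ≤ E → p * (3 * k + 4) < q → Pattern k p q E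
pattern-exists k p q E p≥1 E≥1 pA<q = Build.colouring-pattern (geometry-exists L E L≥1 E≥1)
  where
  open Parameters k p q E (pred (p * (3 * k + 4) * E)) (≤-trans (s≤s z≤n) pA<q) E≥1 pA<q
    (suc-pred (p * (3 * k + 4) * E) {{>-nonZero (*-mono-≤ (*-mono-≤ p≥1 (m≤n⇒m≤o+n (3 * k) (s≤s z≤n))) E≥1)}})

-- Blow-ups

∑-tabulate : ∀ n (h : Fin n → A) (h′ : ℕ → A) → (∀ i → h i ≡ h′ (toℕ i)) → (f : A → ℕ) →
             ∑ (tabulate h) f ≡ ∑ (upTo n) (f ∘ h′)
∑-tabulate zero    h h′ eq f = refl
∑-tabulate (suc n) h h′ eq f = trans (cong₂ _+_ (cong f (eq zero)) (∑-tabulate n (h ∘ suc) (h′ ∘ suc) (eq ∘ suc) f))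
  (sym (∑-upTo-suc n (f ∘ h′)))

∑-allFin : ∀ n (f : ℕ → ℕ) → ∑ (allFin n) (f ∘ toℕ) ≡ ∑ (upTo n) f
∑-allFin n f = trans (cong sum (trans (map-tabulate {n = n} id (f ∘ toℕ)) (sym (map-tabulate toℕ f))))
  (∑-tabulate n toℕ id (λ _ → refl) f)

injection-≤ : ∀ {t n} (f : Fin t → Fin n) → Injective _≡_ _≡_ f → (φ : Fin n → ℕ) → (∀ a → 1 ≤ φ (f a)) → t ≤ ∑ (allFin n) φ
injection-≤ {t} {n} f inj φ φ≥1 = begin
  t                                                                ≡⟨ trans (sym (length-allFin t)) (trans (length-∑ (allFin t)) (∑-cong (allFin t) (λ a → sym (∑-ind-≟ (f a))))) ⟩
  ∑ (allFin t) (λ a → ∑ (allFin n) (λ j → ind (f a Fin.≟ j)))      ≡⟨ ∑-swap (allFin t) (allFin n) _ ⟩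
  ∑ (allFin n) (λ j → ∑ (allFin t) (λ a → ind (f a Fin.≟ j)))      ≤⟨ ∑-mono (allFin n) fibre-≤ ⟩
  ∑ (allFin n) φ                                                   ∎
  where
  open ≤-Reasoning
  fibre-≤ : ∀ j → ∑ (allFin t) (λ a → ind (f a Fin.≟ j)) ≤ φ j
  fibre-≤ j with 1 ≤? ∑ (allFin t) (λ a → ind (f a Fin.≟ j))
  ... | no ¬p = ≤-trans (≤-reflexive (n<1⇒n≡0 (≰⇒> ¬p))) z≤n
  ... | yes p with ∑-positive (allFin t) (λ a → ind (f a Fin.≟ j)) p
  ...   | a , _ , hit = ≤-trans
          (∑-exclusive (allFin⁺ t) (λ a → ind (f a Fin.≟ j)) 1 (λ a → ind≤1 (f a Fin.≟ j))
            (λ {a} {b} pa pb → inj (trans (ind⇒ (f a Fin.≟ j) pa) (sym (ind⇒ (f b Fin.≟ j) pb)))))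
          (subst (λ z → 1 ≤ φ z) (ind⇒ (f a Fin.≟ j) hit) (φ≥1 a))

∑-upTo-periodic : ∀ W (f : ℕ → ℕ) → (∀ j → f (W + j) ≡ f j) → ∀ m → ∑ (upTo (m * W)) f ≡ m * ∑ (upTo W) f
∑-upTo-periodic W f per zero    = refl
∑-upTo-periodic W f per (suc m) = trans (∑-upTo-+ W (m * W) f)
  (cong (∑ (upTo W) f +_) (trans (∑-cong (upTo (m * W)) per) (∑-upTo-periodic W f per m)))

∑-upTo-mono : ∀ {m n} (f : ℕ → ℕ) → m ≤ n → ∑ (upTo m) f ≤ ∑ (upTo n) f
∑-upTo-mono {m} {n} f m≤n = ≤-trans (m≤m+n _ _)
  (≤-reflexive (sym (trans (cong (λ z → ∑ (upTo z) f) (sym (m+[n∸m]≡n m≤n))) (∑-upTo-+ m (n ∸ m) f))))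

module BlowUp {k p q E : ℕ} (P : Pattern k p q E) where
  open Pattern P

  instance
    W≢0 : NonZero W
    W≢0 = >-nonZero cells≥1

  -- Cells are handed out periodically by index, so any W consecutive vertices see each entry of
  -- `cells` once, repetitions included.
  cell : ℕ → Cell
  cell j = lookup cells (j mod W)

  toℕ-mod : ∀ (i : Fin W) → toℕ i mod W ≡ i
  toℕ-mod i = Finₚ.toℕ-injective (trans (Finₚ.toℕ-fromℕ< (m%n<n (toℕ i) W)) (m<n⇒m%n≡m (Finₚ.toℕ<n i)))

  cell-periodic : ∀ j → cell (W + j) ≡ cell j
  cell-periodic j = cong (lookup cells) (Finₚ.toℕ-injective (trans (Finₚ.toℕ-fromℕ< (m%n<n (W + j) W))
    (trans (cong (_% W) (+-comm W j)) (trans ([m+n]%n≡m%n j W) (sym (Finₚ.toℕ-fromℕ< (m%n<n j W)))))))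

  ∑-period : (f : Cell → ℕ) → ∑ (upTo W) (f ∘ cell) ≡ ∑ cells f
  ∑-period f = trans (sym (∑-tabulate W (lookup cells) cell (λ i → cong (lookup cells) (sym (toℕ-mod i))) f))
    (cong (λ cs → ∑ cs f) (tabulate-lookup cells))

  ∑-periods : (f : Cell → ℕ) → ∀ m → ∑ (upTo (m * W)) (f ∘ cell) ≡ m * ∑ cells f
  ∑-periods f m = trans (∑-upTo-periodic W (f ∘ cell) (λ j → cong f (cell-periodic j)) m) (cong (m *_) (∑-period f))

  module _ (n : ℕ) where

    b : ℕ
    b = n / W

    n≡ : n ≡ n % W + b * W
    n≡ = m≡m%n+[m/n]*n n W

    bW≤n : b * W ≤ n
    bW≤n = ≤-trans (m≤n+m (b * W) (n % W)) (≤-reflexive (sym n≡))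

    n≤[1+b]W : n ≤ suc b * W
    n≤[1+b]W = ≤-trans (≤-reflexive n≡) (+-monoˡ-≤ (b * W) (<⇒≤ (m%n<n n W)))

    χ : Colouring n
    χ = record { colour = λ i j → col (cell (toℕ i)) (cell (toℕ j)) ; symm = λ i j → col-sym (cell (toℕ i)) (cell (toℕ j)) }

    RP-free : RPCliqueFree (2 * (2 + k)) χ
    RP-free (f , _ , adj) = <⇒≱ (≤-reflexive (eq k))
      (≤-trans (≤-reflexive (sym (length-tabulate (λ a → cell (toℕ (f a))))))
        (clique-≤ (tabulate (λ a → cell (toℕ (f a)))) (AllPairsₚ.tabulate⁺ (λ {a} {a′} → adj a a′))))
      where
      eq : ∀ k → suc (3 + 2 * k) ≡ 2 * (2 + k)
      eq = solve-∀

    -- The strict integer inequality of `independent-<` gains 1 in each of the b + 1 periods that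
    -- cover the vertices. The incomplete period costs at most pW, so a large number of periods
    -- decides.
    BP-free : p * W ≤ b → ∀ t → p * n ≤ q * t → BPCliqueFree t χ
    BP-free pW≤b t pn≤qt (f , inj , adj) = <⇒≱ (≤-<-trans pW≤b (n<1+n b)) (+-cancelˡ-≤ (b * (p * W)) (suc b) (p * W) (begin
      b * (p * W) + suc b               ≡⟨ cong (_+ suc b) (eq b p W) ⟩
      p * (b * W) + suc b               ≤⟨ +-monoˡ-≤ (suc b) (≤-trans (*-monoʳ-≤ p bW≤n) pn≤qt) ⟩
      q * t + suc b                     ≤⟨ +-monoˡ-≤ (suc b) (*-monoʳ-≤ q t≤) ⟩
      q * (suc b * S) + suc b           ≡⟨ eq′ q (suc b) S ⟩
      suc b * suc (q * S)               ≤⟨ *-monoʳ-≤ (suc b) (independent-< I indep) ⟩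
      suc b * (p * W)                   ≡⟨ +-comm (p * W) (b * (p * W)) ⟩
      b * (p * W) + p * W               ∎))
      where
      open ≤-Reasoning
      eq : ∀ b p W → b * (p * W) ≡ p * (b * W)
      eq = solve-∀
      eq′ : ∀ q b S → q * (b * S) + b ≡ b * suc (q * S)
      eq′ = solve-∀
      I : List Cell
      I = tabulate (λ a → cell (toℕ (f a)))
      S = sizeIn _≟ᶜ_ cells I
      φ : Cell → ℕ
      φ u = ind (member? _≟ᶜ_ u I)
      ¬red : ∀ {c} → InBP c → c ≢ red
      ¬red (inj₁ refl) ()
      ¬red (inj₂ refl) ()
      indep : ∀ {u v} → u ∈ I → v ∈ I → col u v ≢ red
      indep u∈ v∈ with ∈-tabulate⁻ u∈ | ∈-tabulate⁻ v∈
      ... | a , refl | a′ , refl with a Fin.≟ a′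
      ...   | yes refl = λ eq → blue≢red (trans (sym (col-diagonal (cell (toℕ (f a))))) eq)
        where
        blue≢red : blue ≢ red
        blue≢red ()
      ...   | no a≢a′ = ¬red (adj a a′ a≢a′)
      t≤ : t ≤ suc b * S
      t≤ = begin
        t                                      ≤⟨ injection-≤ f inj (φ ∘ cell ∘ toℕ) (λ a → ≤-reflexive (sym (ind-yes (member? _≟ᶜ_ _ I) (∈-tabulate⁺ a)))) ⟩
        ∑ (allFin n) (φ ∘ cell ∘ toℕ)          ≡⟨ ∑-allFin n (φ ∘ cell) ⟩
        ∑ (upTo n) (φ ∘ cell)                  ≤⟨ ∑-upTo-mono (φ ∘ cell) n≤[1+b]W ⟩
        ∑ (upTo (suc b * W)) (φ ∘ cell)        ≡⟨ ∑-periods φ (suc b) ⟩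
        suc b * S                              ∎

    -- Only complete periods are used for the lower bound. Ordered pairs count every edge twice, and
    -- pairs with equal vertices contribute nothing since `col` is blue on the diagonal.
    b²P≤2count : b * (b * purplePairs) ≤ 2 * purpleCount χ
    b²P≤2count = begin
      b * (b * purplePairs)
        ≡⟨ cong (b *_) (∑-*ˡ cells b _) ⟨
      b * ∑ cells (λ u → b * ∑ cells (λ v → purple# (col u v)))
        ≡⟨ ∑-periods (λ u → b * ∑ cells (λ v → purple# (col u v))) b ⟨
      ∑ (upTo (b * W)) (λ i → b * ∑ cells (λ v → purple# (col (cell i) v)))
        ≤⟨ ∑-upTo-mono _ bW≤n ⟩
      ∑ (upTo n) (λ i → b * ∑ cells (λ v → purple# (col (cell i) v)))
        ≤⟨ ∑-mono (upTo n) (λ i → ≤-trans (≤-reflexive (sym (∑-periods (λ v → purple# (col (cell i) v)) b))) (∑-upTo-mono _ bW≤n)) ⟩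
      ∑ (upTo n) (λ i → ∑ (upTo n) (λ j → purple# (col (cell i) (cell j))))
        ≡⟨ trans (∑-cong (allFin n) (λ i → ∑-allFin n (λ j → purple# (col (cell (toℕ i)) (cell j))))) (∑-allFin n (λ i → ∑ (upTo n) (λ j → purple# (col (cell i) (cell j))))) ⟨
      ∑ (allFin n) (λ i → ∑ (allFin n) (λ j → purple# (c i j)))
        ≤⟨ ∑-mono (allFin n) (λ i → ∑-mono (allFin n) (λ j → split i j)) ⟩
      ∑ (allFin n) (λ i → ∑ (allFin n) (λ j → lt i j + lt j i))
        ≡⟨ trans (∑-cong (allFin n) (λ i → ∑-+ (allFin n) (lt i) (λ j → lt j i))) (∑-+ (allFin n) _ _) ⟩
      purpleCount χ + ∑ (allFin n) (λ i → ∑ (allFin n) (λ j → lt j i))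
        ≡⟨ cong (purpleCount χ +_) (trans (∑-swap (allFin n) (allFin n) (λ i j → lt j i)) (sym (+-identityʳ _))) ⟩
      2 * purpleCount χ ∎
      where
      open ≤-Reasoning
      c : Fin n → Fin n → Colour
      c = colour χ
      lt : Fin n → Fin n → ℕ
      lt i j = if (toℕ i <ᵇ toℕ j) ∧ isPurple (c i j) then 1 else 0
      lt-< : ∀ i j → toℕ i < toℕ j → lt i j ≡ purple# (c i j)
      lt-< i j i<j with toℕ i <ᵇ toℕ j | <⇒<ᵇ i<j
      ... | true | _ = refl
      split : ∀ i j → purple# (c i j) ≤ lt i j + lt j i
      split i j with <-cmp (toℕ i) (toℕ j)
      ... | tri< i<j _ _ = ≤-trans (≤-reflexive (sym (lt-< i j i<j))) (m≤m+n _ _)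
      ... | tri> _ _ j<i = ≤-trans (≤-reflexive (trans (cong purple# (symm χ i j)) (sym (lt-< j i j<i)))) (m≤n+m _ (lt i j))
      ... | tri≈ _ i≡j _ = ≤-trans (≤-reflexive (cong purple# (trans (cong (λ z → col (cell (toℕ i)) (cell z)) (sym i≡j)) (col-diagonal (cell (toℕ i)))))) z≤n

    purplePairs≤W² : purplePairs ≤ W * W
    purplePairs≤W² = ≤-trans (∑-mono cells (λ u → ∑-mono cells (λ v → purple#≤1 (col u v))))
      (≤-reflexive (trans (∑-cong cells (λ _ → sym (length-∑ cells))) (∑-const cells W)))
      where
      purple#≤1 : ∀ c → purple# c ≤ 1
      purple#≤1 red    = z≤n
      purple#≤1 blue   = z≤n
      purple#≤1 purple = ≤-refl

    n²≤ : n * n ≤ b * b * (W * W) + 3 * (n * W)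
    n²≤ = begin
      n * n                                     ≡⟨ cong₂ _*_ n≡ n≡ ⟩
      (r + b * W) * (r + b * W)                 ≡⟨ eq₁ r b W ⟩
      b * b * (W * W) + (r * r + 2 * (b * W * r)) ≤⟨ +-monoʳ-≤ (b * b * (W * W)) (+-mono-≤ (*-mono-≤ r≤n r≤W) (*-monoʳ-≤ 2 (*-mono-≤ bW≤n r≤W))) ⟩
      b * b * (W * W) + (n * W + 2 * (n * W))   ∎
      where
      open ≤-Reasoning
      r = n % W
      r≤W : r ≤ W
      r≤W = <⇒≤ (m%n<n n W)
      r≤n : r ≤ n
      r≤n = ≤-trans (m≤m+n r (b * W)) (≤-reflexive (sym n≡))
      eq₁ : ∀ r b W → (r + b * W) * (r + b * W) ≡ b * b * (W * W) + (r * r + 2 * (b * W * r))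
      eq₁ = solve-∀

    -- The incomplete period loses at most 3nW from n², which is at most n²/E for these n. The error
    -- 2/E of the pattern thereby becomes 3/E.
    purple-dense : 3 * W * E ≤ n →
      n * n * (E * ((3 * k + 1) * (q * q) + (3 * k + 4) * (p * q)))
      ≤ 2 * ((3 * k + 4) * (q * q)) * (E * purpleCount χ) + n * n * (E * ((3 * k + 4) * (p * p)) + 3 * ((3 * k + 4) * (q * q)))
    purple-dense 3WE≤n = *-cancelˡ-≤ (W * W) {{>-nonZero (*-mono-≤ cells≥1 cells≥1)}} (begin
      W * W * (n * n * (E * G))                       ≡⟨ eq₁ W n E G ⟩
      n * n * (W * W * E * G)                         ≤⟨ *-monoʳ-≤ (n * n) purplePairs-≥ ⟩
      n * n * (Q * (E * purplePairs) + W * W * E * H + 2 * (W * W) * Q)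
        ≡⟨ eq₂ n Q E purplePairs W H ⟩
      Q * E * (n * n * purplePairs) + n * n * (W * W) * (E * H + 2 * Q)
        ≤⟨ +-monoˡ-≤ (n * n * (W * W) * (E * H + 2 * Q)) (*-monoʳ-≤ (Q * E) n²P≤) ⟩
      Q * E * (W * W * (2 * purpleCount χ) + 3 * (n * W) * (W * W)) + n * n * (W * W) * (E * H + 2 * Q)
        ≡⟨ eq₃ Q E W (purpleCount χ) n H ⟩
      W * W * (2 * Q * (E * purpleCount χ)) + W * W * Q * (n * (3 * W * E)) + n * n * (W * W) * (E * H + 2 * Q)
        ≤⟨ +-monoˡ-≤ (n * n * (W * W) * (E * H + 2 * Q)) (+-monoʳ-≤ (W * W * (2 * Q * (E * purpleCount χ))) (*-monoʳ-≤ (W * W * Q) (*-monoʳ-≤ n 3WE≤n))) ⟩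
      W * W * (2 * Q * (E * purpleCount χ)) + W * W * Q * (n * n) + n * n * (W * W) * (E * H + 2 * Q)
        ≡⟨ eq₄ W Q E (purpleCount χ) n H ⟩
      W * W * (2 * Q * (E * purpleCount χ) + n * n * (E * H + 3 * Q)) ∎)
      where
      open ≤-Reasoning
      G = (3 * k + 1) * (q * q) + (3 * k + 4) * (p * q)
      H = (3 * k + 4) * (p * p)
      Q = (3 * k + 4) * (q * q)
      n²P≤ : n * n * purplePairs ≤ W * W * (2 * purpleCount χ) + 3 * (n * W) * (W * W)
      n²P≤ = begin
        n * n * purplePairs                                     ≤⟨ *-monoˡ-≤ purplePairs n²≤ ⟩
        (b * b * (W * W) + 3 * (n * W)) * purplePairs           ≡⟨ eq b (W * W) (3 * (n * W)) purplePairs ⟩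
        W * W * (b * (b * purplePairs)) + 3 * (n * W) * purplePairs
          ≤⟨ +-mono-≤ (*-monoʳ-≤ (W * W) b²P≤2count) (*-monoʳ-≤ (3 * (n * W)) purplePairs≤W²) ⟩
        W * W * (2 * purpleCount χ) + 3 * (n * W) * (W * W)     ∎
        where
        eq : ∀ b W z P → (b * b * W + z) * P ≡ W * (b * (b * P)) + z * P
        eq = solve-∀
      eq₁ : ∀ W n E G → W * W * (n * n * (E * G)) ≡ n * n * (W * W * E * G)
      eq₁ = solve-∀
      eq₂ : ∀ n Q E P W H → n * n * (Q * (E * P) + W * W * E * H + 2 * (W * W) * Q) ≡ Q * E * (n * n * P) + n * n * (W * W) * (E * H + 2 * Q)
      eq₂ = solve-∀
      eq₃ : ∀ Q E W c n H → Q * E * (W * W * (2 * c) + 3 * (n * W) * (W * W)) + n * n * (W * W) * (E * H + 2 * Q)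
        ≡ W * W * (2 * Q * (E * c)) + W * W * Q * (n * (3 * W * E)) + n * n * (W * W) * (E * H + 2 * Q)
      eq₃ = solve-∀
      eq₄ : ∀ W Q E c n H → W * W * (2 * Q * (E * c)) + W * W * Q * (n * n) + n * n * (W * W) * (E * H + 2 * Q)
        ≡ W * W * (2 * Q * (E * c) + n * n * (E * H + 3 * Q))
      eq₄ = solve-∀

  pW≤b : ∀ n → p * W * W ≤ n → p * W ≤ b n
  pW≤b n pWW≤n = ≤-trans (≤-reflexive (sym (m*n/n≡m (p * W) W))) (/-mono-≤ pWW≤n (≤-refl {W}))

finite-theorem : ∀ k p q E → 1 ≤ p → 1 ≤ E → p * (3 * k + 4) < q →
  ∃ λ (N : ℕ) → ∀ n → N ≤ n → Σ (Colouring n) λ χ →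
    RPCliqueFree (2 * (2 + k)) χ × (∀ t → p * n ≤ q * t → BPCliqueFree t χ) ×
    n * n * (E * ((3 * k + 1) * (q * q) + (3 * k + 4) * (p * q)))
      ≤ 2 * ((3 * k + 4) * (q * q)) * (E * purpleCount χ) + n * n * (E * ((3 * k + 4) * (p * p)) + 3 * ((3 * k + 4) * (q * q)))
finite-theorem k p q E p≥1 E≥1 pA<q = 3 * W * E + p * W * W , λ n N≤n →
  χ n , RP-free n , BP-free n (pW≤b n (≤-trans (m≤n+m (p * W * W) (3 * W * E)) N≤n)) ,
  purple-dense n (≤-trans (m≤m+n (3 * W * E) (p * W * W)) N≤n)
  where
  P = pattern-exists k p q E p≥1 E≥1 pA<q
  open Pattern P using (W)
  open BlowUp P

-- Rational arithmetic

ceiling-≥ : ∀ x → ℚ.↥ x ℤ.≤ ℚ.ceiling x ℤ.* ℚ.↧ x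
ceiling-≥ x@record{} = subst₂ ℤ._≤_ (trans (cong ℤ.-_ (ℚₚ.↥-neg x)) (ℤₚ.neg-involutive (ℚ.↥ x)))
  (trans (ℤₚ.neg-distribˡ-* (ℚ.floor (ℚ.- x)) (ℚ.↧ (ℚ.- x))) (cong (ℚ.ceiling x ℤ.*_) (ℚₚ.↧-neg x)))
  (ℤₚ.neg-mono-≤ (floor-≤ (ℚ.- x)))
  where
  floor-≤ : ∀ y → ℚ.floor y ℤ.* ℚ.↧ y ℤ.≤ ℚ.↥ y
  floor-≤ y@record{} = ℤ-DivMod.[n/d]*d≤n (ℚ.↥ y) (ℚ.↧ y)

i≤∣i∣ : ∀ i → i ℤ.≤ ℤ.+ ℤ.∣ i ∣
i≤∣i∣ (ℤ.+ n)      = ℤₚ.≤-refl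
i≤∣i∣ (ℤ.-[1+ n ]) = ℤ.-≤+

toℚᵘ-/ : ∀ a b → ℚ.toℚᵘ (ℤ.+ a ℚ./ suc b) ℚᵘ.≃ mkℚᵘ (ℤ.+ a) b
toℚᵘ-/ a b = ℚₚ.toℚᵘ-fromℚᵘ (mkℚᵘ (ℤ.+ a) b)

≃⇒cross : ∀ x {a b} → ℚ.toℚᵘ x ℚᵘ.≃ mkℚᵘ a b → ℚ.↥ x ℤ.* ℤ.+ suc b ≡ a ℤ.* ℚ.↧ x
≃⇒cross record{} (ℚᵘ.*≡* eq) = eq

module _ (p q-1 : ℕ) .(coprime : Coprime p (suc q-1)) where

  private
    q = suc q-1
    c : ℚ
    c = mkℚ (ℤ.+ p) q-1 coprime

  toℚᵘ-c*n : ∀ n → ℚ.toℚᵘ (c ℚ.* ℕtoℚ n) ℚᵘ.≃ mkℚᵘ (ℤ.+ p) q-1 ℚᵘ.* mkℚᵘ (ℤ.+ n) 0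
  toℚᵘ-c*n n = ℚᵘₚ.≃-trans (ℚₚ.toℚᵘ-homo-* c (ℕtoℚ n)) (ℚᵘₚ.*-congˡ {mkℚᵘ (ℤ.+ p) q-1} (toℚᵘ-/ n 0))

  c*n<1⇒ : ∀ n → c ℚ.* ℕtoℚ n ℚ.< 1ℚ → p * n < q
  c*n<1⇒ n lt with ℚᵘₚ.<-respˡ-≃ (toℚᵘ-c*n n) (ℚₚ.toℚᵘ-mono-< lt)
  ... | ℚᵘ.*<* lt′ = ℤₚ.drop‿+<+ (subst₂ ℤ._<_
      (trans (ℤₚ.*-identityʳ _) (sym (ℤₚ.pos-* p n)))
      (trans (ℤₚ.*-identityˡ _) (cong ℤ.+_ (*-identityʳ q))) lt′)

  p*n≤q*⌈c*n⌉ : ∀ n → p * n ≤ q * ceilℕ (c ℚ.* ℕtoℚ n)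
  p*n≤q*⌈c*n⌉ n = ℤₚ.drop‿+≤+ (begin
    ℤ.+ (p * n)               ≤⟨ ℤₚ.*-cancelʳ-≤-pos (ℤ.+ (p * n)) (ℤ.+ q ℤ.* z) (ℚ.↧ x) scaled ⟩
    ℤ.+ q ℤ.* z               ≤⟨ ℤₚ.*-monoˡ-≤-nonNeg (ℤ.+ q) (i≤∣i∣ z) ⟩
    ℤ.+ q ℤ.* ℤ.+ ℤ.∣ z ∣     ≡⟨ ℤₚ.pos-* q ℤ.∣ z ∣ ⟨
    ℤ.+ (q * ℤ.∣ z ∣)         ∎)
    where
    open ℤₚ.≤-Reasoning
    x = c ℚ.* ℕtoℚ n
    z = ℚ.ceiling x
    scaled : ℤ.+ (p * n) ℤ.* ℚ.↧ x ℤ.≤ (ℤ.+ q ℤ.* z) ℤ.* ℚ.↧ x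
    scaled = begin
      ℤ.+ (p * n) ℤ.* ℚ.↧ x             ≡⟨ cong (ℤ._* ℚ.↧ x) (ℤₚ.pos-* p n) ⟩
      ℤ.+ p ℤ.* ℤ.+ n ℤ.* ℚ.↧ x         ≡⟨ ≃⇒cross x (toℚᵘ-c*n n) ⟨
      ℚ.↥ x ℤ.* ℤ.+ (q * 1)             ≡⟨ cong (λ m → ℚ.↥ x ℤ.* ℤ.+ m) (*-identityʳ q) ⟩
      ℚ.↥ x ℤ.* ℤ.+ q                   ≤⟨ ℤₚ.*-monoʳ-≤-nonNeg (ℤ.+ q) (ceiling-≥ x) ⟩
      (z ℤ.* ℚ.↧ x) ℤ.* ℤ.+ q           ≡⟨ rearrange z (ℚ.↧ x) (ℤ.+ q) ⟩
      (ℤ.+ q ℤ.* z) ℤ.* ℚ.↧ x           ∎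
      where
      rearrange : ∀ a b c → a ℤ.* b ℤ.* c ≡ c ℤ.* a ℤ.* b
      rearrange = ℤ-Ring.solve-∀

  module _ (d-1 B e f-1 : ℕ) .(coprime′ : Coprime e (suc f-1)) where

    private
      d = suc d-1
      f = suc f-1
      ε : ℚ
      ε = mkℚ (ℤ.+ e) f-1 coprime′

    cast-bound : ∀ n count →
      n * n * (f * (B * (q * q) + d * (p * q))) ≤ 2 * (d * (q * q)) * (f * count) + n * n * (f * (d * (p * p)) + e * (d * (q * q))) →
      (½ ℚ.* (((ratℕ B d ℚ.+ c) ℚ.- c ℚ.* c) ℚ.- ε)) ℚ.* (ℕtoℚ n ℚ.* ℕtoℚ n) ℚ.≤ ℕtoℚ count
    cast-bound n count bound = ℚₚ.toℚᵘ-cancel-≤ (ℚᵘₚ.≤-respˡ-≃ (ℚᵘₚ.≃-sym lhs≃) (ℚᵘₚ.≤-respʳ-≃ (ℚᵘₚ.≃-sym (toℚᵘ-/ count 0)) (ℚᵘ.*≤* cross-multiplied)))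
      where
      cᵘ εᵘ ρᵘ nᵘ : ℚᵘ
      cᵘ = mkℚᵘ (ℤ.+ p) q-1
      εᵘ = mkℚᵘ (ℤ.+ e) f-1
      ρᵘ = mkℚᵘ (ℤ.+ B) d-1
      nᵘ = mkℚᵘ (ℤ.+ n) 0
      lhsᵘ : ℚᵘ
      lhsᵘ = (ℚᵘ.½ ℚᵘ.* (((ρᵘ ℚᵘ.+ cᵘ) ℚᵘ.- cᵘ ℚᵘ.* cᵘ) ℚᵘ.- εᵘ)) ℚᵘ.* (nᵘ ℚᵘ.* nᵘ)
      lhs≃ : ℚ.toℚᵘ ((½ ℚ.* (((ratℕ B d ℚ.+ c) ℚ.- c ℚ.* c) ℚ.- ε)) ℚ.* (ℕtoℚ n ℚ.* ℕtoℚ n)) ℚᵘ.≃ lhsᵘ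
      lhs≃ = ℚᵘₚ.≃-trans (ℚₚ.toℚᵘ-homo-* (½ ℚ.* inner) (ℕtoℚ n ℚ.* ℕtoℚ n)) (ℚᵘₚ.*-cong
        (ℚᵘₚ.≃-trans (ℚₚ.toℚᵘ-homo-* ½ inner) (ℚᵘₚ.*-congˡ {ℚᵘ.½} inner≃))
        (ℚᵘₚ.≃-trans (ℚₚ.toℚᵘ-homo-* (ℕtoℚ n) (ℕtoℚ n)) (ℚᵘₚ.*-cong (toℚᵘ-/ n 0) (toℚᵘ-/ n 0))))
        where
        inner : ℚ
        inner = ((ratℕ B d ℚ.+ c) ℚ.- c ℚ.* c) ℚ.- ε
        inner≃ : ℚ.toℚᵘ inner ℚᵘ.≃ ((ρᵘ ℚᵘ.+ cᵘ) ℚᵘ.- cᵘ ℚᵘ.* cᵘ) ℚᵘ.- εᵘ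
        inner≃ = ℚᵘₚ.≃-trans (ℚₚ.toℚᵘ-homo-+ ((ratℕ B d ℚ.+ c) ℚ.- c ℚ.* c) (ℚ.- ε)) (ℚᵘₚ.+-cong
          (ℚᵘₚ.≃-trans (ℚₚ.toℚᵘ-homo-+ (ratℕ B d ℚ.+ c) (ℚ.- (c ℚ.* c))) (ℚᵘₚ.+-cong
            (ℚᵘₚ.≃-trans (ℚₚ.toℚᵘ-homo-+ (ratℕ B d) c) (ℚᵘₚ.+-congˡ cᵘ (toℚᵘ-/ B d-1)))
            (ℚᵘₚ.≃-trans (ℚₚ.toℚᵘ-homo‿- (c ℚ.* c)) (ℚᵘₚ.-‿cong (ℚₚ.toℚᵘ-homo-* c c)))))
          (ℚₚ.toℚᵘ-homo‿- ε))
      ⟦_⟧ : ℕ → ℤ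
      ⟦ m ⟧ = ℤ.+ m
      U V Z : ℤ
      U = ⟦ n ⟧ ℤ.* ⟦ n ⟧ ℤ.* (⟦ f ⟧ ℤ.* (⟦ B ⟧ ℤ.* (⟦ q ⟧ ℤ.* ⟦ q ⟧) ℤ.+ ⟦ d ⟧ ℤ.* (⟦ p ⟧ ℤ.* ⟦ q ⟧)))
      V = ⟦ 2 ⟧ ℤ.* (⟦ d ⟧ ℤ.* (⟦ q ⟧ ℤ.* ⟦ q ⟧)) ℤ.* (⟦ f ⟧ ℤ.* ⟦ count ⟧)
      Z = ⟦ n ⟧ ℤ.* ⟦ n ⟧ ℤ.* (⟦ f ⟧ ℤ.* (⟦ d ⟧ ℤ.* (⟦ p ⟧ ℤ.* ⟦ p ⟧)) ℤ.+ ⟦ e ⟧ ℤ.* (⟦ d ⟧ ℤ.* (⟦ q ⟧ ℤ.* ⟦ q ⟧)))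
      infixr 7 _⊛_
      _⊛_ : ∀ {a b i j} → ⟦ a ⟧ ≡ i → ⟦ b ⟧ ≡ j → ⟦ a * b ⟧ ≡ i ℤ.* j
      _⊛_ {a} {b} refl refl = ℤₚ.pos-* a b
      infixr 6 _⊞_
      _⊞_ : ∀ {a b i j} → ⟦ a ⟧ ≡ i → ⟦ b ⟧ ≡ j → ⟦ a + b ⟧ ≡ i ℤ.+ j
      refl ⊞ refl = refl
      ! : ∀ {a} → ⟦ a ⟧ ≡ ⟦ a ⟧
      ! = refl
      U≤V+Z : U ℤ.≤ V ℤ.+ Z
      U≤V+Z = subst₂ ℤ._≤_
        ((! {n} ⊛ ! {n}) ⊛ (! {f} ⊛ (! {B} ⊛ ! {q} ⊛ ! {q} ⊞ ! {d} ⊛ ! {p} ⊛ ! {q})))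
        ((! {2} ⊛ (! {d} ⊛ ! {q} ⊛ ! {q})) ⊛ (! {f} ⊛ ! {count})
          ⊞ (! {n} ⊛ ! {n}) ⊛ (! {f} ⊛ ! {d} ⊛ ! {p} ⊛ ! {p} ⊞ ! {e} ⊛ ! {d} ⊛ ! {q} ⊛ ! {q}))
        (ℤ.+≤+ bound)
      cross-multiplied : ℚᵘ.↥ lhsᵘ ℤ.* ℤ.1ℤ ℤ.≤ ⟦ count ⟧ ℤ.* ℚᵘ.↧ lhsᵘ
      cross-multiplied = subst₂ ℤ._≤_
        (numerators ⟦ n ⟧ ⟦ f ⟧ ⟦ B ⟧ ⟦ q ⟧ ⟦ d ⟧ ⟦ p ⟧ ⟦ e ⟧)
        (denominators ⟦ q ⟧ ⟦ d ⟧ ⟦ f ⟧ ⟦ count ⟧)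
        -- The unreduced denominator of the left side is 2dq³f, one factor `q` more than in `bound`.
        (ℤₚ.*-monoˡ-≤-nonNeg ⟦ q ⟧ (ℤₚ.≤-trans (ℤₚ.+-monoˡ-≤ (ℤ.- Z) U≤V+Z) (ℤₚ.≤-reflexive (cancel V Z))))
        where
        cancel : ∀ v z → v ℤ.+ z ℤ.+ ℤ.- z ≡ v
        cancel = ℤ-Ring.solve-∀
        numerators : ∀ n f B q d p e →
          q ℤ.* (n ℤ.* n ℤ.* (f ℤ.* (B ℤ.* (q ℤ.* q) ℤ.+ d ℤ.* (p ℤ.* q)))
            ℤ.+ ℤ.- (n ℤ.* n ℤ.* (f ℤ.* (d ℤ.* (p ℤ.* p)) ℤ.+ e ℤ.* (d ℤ.* (q ℤ.* q)))))
          ≡ ((ℤ.1ℤ ℤ.* ((((B ℤ.* q ℤ.+ p ℤ.* d) ℤ.* (q ℤ.* q)) ℤ.+ (ℤ.- (p ℤ.* p)) ℤ.* (d ℤ.* q)) ℤ.* f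
              ℤ.+ (ℤ.- e) ℤ.* ((d ℤ.* q) ℤ.* (q ℤ.* q)))) ℤ.* (n ℤ.* n)) ℤ.* ℤ.1ℤ
        numerators = ℤ-Ring.solve-∀
        denominators : ∀ q d f count →
          q ℤ.* (ℤ.+ 2 ℤ.* (d ℤ.* (q ℤ.* q)) ℤ.* (f ℤ.* count))
          ≡ count ℤ.* ((ℤ.+ 2 ℤ.* ((d ℤ.* q) ℤ.* (q ℤ.* q) ℤ.* f)) ℤ.* ℤ.1ℤ)
        denominators = ℤ-Ring.solve-∀

theorem5p3 : (ℓ : ℕ) → 2 ≤ ℓ →
    (c : ℚ) → 0ℚ ℚ.< c → c ℚ.* ℕtoℚ (3 * ℓ ∸ 2) ℚ.< 1ℚ →
    (ε : ℚ) → 0ℚ ℚ.< ε →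
    ∃ λ (N : ℕ) → (n : ℕ) → N ≤ n →
      Σ (Colouring n) λ χ →
        Admissible (2 * ℓ) (ceilℕ (c ℚ.* ℕtoℚ n)) χ ×
        ((½ ℚ.* (ratℕ (3 * ℓ ∸ 5) (3 * ℓ ∸ 2) ℚ.+ c ℚ.- c ℚ.* c ℚ.- ε)) ℚ.* (ℕtoℚ n ℚ.* ℕtoℚ n)
          ℚ.≤ ℕtoℚ (purpleCount χ))
theorem5p3 _ _ (mkℚ (ℤ.+ 0) _ _) (ℚ.*<* (ℤ.+<+ ()))
theorem5p3 _ _ (mkℚ ℤ.-[1+ _ ] _ _) (ℚ.*<* ())
theorem5p3 _ _ _ _ _ (mkℚ (ℤ.+ 0) _ _) (ℚ.*<* (ℤ.+<+ ()))
theorem5p3 _ _ _ _ _ (mkℚ ℤ.-[1+ _ ] _ _) (ℚ.*<* ())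
theorem5p3 1 (s≤s ()) (mkℚ ℤ.+[1+ _ ] _ _) _ _ (mkℚ ℤ.+[1+ _ ] _ _) _
theorem5p3 (suc (suc k)) _ (mkℚ ℤ.+[1+ p-1 ] q-1 coprime) _ c*d<1 (mkℚ ℤ.+[1+ e-1 ] f-1 coprime′) _ =
  N , λ n N≤n → let χ , RP-free , BP-free , dense = large n N≤n in
    χ , (RP-free , BP-free (ceilℕ (c ℚ.* ℕtoℚ n)) (p*n≤q*⌈c*n⌉ p q-1 coprime n)) ,
    subst₂ (λ B d → (½ ℚ.* (ratℕ B d ℚ.+ c ℚ.- c ℚ.* c ℚ.- ε)) ℚ.* (ℕtoℚ n ℚ.* ℕtoℚ n) ℚ.≤ ℕtoℚ (purpleCount χ))
      (sym 3ℓ∸5≡) (sym 3ℓ∸2≡)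
      (cast-bound p q-1 coprime (3 * k + 3) (3 * k + 1) e f-1 coprime′ n (purpleCount χ) (rescale n (purpleCount χ) dense))
  where
  p = suc p-1
  q = suc q-1
  e = suc e-1
  f = suc f-1
  d = suc (3 * k + 3)
  c = mkℚ (ℤ.+ p) q-1 coprime
  ε = mkℚ (ℤ.+ e) f-1 coprime′
  3ℓ∸2≡ : 3 * suc (suc k) ∸ 2 ≡ d
  3ℓ∸2≡ = cong (_∸ 2) (eq k)
    where
    eq : ∀ k → 3 * suc (suc k) ≡ 2 + suc (3 * k + 3)
    eq = solve-∀
  3ℓ∸5≡ : 3 * suc (suc k) ∸ 5 ≡ 3 * k + 1
  3ℓ∸5≡ = cong (_∸ 5) (eq k)
    where
    eq : ∀ k → 3 * suc (suc k) ≡ 5 + (3 * k + 1)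
    eq = solve-∀
  3k+4≡d : 3 * k + 4 ≡ d
  3k+4≡d = +-suc (3 * k) 3
  -- With E = 3f the error 3/E is 1/f, at most e/f = ε.
  finite = finite-theorem k p q (3 * f) (s≤s z≤n) (s≤s z≤n)
    (subst (λ d → p * d < q) (trans 3ℓ∸2≡ (sym 3k+4≡d)) (c*n<1⇒ p q-1 coprime (3 * suc (suc k) ∸ 2) c*d<1))
  N = proj₁ finite
  large = proj₂ finite
  rescale : ∀ n count →
    n * n * (3 * f * ((3 * k + 1) * (q * q) + (3 * k + 4) * (p * q)))
      ≤ 2 * ((3 * k + 4) * (q * q)) * (3 * f * count) + n * n * (3 * f * ((3 * k + 4) * (p * p)) + 3 * ((3 * k + 4) * (q * q))) →
    n * n * (f * ((3 * k + 1) * (q * q) + d * (p * q)))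
      ≤ 2 * (d * (q * q)) * (f * count) + n * n * (f * (d * (p * p)) + e * (d * (q * q)))
  rescale n count bound rewrite 3k+4≡d = *-cancelˡ-≤ 3 (begin
    3 * (n * n * (f * G))                                                     ≡⟨ eq₁ (n * n) f G ⟩
    n * n * (3 * f * G)                                                       ≤⟨ bound ⟩
    2 * Q * (3 * f * count) + n * n * (3 * f * H + 3 * Q)                     ≤⟨ +-monoʳ-≤ (2 * Q * (3 * f * count))
                                                                                   (*-monoʳ-≤ (n * n) (+-monoʳ-≤ (3 * f * H) (*-monoʳ-≤ 3 (m≤m+n Q (e-1 * Q))))) ⟩
    2 * Q * (3 * f * count) + n * n * (3 * f * H + 3 * (e * Q))               ≡⟨ eq₂ Q f count (n * n) H (e * Q) ⟩
    3 * (2 * Q * (f * count) + n * n * (f * H + e * Q))                       ∎)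
    where
    open ≤-Reasoning
    G = (3 * k + 1) * (q * q) + d * (p * q)
    H = d * (p * p)
    Q = d * (q * q)
    eq₁ : ∀ m f G → 3 * (m * (f * G)) ≡ m * (3 * f * G)
    eq₁ = solve-∀
    eq₂ : ∀ Q f c m H e → 2 * Q * (3 * f * c) + m * (3 * f * H + 3 * e) ≡ 3 * (2 * Q * (f * c) + m * (f * H + e))
    eq₂ = solve-∀
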